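{- Let $p>3$ be a prime and, for $n\ge0$, let $T_n=\sum_{k=0}^n\binom{n}{k}^2\binom{2k}{n}^2$. Then $$\sum_{k=0}^{p-1}(2k+1)\frac{T_k}{4^k}\equiv p+\frac76p^4B_{p-3}\pmod{p^5}$$ and $$\sum_{k=0}^{p-1}(2k+1)\frac{T_k}{(-4)^k}\equiv(-1)^{(p-1)/2}p+p^3E_{p-3}\pmod{p^4},$$ where $B_{p-3}$ is the $(p-3)$th Bernoulli number and $E_{p-3}$ is the $(p-3)$th Euler number.
   Context: The Bernoulli numbers $B_n$ are the standard ones, defined by $\frac{t}{e^t-1}=\sum_{n\ge0}B_n\frac{t^n}{n!}$. The Euler numbers $E_n$ are defined by $\frac{2e^t}{e^{2t}+1}=\sum_{n=0}^\infty E_n\frac{t^n}{n!}$ for $|t|<\pi/2$. A congruence $a\equiv b\pmod{p^m}$ between rational numbers whose denominators are coprime to $p$ means that $(a-b)/p^m$ is a rational number whose denominator is coprime to $p$. -}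

module Defs where

open import Data.Nat as ℕ using (ℕ; zero; suc; _%_; _≡ᵇ_)
open import Data.Nat.Combinatorics using (_C_)
open import Data.Nat.Divisibility using (_∣_)
open import Data.Integer as ℤ using (ℤ; +_)
open import Data.Rational using (ℚ; 0ℚ; 1ℚ; _+_; _*_; _-_; -_; _/_)
open import Data.List using (List; []; _∷_; _++_; [_]; zipWith; upTo; foldr; foldl; map)
open import Data.Nat.ListAction using () renaming (sum to sumℕ)
open import Data.Bool using (if_then_else_)
open import Data.Product using (∃; _×_)
open import Relation.Nullary using (¬_)
open import Relation.Binary.PropositionalEquality using (_≡_)

ℕtoℚ : ℕ → ℚ
ℕtoℚ n = (+ n) / 1

ℤtoℚ : ℤ → ℚ
ℤtoℚ z = z / 1

sumℚ : List ℚ → ℚ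
sumℚ = foldr _+_ 0ℚ

Σ< : ℕ → (ℕ → ℚ) → ℚ
Σ< n f = sumℚ (map f (upTo n))

powℚ : ℚ → ℕ → ℚ
powℚ x zero = 1ℚ
powℚ x (suc n) = x * powℚ x n

lastℚ : List ℚ → ℚ
lastℚ = foldl (λ _ x → x) 0ℚ

-- Bernoulli numbers: [B_0, ..., B_n], via the recurrence
-- Σ_{k=0}^{m} C(m+1,k) B_k = 0 (m ≥ 1), B_0 = 1, equivalent to t/(e^t-1) = Σ B_n t^n/n!
bernoulliUpTo : ℕ → List ℚ
bernoulliUpTo zero = 1ℚ ∷ []
bernoulliUpTo (suc n) =
  let l = bernoulliUpTo n in
  l ++ [ - ((+ 1 / suc (suc n)) *
            sumℚ (zipWith (λ k b → ℕtoℚ (suc (suc n) C k) * b) (upTo (suc n)) l)) ]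

bernoulli : ℕ → ℚ
bernoulli n = lastℚ (bernoulliUpTo n)

-- Euler numbers: [E_0, ..., E_n], from sech t · cosh t = 1, i.e.
-- Σ_{j} C(n,2j) E_{n-2j} = [n = 0]; here 2e^t/(e^{2t}+1) = sech t.
-- E_n = - Σ_{k<n, k ≡ n mod 2} C(n,k) E_k
eulerUpTo : ℕ → List ℚ
eulerUpTo zero = 1ℚ ∷ []
eulerUpTo (suc n) =
  let l = eulerUpTo n in
  l ++ [ - sumℚ (zipWith (λ k e → if ((suc n ℕ.+ k) % 2 ≡ᵇ 0)
                                   then ℕtoℚ (suc n C k) * e else 0ℚ)
                         (upTo (suc n)) l) ]

euler : ℕ → ℚ
euler n = lastℚ (eulerUpTo n)

CongQ : ℚ → ℚ → ℕ → ℕ → Set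
CongQ a b p m = ∃ λ (u : ℤ) → ∃ λ (v : ℕ) →
  (¬ (p ∣ v)) × ((a - b) * ℕtoℚ v ≡ ℕtoℚ (p ℕ.^ m) * ℤtoℚ u)

T : ℕ → ℕ
T n = sumℕ (map (λ k → (n C k) ℕ.^ 2 ℕ.* ((2 ℕ.* k) C n) ℕ.^ 2) (upTo (suc n)))

{-# OPTIONS --safe #-}
module Submission where

-- Write p = 2m + 1.  By Zeilberger's algorithm T_n/4ⁿ and
--   Σ_k (n+2k)! / ((n-2k)! k!⁴ 16ᵏ)
-- satisfy the same recurrence of order two, hence agree.  In the second form
-- Σ_{n<p} (2n+1)(±1)ⁿ (n+2k)!/(n-2k)! telescopes, and the two sums become
--   p² Σ_k a_k f_k/(2k+1)   and   p Σ_k a_k f_k,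
-- where a_k = (-1)ᵏ C(m,k) C(m+k,k) are the coefficients of a shifted Legendre
-- polynomial and f_k = Π_{j≤k} (1 - p²/(2j)²) ≡ 1 - (p²/4) Σ_{j≤k} 1/j² (mod p⁴).
-- Exact evaluations, by induction on m, of Σ a_k, Σ a_k/(2k+1) and of the same
-- sums weighted with Σ_{j≤k} 1/j² leave
--   p + (p³/2) Σ_{j≤m} 1/j²   and   (-1)ᵐ (p + (p³/2) Σ_{j≤m} (-1)ʲ/j²).
-- Finally Σ_{j≤m} 1/j² ≡ (7/3) p B_{p-3} (mod p²) comes from comparing, for
-- φ(j) = 1/j² and φ(j) = j^{p-3}, the splittings of Σ_{j<p} φ(j) into lower and
-- upper half and into even and odd j, together with Σ_{j<p} j^{p-3} ≡ p B_{p-3};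
-- and (-1)ᵐ Σ_{j≤m} (-1)ʲ/j² ≡ 2 E_{p-3} (mod p) from the alternating sum of the
-- (p-3)th powers of 1, 3, …, p - 2.

-- The delicate point is p-adic precision. In the first sum the term k = m has denominator 2m + 1 =
-- p, so one of the two factors p is lost; the remainder of f_k is harmless only because p times the
-- weighted sum stays p-integral. Writing H = Σ_{j≤m} 1/j², the term p³H/2 then requires H modulo
-- p². But B_{p-3} comes from a power sum, and j^{p-3} ≡ 1/j² holds modulo p only, so H cannot be
-- replaced by a sum of powers. The bridge is a cubic sum, which enters multiplied by p and hence
-- matters modulo p only. Expanding under j ↦ p - j to first order in p gives 6H ≡ -7p Σ_{j≤m} 1/j³
-- (mod p²) for the reciprocals and 2B_{p-3} ≡ -Σ_{j≤m} j^{p-4} (mod p) for the powers, and j^{p-4}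
-- ≡ 1/j³ (mod p) joins the two. For the second sum E_{p-3} is needed modulo p only, so Fermat's
-- theorem is enough.

module Proof where
  open import Algebra.Bundles using (CommutativeRing)
  open import Algebra.Structures using (IsCommutativeRing)
  open import Algebra.Solver.Ring.AlmostCommutativeRing using (AlmostCommutativeRing; fromCommutativeRing; _-Raw-AlmostCommutative⟶_)
  import Algebra.Solver.Ring as RingSolver
  open import Data.Bool using (true; false; if_then_else_)
  open import Data.Integer as ℤ using (ℤ; +_; -[1+_])
  import Data.Integer.Properties as ℤₚ
  open import Data.List using (List; []; _∷_; _++_; [_]; zipWith; upTo; applyUpTo; map)
  import Data.List.Properties as Listₚ
  open import Data.Maybe using (Maybe; just; nothing)
  open import Data.Nat as ℕ using (ℕ; zero; suc; z≤n; s≤s; _<_; _∸_; _≡ᵇ_; _%_)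
  open import Data.Nat.Combinatorics using (_C_; nCk+nC[k+1]≡[n+1]C[k+1]; nCk≡nC[n∸k]; nC1≡n)
  open import Data.Nat.Divisibility using (_∣_; divides; ∣⇒≤)
  import Data.Nat.DivMod as DivMod
  open import Data.Nat.ListAction using () renaming (sum to sumℕ)
  open import Data.Nat.Primality using (Prime; euclidsLemma; prime⇒nonTrivial; prime⇒irreducible)
  import Data.Nat.Properties as ℕₚ
  open import Data.Product using (∃; _×_; _,_; proj₁; proj₂)
  open import Data.Rational as ℚ using (ℚ; toℚᵘ)
  import Data.Rational.Properties as ℚₚ
  open import Data.Rational.Unnormalised as ℚᵘ using (mkℚᵘ; *≡*)
  import Data.Rational.Unnormalised.Properties as ℚᵘₚ
  open import Data.Sum using (_⊎_; inj₁; inj₂; [_,_]′)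
  open import Defs using (sumℚ; lastℚ; bernoulli; bernoulliUpTo; euler; eulerUpTo; T; CongQ; Σ<; powℚ; ℕtoℚ)
  open import Relation.Binary.PropositionalEquality hiding ([_])
  open import Relation.Nullary using (¬_; yes; no)

  -- The rationals as an abstract field

  infixl 6 _+_ _-_
  infixl 7 _*_
  infix  8 -_

  -- Data.Rational's operations evaluate their arguments, which defeats
  -- unification; the opaque copies below behave like an abstract field.
  opaque
    _+_ _*_ : ℚ → ℚ → ℚ
    _+_ = ℚ._+_
    _*_ = ℚ._*_

    -_ : ℚ → ℚ
    -_ = ℚ.-_

    fromℤ : ℤ → ℚ
    fromℤ z = z ℚ./ 1

    -- The shifted index keeps the reciprocal total: `inv 1`, `inv 3` and `inv 15` are 1/2, 1/4 and
    -- 1/16.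
    inv : ℕ → ℚ
    inv n = + 1 ℚ./ suc n

  _-_ : ℚ → ℚ → ℚ
  x - y = x + - y

  -- Images of integers rather than the library constants, so that `ℤ⟶ℚ` preserves 0 and 1 by
  -- `refl`.
  0ℚ 1ℚ : ℚ
  0ℚ = fromℤ (+ 0)
  1ℚ = fromℤ (+ 1)

  ι : ℕ → ℚ
  ι n = fromℤ (+ n)

  opaque
    unfolding _+_

    +-*-isCommutativeRing : IsCommutativeRing _≡_ _+_ _*_ -_ 0ℚ 1ℚ
    +-*-isCommutativeRing = ℚₚ.+-*-isCommutativeRing

  +-*-commutativeRing : CommutativeRing _ _
  +-*-commutativeRing = record { isCommutativeRing = +-*-isCommutativeRing }

  open CommutativeRing +-*-commutativeRing
    using (+-assoc; +-comm; +-identityˡ; +-identityʳ; -‿inverseˡ; -‿inverseʳ; *-assoc; *-comm; *-identityˡ; *-identityʳ; zeroˡ; zeroʳ; distribˡ; distribʳ)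

  opaque
    unfolding _+_

    toℚᵘ-fromℤ : ∀ z → toℚᵘ (fromℤ z) ℚᵘ.≃ mkℚᵘ z 0
    toℚᵘ-fromℤ z = ℚₚ.toℚᵘ-fromℚᵘ (mkℚᵘ z 0)

    fromℤ-+ : ∀ x y → fromℤ (x ℤ.+ y) ≡ fromℤ x + fromℤ y
    fromℤ-+ x y = ℚₚ.toℚᵘ-injective (begin
      toℚᵘ (fromℤ (x ℤ.+ y))              ≈⟨ toℚᵘ-fromℤ (x ℤ.+ y) ⟩
      mkℚᵘ (x ℤ.+ y) 0                    ≈⟨ *≡* (cong (ℤ._* + 1) (sym (cong₂ ℤ._+_ (ℤₚ.*-identityʳ x) (ℤₚ.*-identityʳ y)))) ⟩
      mkℚᵘ x 0 ℚᵘ.+ mkℚᵘ y 0              ≈⟨ ℚᵘₚ.+-cong (toℚᵘ-fromℤ x) (toℚᵘ-fromℤ y) ⟨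
      toℚᵘ (fromℤ x) ℚᵘ.+ toℚᵘ (fromℤ y)  ≈⟨ ℚₚ.toℚᵘ-homo-+ (fromℤ x) (fromℤ y) ⟨
      toℚᵘ (fromℤ x + fromℤ y)            ∎)
      where open ℚᵘₚ.≃-Reasoning

    fromℤ-* : ∀ x y → fromℤ (x ℤ.* y) ≡ (fromℤ x) * (fromℤ y)
    fromℤ-* x y = ℚₚ.toℚᵘ-injective (begin
      toℚᵘ (fromℤ (x ℤ.* y))              ≈⟨ toℚᵘ-fromℤ (x ℤ.* y) ⟩
      mkℚᵘ x 0 ℚᵘ.* mkℚᵘ y 0              ≈⟨ ℚᵘₚ.*-cong (toℚᵘ-fromℤ x) (toℚᵘ-fromℤ y) ⟨
      toℚᵘ (fromℤ x) ℚᵘ.* toℚᵘ (fromℤ y)  ≈⟨ ℚₚ.toℚᵘ-homo-* (fromℤ x) (fromℤ y) ⟨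
      toℚᵘ ((fromℤ x) * (fromℤ y))        ∎)
      where open ℚᵘₚ.≃-Reasoning

    fromℤ-neg : ∀ x → fromℤ (ℤ.- x) ≡ - (fromℤ x)
    fromℤ-neg x = ℚₚ.toℚᵘ-injective (begin
      toℚᵘ (fromℤ (ℤ.- x))  ≈⟨ toℚᵘ-fromℤ (ℤ.- x) ⟩
      ℚᵘ.- mkℚᵘ x 0         ≈⟨ ℚᵘₚ.-‿cong (toℚᵘ-fromℤ x) ⟨
      ℚᵘ.- toℚᵘ (fromℤ x)   ≈⟨ ℚₚ.toℚᵘ-homo‿- (fromℤ x) ⟨
      toℚᵘ (- (fromℤ x))    ∎)
      where open ℚᵘₚ.≃-Reasoning

    -- The ring solver sees `inv n` as an indeterminate. Solver identities below therefore expose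
    -- products such as `ι (suc n) * inv n` as factors, inserted where necessary, and this equation
    -- then rewrites them to 1.
    ι-inv : ∀ n → ι (suc n) * inv n ≡ 1ℚ
    ι-inv n = ℚₚ.toℚᵘ-injective (begin
      toℚᵘ (ι (suc n) * inv n)            ≈⟨ ℚₚ.toℚᵘ-homo-* (ι (suc n)) (inv n) ⟩
      toℚᵘ (ι (suc n)) ℚᵘ.* toℚᵘ (inv n)  ≈⟨ ℚᵘₚ.*-cong (toℚᵘ-fromℤ (+ suc n)) (ℚₚ.toℚᵘ-fromℚᵘ (mkℚᵘ (+ 1) n)) ⟩
      mkℚᵘ (+ suc n) 0 ℚᵘ.* mkℚᵘ (+ 1) n  ≈⟨ *≡* (cong +_ (eq n)) ⟩
      toℚᵘ 1ℚ                             ∎)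
      where
      open ℚᵘₚ.≃-Reasoning
      eq : ∀ n → suc n ℕ.* 1 ℕ.* 1 ≡ suc (n ℕ.+ 0 ℕ.+ 0)
      eq n = trans (ℕₚ.*-identityʳ _) (trans (ℕₚ.*-identityʳ _) (cong suc (sym (trans (ℕₚ.+-identityʳ _) (ℕₚ.+-identityʳ _)))))

  ℚ-ring : AlmostCommutativeRing _ _
  ℚ-ring = fromCommutativeRing +-*-commutativeRing

  -- Integer coefficients let the solver compare constants by computation in ℤ although the
  -- operations on ℚ are opaque.
  ℤ⟶ℚ : ℤ.+-*-rawRing -Raw-AlmostCommutative⟶ ℚ-ring
  ℤ⟶ℚ = record
    { ⟦_⟧    = fromℤ
    ; +-homo = fromℤ-+
    ; *-homo = fromℤ-*
    ; -‿homo = fromℤ-neg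
    ; 0-homo = refl
    ; 1-homo = refl
    }

  ≡-dec : (x y : ℤ) → Maybe (fromℤ x ≡ fromℤ y)
  ≡-dec x y with x ℤ.≟ y
  ... | yes x≡y = just (cong fromℤ x≡y)
  ... | no _    = nothing

  open RingSolver ℤ.+-*-rawRing ℚ-ring ℤ⟶ℚ ≡-dec
    using (Polynomial; solve; con; _:=_; _:+_; _:*_; _:-_; :-_)

  infix 10 #_
  #_ : ∀ {k} → ℕ → Polynomial k
  # n = con (+ n)

  ι-+ : ∀ m n → ι (m ℕ.+ n) ≡ ι m + ι n
  ι-+ m n = fromℤ-+ (+ m) (+ n)

  ι-* : ∀ m n → ι (m ℕ.* n) ≡ ι m * ι n
  ι-* m n = trans (cong fromℤ (ℤₚ.pos-* m n)) (fromℤ-* (+ m) (+ n))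

  ι-suc : ∀ n → ι (suc n) ≡ ι n + 1ℚ
  ι-suc n = trans (ι-+ 1 n) (+-comm 1ℚ (ι n))

  open ≡-Reasoning

  *-cancelˡ-inverse : ∀ {c d x y} → d * c ≡ 1ℚ → c * x ≡ c * y → x ≡ y
  *-cancelˡ-inverse {c} {d} {x} {y} dc≡1 cx≡cy = begin
    x             ≡⟨ lemma x ⟩
    d * (c * x)   ≡⟨ cong (d *_) cx≡cy ⟩
    d * (c * y)   ≡⟨ lemma y ⟨
    y             ∎
    where
    lemma : ∀ z → z ≡ d * (c * z)
    lemma z = trans (sym (*-identityˡ z)) (trans (cong (_* z) (sym dc≡1)) (*-assoc d c z))

  ι-cancel : ∀ n {x y} → ι (suc n) * x ≡ ι (suc n) * y → x ≡ y
  ι-cancel n = *-cancelˡ-inverse (trans (*-comm (inv n) _) (ι-inv n))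

  -- Finite sums

  ∑ : ℕ → (ℕ → ℚ) → ℚ
  ∑ zero    f = 0ℚ
  ∑ (suc n) f = ∑ n f + f n

  ∑-cong : ∀ n {f g : ℕ → ℚ} → (∀ k → k < n → f k ≡ g k) → ∑ n f ≡ ∑ n g
  ∑-cong zero    f≡g = refl
  ∑-cong (suc n) f≡g = cong₂ _+_ (∑-cong n λ k k<n → f≡g k (ℕₚ.m<n⇒m<1+n k<n)) (f≡g n ℕₚ.≤-refl)

  ∑-cong′ : ∀ n {f g : ℕ → ℚ} → (∀ k → f k ≡ g k) → ∑ n f ≡ ∑ n g
  ∑-cong′ n f≡g = ∑-cong n λ k _ → f≡g k

  ∑-zero : ∀ n → ∑ n (λ _ → 0ℚ) ≡ 0ℚ
  ∑-zero zero    = refl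
  ∑-zero (suc n) = trans (+-identityʳ _) (∑-zero n)

  ∑-+ : ∀ n (f g : ℕ → ℚ) → ∑ n (λ k → f k + g k) ≡ ∑ n f + ∑ n g
  ∑-+ zero    f g = sym (+-identityˡ 0ℚ)
  ∑-+ (suc n) f g = trans (cong (_+ (f n + g n)) (∑-+ n f g))
    (solve 4 (λ a b c d → a :+ b :+ (c :+ d) := a :+ c :+ (b :+ d)) refl (∑ n f) (∑ n g) (f n) (g n))

  ∑-*ˡ : ∀ n c (f : ℕ → ℚ) → ∑ n (λ k → c * f k) ≡ c * ∑ n f
  ∑-*ˡ zero    c f = sym (zeroʳ c)
  ∑-*ˡ (suc n) c f = trans (cong (_+ c * f n) (∑-*ˡ n c f)) (sym (distribˡ c _ _))

  ∑-swap : ∀ m n (f : ℕ → ℕ → ℚ) → ∑ m (λ i → ∑ n (f i)) ≡ ∑ n (λ j → ∑ m (λ i → f i j))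
  ∑-swap zero    n f = sym (∑-zero n)
  ∑-swap (suc m) n f = trans (cong (_+ ∑ n (f m)) (∑-swap m n f)) (sym (∑-+ n _ _))

  ∑-telescope : ∀ n (g : ℕ → ℚ) → ∑ n (λ k → g (suc k) - g k) ≡ g n - g 0
  ∑-telescope zero    g = sym (-‿inverseʳ (g 0))
  ∑-telescope (suc n) g = trans (cong (_+ (g (suc n) - g n)) (∑-telescope n g))
    (solve 3 (λ a b c → b :- c :+ (a :- b) := a :- c) refl (g (suc n)) (g n) (g 0))

  ∑-head : ∀ n (f : ℕ → ℚ) → ∑ (suc n) f ≡ f 0 + ∑ n (λ k → f (suc k))
  ∑-head zero    f = +-comm 0ℚ (f 0)
  ∑-head (suc n) f = trans (cong (_+ f (suc n)) (∑-head n f)) (+-assoc (f 0) _ _)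

  ∑-reverse : ∀ n (f : ℕ → ℚ) → ∑ n f ≡ ∑ n (λ k → f (n ∸ suc k))
  ∑-reverse zero    f = refl
  ∑-reverse (suc n) f = begin
    ∑ n f + f n                              ≡⟨ +-comm _ (f n) ⟩
    f n + ∑ n f                              ≡⟨ cong (λ s → f n + s) (∑-reverse n f) ⟩
    f n + ∑ n (λ k → f (n ∸ suc k))          ≡⟨ ∑-head n (λ k → f (n ∸ k)) ⟨
    ∑ (suc n) (λ k → f (n ∸ k))              ∎

  ∑-truncate : ∀ m n {f : ℕ → ℚ} → (∀ k → m ℕ.≤ k → f k ≡ 0ℚ) → m ℕ.≤ n → ∑ n f ≡ ∑ m f
  ∑-truncate m zero    vanish z≤n = refl
  ∑-truncate m (suc n) vanish m≤1+n with ℕₚ.m≤n⇒m<n∨m≡n m≤1+n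
  ... | inj₁ (s≤s m≤n) = trans (cong₂ _+_ (∑-truncate m n vanish m≤n) (vanish n m≤n)) (+-identityʳ _)
  ... | inj₂ refl      = refl

  ∑-pairs : ∀ n (f : ℕ → ℚ) → ∑ (n ℕ.* 2) f ≡ ∑ n (λ k → f (k ℕ.* 2) + f (suc (k ℕ.* 2)))
  ∑-pairs zero    f = refl
  ∑-pairs (suc n) f = trans (+-assoc _ _ _) (cong (_+ (f (n ℕ.* 2) + f (suc (n ℕ.* 2)))) (∑-pairs n f))

  ∑-++ : ∀ m n (f : ℕ → ℚ) → ∑ (n ℕ.+ m) f ≡ ∑ m f + ∑ n (λ k → f (k ℕ.+ m))
  ∑-++ m zero    f = sym (+-identityʳ _)
  ∑-++ m (suc n) f = trans (cong (_+ f (n ℕ.+ m)) (∑-++ m n f)) (+-assoc _ _ _)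

  -- Reciprocals of factorials

  rf : ℕ → ℚ
  rf zero    = 1ℚ
  rf (suc n) = inv n * rf n

  -- 1/(n - k)!, which is 0 when k > n, so that rf∸-unsuc and rf∸-suc hold without side conditions.
  rf∸ : ℕ → ℕ → ℚ
  rf∸ n       zero    = rf n
  rf∸ zero    (suc k) = 0ℚ
  rf∸ (suc n) (suc k) = rf∸ n k

  rf-unsuc : ∀ n → rf n ≡ ι (suc n) * rf (suc n)
  rf-unsuc n = trans (sym (*-identityˡ (rf n))) (trans (cong (_* rf n) (sym (ι-inv n))) (*-assoc (ι (suc n)) (inv n) (rf n)))

  rf∸-unsuc : ∀ n k → rf∸ n k ≡ (ι n + 1ℚ - ι k) * rf∸ (suc n) k
  rf∸-unsuc n zero = trans (rf-unsuc n) (cong (_* rf (suc n)) (trans (ι-suc n) (solve 1 (λ x → x := x :- # 0) refl (ι n + 1ℚ))))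
  rf∸-unsuc zero (suc zero)    = sym (trans (cong (λ x → x * 1ℚ) (solve 1 (λ x → x :+ # 1 :- # 1 := x) refl 0ℚ)) (zeroˡ _))
  rf∸-unsuc zero (suc (suc k)) = sym (zeroʳ _)
  rf∸-unsuc (suc n) (suc k) = trans (rf∸-unsuc n k) (cong (_* rf∸ (suc n) k) (begin
    ι n + 1ℚ - ι k                 ≡⟨ solve 2 (λ x y → x :+ # 1 :- y := x :+ # 1 :+ # 1 :- (y :+ # 1)) refl (ι n) (ι k) ⟩
    ι n + 1ℚ + 1ℚ - (ι k + 1ℚ)     ≡⟨ cong₂ (λ x y → x + 1ℚ - y) (sym (ι-suc n)) (sym (ι-suc k)) ⟩
    ι (suc n) + 1ℚ - ι (suc k)     ∎))

  rf∸-suc : ∀ n k → rf∸ n (suc k) ≡ (ι n - ι k) * rf∸ n k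
  rf∸-suc n k = trans (rf∸-unsuc n (suc k)) (cong (_* rf∸ n k) (trans (cong (λ y → ι n + 1ℚ - y) (ι-suc k))
    (solve 2 (λ x y → x :+ # 1 :- (y :+ # 1) := x :- y) refl (ι n) (ι k))))

  rf∸-zero : ∀ {n k} → n < k → rf∸ n k ≡ 0ℚ
  rf∸-zero {zero}  (s≤s _)   = refl
  rf∸-zero {suc n} (s≤s n<k) = rf∸-zero n<k

  -- The recurrence of T_n

  sq : ℚ → ℚ
  sq x = x * x

  fact : ℕ → ℚ
  fact zero    = 1ℚ
  fact (suc n) = ι (suc n) * fact n

  fact*rf : ∀ n → fact n * rf n ≡ 1ℚ
  fact*rf zero    = *-identityˡ 1ℚ
  fact*rf (suc n) = begin
    ι (suc n) * fact n * (inv n * rf n)     ≡⟨ solve 4 (λ a b c d → a :* b :* (c :* d) := a :* c :* (b :* d)) refl (ι (suc n)) (fact n) (inv n) (rf n) ⟩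
    ι (suc n) * inv n * (fact n * rf n)     ≡⟨ cong₂ _*_ (ι-inv n) (fact*rf n) ⟩
    1ℚ * 1ℚ                                 ≡⟨ *-identityˡ 1ℚ ⟩
    1ℚ                                      ∎

  ι-*2 : ∀ k → ι (k ℕ.* 2) ≡ ι 2 * ι k
  ι-*2 k = trans (ι-* k 2) (*-comm (ι k) (ι 2))

  ι-2+ : ∀ n → ι (2 ℕ.+ n) ≡ ι n + ι 2
  ι-2+ n = trans (ι-+ 2 n) (+-comm (ι 2) (ι n))

  [2k]!/k! : ℕ → ℚ
  [2k]!/k! k = fact (k ℕ.* 2) * rf k

  [2k]!/k!-suc : ∀ k → [2k]!/k! (suc k) ≡ ι 2 * (ι 2 * ι k + 1ℚ) * [2k]!/k! k
  [2k]!/k!-suc k = begin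
    ι (suc (suc (k ℕ.* 2))) * (ι (suc (k ℕ.* 2)) * f) * g
      ≡⟨ cong₂ (λ x y → x * (y * f) * g) (trans (ι-2+ _) (cong (_+ ι 2) (ι-*2 k))) (trans (ι-suc _) (cong (_+ 1ℚ) (ι-*2 k))) ⟩
    (ι 2 * ι k + ι 2) * ((ι 2 * ι k + 1ℚ) * f) * g
      ≡⟨ solve 3 (λ y f g → (# 2 :* y :+ # 2) :* ((# 2 :* y :+ # 1) :* f) :* g := # 2 :* (# 2 :* y :+ # 1) :* (f :* ((y :+ # 1) :* g))) refl (ι k) f g ⟩
    ι 2 * (ι 2 * ι k + 1ℚ) * (f * ((ι k + 1ℚ) * g))
      ≡⟨ cong (λ z → ι 2 * (ι 2 * ι k + 1ℚ) * (f * z)) (trans (cong (_* g) (sym (ι-suc k))) (sym (rf-unsuc k))) ⟩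
    ι 2 * (ι 2 * ι k + 1ℚ) * [2k]!/k! k ∎
    where f = fact (k ℕ.* 2) ; g = rf (suc k)

  -- C(n,k)² C(2k,n)² after cancelling the n! that the two binomial coefficients share. Only
  -- 1/(n-k)! and 1/(2k-n)! still depend on n, which keeps the shifts in n simple.
  T-term : ℕ → ℕ → ℚ
  T-term n k = sq ([2k]!/k! k * (rf∸ n k * rf∸ (k ℕ.* 2) n))

  -- Found with Zeilberger's algorithm; the right factor is chosen so that
  -- no boundary terms arise in T-rec-∑.
  T-cert : ℕ → ℕ → ℚ
  T-cert n k = (sq (x + ι 2) * (ι 7 * x + ι 10) - ι 8 * (ι 2 * x + ι 3) * (x + ι 2) * y + ι 4 * (ι 2 * x + ι 3) * sq y)
          * sq ([2k]!/k! k * (rf∸ (suc (suc n)) k * rf∸ (k ℕ.* 2) (suc (suc n))))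
    where x = ι n ; y = ι k

  cube : ℚ → ℚ
  cube x = x * x * x

  -- An Apéry-like recurrence (n+1)³u_{n+1} - (2n+1)(an²+an+b)u_n + cn³u_{n-1} with (a,b,c) =
  -- (12,4,16), taken at n = x + 1.
  T-rec : ℚ → ℚ → ℚ → ℚ → ℚ
  T-rec x u₀ u₁ u₂ = cube (x + ι 2) * u₂
    - (ι 2 * x + ι 3) * (ι 12 * sq (x + 1ℚ) + ι 12 * (x + 1ℚ) + ι 4) * u₁
    + ι 16 * cube (x + 1ℚ) * u₀

  -- All five terms are polynomial multiples of squares built from `A` = 1/(n+2-k)! and `B` =
  -- 1/(2k-n)!, the reciprocals from which the others arise without division. What remains is a
  -- polynomial identity, valid also where the reciprocals are 0 by convention. For the certificate
  -- at k + 1, `rf∸` cancels the common successors by computation.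
  T-rec-term : ∀ n k → T-rec (ι n) (T-term n k) (T-term (suc n) k) (T-term (suc (suc n)) k) ≡ T-cert n (suc k) - T-cert n k
  T-rec-term n k = begin
    T-rec x (T-term n k) (T-term (suc n) k) (T-term (suc (suc n)) k)
      ≡⟨ cong₂ (λ u₀ u₁ → T-rec x u₀ u₁ (T-term (suc (suc n)) k)) F₀ F₁ ⟩
    T-rec x (sq (Q * ((x + 1ℚ - y) * ((x + ι 2 - y) * A) * B))) (sq (Q * ((x + ι 2 - y) * A * ((ι 2 * y - x) * B)))) (T-term (suc (suc n)) k)
      ≡⟨ cong (T-rec x _ _) F₂ ⟩
    T-rec x (sq (Q * ((x + 1ℚ - y) * ((x + ι 2 - y) * A) * B))) (sq (Q * ((x + ι 2 - y) * A * ((ι 2 * y - x) * B)))) (sq (Q * (A * ((ι 2 * y - (x + 1ℚ)) * ((ι 2 * y - x) * B)))))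
      ≡⟨ poly x y Q A B ⟩
    s x (y + 1ℚ) * sq (ι 2 * (ι 2 * y + 1ℚ) * Q * ((x + ι 2 - y) * A * B)) - s x y * sq (Q * (A * ((ι 2 * y - (x + 1ℚ)) * ((ι 2 * y - x) * B))))
      ≡⟨ cong₂ _-_ (sym G₁) (sym G₀) ⟩
    T-cert n (suc k) - T-cert n k ∎
    where
    x = ι n ; y = ι k ; Q = [2k]!/k! k ; A = rf∸ (suc (suc n)) k ; B = rf∸ (k ℕ.* 2) n

    s : ℚ → ℚ → ℚ
    s x y = sq (x + ι 2) * (ι 7 * x + ι 10) - ι 8 * (ι 2 * x + ι 3) * (x + ι 2) * y + ι 4 * (ι 2 * x + ι 3) * sq y

    poly : ∀ x y Q A B →
      T-rec x (sq (Q * ((x + 1ℚ - y) * ((x + ι 2 - y) * A) * B))) (sq (Q * ((x + ι 2 - y) * A * ((ι 2 * y - x) * B)))) (sq (Q * (A * ((ι 2 * y - (x + 1ℚ)) * ((ι 2 * y - x) * B)))))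
      ≡ s x (y + 1ℚ) * sq (ι 2 * (ι 2 * y + 1ℚ) * Q * ((x + ι 2 - y) * A * B)) - s x y * sq (Q * (A * ((ι 2 * y - (x + 1ℚ)) * ((ι 2 * y - x) * B))))
    poly = solve 5 (λ x y Q A B →
      let sq′ = λ a → a :* a
          cube′ = λ a → a :* a :* a
          s′ = λ x y → sq′ (x :+ # 2) :* (# 7 :* x :+ # 10) :- # 8 :* (# 2 :* x :+ # 3) :* (x :+ # 2) :* y :+ # 4 :* (# 2 :* x :+ # 3) :* sq′ y
          u₀ = sq′ (Q :* ((x :+ # 1 :- y) :* ((x :+ # 2 :- y) :* A) :* B))
          u₁ = sq′ (Q :* ((x :+ # 2 :- y) :* A :* ((# 2 :* y :- x) :* B)))
          u₂ = sq′ (Q :* (A :* ((# 2 :* y :- (x :+ # 1)) :* ((# 2 :* y :- x) :* B))))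
      in cube′ (x :+ # 2) :* u₂ :- (# 2 :* x :+ # 3) :* (# 12 :* sq′ (x :+ # 1) :+ # 12 :* (x :+ # 1) :+ # 4) :* u₁ :+ # 16 :* cube′ (x :+ # 1) :* u₀
         := s′ x (y :+ # 1) :* sq′ (# 2 :* (# 2 :* y :+ # 1) :* Q :* ((x :+ # 2 :- y) :* A :* B)) :- s′ x y :* u₂) refl

    r₁ : rf∸ (suc n) k ≡ (x + ι 2 - y) * A
    r₁ = trans (rf∸-unsuc (suc n) k) (cong (_* A) (trans (cong (λ z → z + 1ℚ - y) (ι-suc n)) (solve 2 (λ x y → x :+ # 1 :+ # 1 :- y := x :+ # 2 :- y) refl x y)))

    r₀ : rf∸ n k ≡ (x + 1ℚ - y) * ((x + ι 2 - y) * A)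
    r₀ = trans (rf∸-unsuc n k) (cong ((x + 1ℚ - y) *_) r₁)

    B₁ : rf∸ (k ℕ.* 2) (suc n) ≡ (ι 2 * y - x) * B
    B₁ = trans (rf∸-suc (k ℕ.* 2) n) (cong (λ z → (z - x) * B) (ι-*2 k))

    B₂ : rf∸ (k ℕ.* 2) (suc (suc n)) ≡ (ι 2 * y - (x + 1ℚ)) * ((ι 2 * y - x) * B)
    B₂ = trans (rf∸-suc (k ℕ.* 2) (suc n)) (cong₂ _*_ (cong₂ _-_ (ι-*2 k) (ι-suc n)) B₁)

    F₀ : T-term n k ≡ sq (Q * ((x + 1ℚ - y) * ((x + ι 2 - y) * A) * B))
    F₀ = cong (λ z → sq (Q * (z * B))) r₀

    F₁ : T-term (suc n) k ≡ sq (Q * ((x + ι 2 - y) * A * ((ι 2 * y - x) * B)))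
    F₁ = cong₂ (λ z w → sq (Q * (z * w))) r₁ B₁

    F₂ : T-term (suc (suc n)) k ≡ sq (Q * (A * ((ι 2 * y - (x + 1ℚ)) * ((ι 2 * y - x) * B))))
    F₂ = cong (λ z → sq (Q * (A * z))) B₂

    G₀ : T-cert n k ≡ s x y * sq (Q * (A * ((ι 2 * y - (x + 1ℚ)) * ((ι 2 * y - x) * B))))
    G₀ = cong (λ z → s x y * sq (Q * (A * z))) B₂

    G₁ : T-cert n (suc k) ≡ s x (y + 1ℚ) * sq (ι 2 * (ι 2 * y + 1ℚ) * Q * ((x + ι 2 - y) * A * B))
    G₁ = trans (cong₂ (λ z w → s x z * sq (w * (rf∸ (suc n) k * B))) (ι-suc k) ([2k]!/k!-suc k)) (cong (λ z → s x (y + 1ℚ) * sq (ι 2 * (ι 2 * y + 1ℚ) * Q * (z * B))) r₁)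

  pow : ℚ → ℕ → ℚ
  pow x zero    = 1ℚ
  pow x (suc n) = x * pow x n

  -- The second form of T_n/4ⁿ

  1/16ᵏk!⁴ : ℕ → ℚ
  1/16ᵏk!⁴ zero    = 1ℚ
  1/16ᵏk!⁴ (suc k) = inv 15 * (sq (sq (inv k)) * 1/16ᵏk!⁴ k)

  1/16ᵏk!⁴-unsuc : ∀ k → 1/16ᵏk!⁴ k ≡ ι 16 * (sq (sq (ι k + 1ℚ)) * 1/16ᵏk!⁴ (suc k))
  1/16ᵏk!⁴-unsuc k = begin
    1/16ᵏk!⁴ k
      ≡⟨ solve 1 (λ x → x := # 1 :* (# 1 :* # 1 :* (# 1 :* # 1)) :* x) refl (1/16ᵏk!⁴ k) ⟩
    1ℚ * sq (sq 1ℚ) * 1/16ᵏk!⁴ k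
      ≡⟨ cong₂ (λ a b → a * sq (sq b) * 1/16ᵏk!⁴ k) (sym (ι-inv 15)) (sym (trans (cong (_* inv k) (sym (ι-suc k))) (ι-inv k))) ⟩
    ι 16 * inv 15 * sq (sq ((ι k + 1ℚ) * inv k)) * 1/16ᵏk!⁴ k
      ≡⟨ solve 4 (λ a y b g → let s = λ x → x :* x in # 16 :* a :* s (s ((y :+ # 1) :* b)) :* g := # 16 :* (s (s (y :+ # 1)) :* (a :* (s (s b) :* g)))) refl (inv 15) (ι k) (inv k) (1/16ᵏk!⁴ k) ⟩
    ι 16 * (sq (sq (ι k + 1ℚ)) * 1/16ᵏk!⁴ (suc k)) ∎

  t-term : ℕ → ℕ → ℚ
  t-term n k = fact (k ℕ.* 2 ℕ.+ n) * rf∸ n (k ℕ.* 2) * 1/16ᵏk!⁴ k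

  -- The shape of `T-rec` with (a,b,c) = (3,1,1). Multiplying a solution by 4ⁿ turns (a,b,c) into
  -- (4a,4b,16c), hence into (12,4,16).
  t-rec : ℚ → ℚ → ℚ → ℚ → ℚ
  t-rec x u₀ u₁ u₂ = cube (x + ι 2) * u₂
    - (ι 2 * x + ι 3) * (ι 3 * sq (x + 1ℚ) + ι 3 * (x + 1ℚ) + 1ℚ) * u₁
    + cube (x + 1ℚ) * u₀

  -- The certificate of Zeilberger's algorithm. Its last factor is the coefficient
  -- 1/(16^{k-1}(k-1)!⁴) written without a predecessor; the factor k⁴ makes it vanish at k = 0, so
  -- the lower boundary contributes nothing.
  t-cert : ℕ → ℕ → ℚ
  t-cert n k = - (ι 2 * (ι 2 * ι n + ι 3) * (fact (k ℕ.* 2 ℕ.+ n) * rf∸ (suc (suc n)) (k ℕ.* 2) * (ι 16 * (sq (sq (ι k)) * 1/16ᵏk!⁴ k))))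

  ι-suc[2k+n] : ∀ k n → ι (suc (k ℕ.* 2 ℕ.+ n)) ≡ ι 2 * ι k + ι n + 1ℚ
  ι-suc[2k+n] k n = trans (ι-suc _) (cong (_+ 1ℚ) (trans (ι-+ (k ℕ.* 2) n) (cong (_+ ι n) (ι-*2 k))))

  ι-2+[2k+n] : ∀ k n → ι (suc (suc (k ℕ.* 2 ℕ.+ n))) ≡ ι 2 * ι k + ι n + ι 2
  ι-2+[2k+n] k n = trans (ι-2+ _) (cong (_+ ι 2) (trans (ι-+ (k ℕ.* 2) n) (cong (_+ ι n) (ι-*2 k))))

  fact-suc[2k+n] : ∀ k n → fact (suc (k ℕ.* 2 ℕ.+ n)) ≡ (ι 2 * ι k + ι n + 1ℚ) * fact (k ℕ.* 2 ℕ.+ n)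
  fact-suc[2k+n] k n = cong (_* fact (k ℕ.* 2 ℕ.+ n)) (ι-suc[2k+n] k n)

  fact-2+[2k+n] : ∀ k n → fact (suc (suc (k ℕ.* 2 ℕ.+ n))) ≡ (ι 2 * ι k + ι n + ι 2) * ((ι 2 * ι k + ι n + 1ℚ) * fact (k ℕ.* 2 ℕ.+ n))
  fact-2+[2k+n] k n = cong₂ _*_ (ι-2+[2k+n] k n) (fact-suc[2k+n] k n)

  t-rec-term : ∀ n k → t-rec (ι n) (t-term n k) (t-term (suc n) k) (t-term (suc (suc n)) k) ≡ t-cert n (suc k) - t-cert n k
  t-rec-term n k = begin
    t-rec x (t-term n k) (t-term (suc n) k) (t-term (suc (suc n)) k)
      ≡⟨ cong₂ (λ u₀ u₁ → t-rec x u₀ u₁ (t-term (suc (suc n)) k)) v₀ v₁ ⟩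
    t-rec x (D * ((x + 1ℚ - ι 2 * y) * ((x + ι 2 - ι 2 * y) * A)) * H) ((ι 2 * y + x + 1ℚ) * D * ((x + ι 2 - ι 2 * y) * A) * H) (t-term (suc (suc n)) k)
      ≡⟨ cong (t-rec x (D * ((x + 1ℚ - ι 2 * y) * ((x + ι 2 - ι 2 * y) * A)) * H) ((ι 2 * y + x + 1ℚ) * D * ((x + ι 2 - ι 2 * y) * A) * H)) v₂ ⟩
    _ ≡⟨ poly x y D A H ⟩
    _ ≡⟨ cong (λ z → - z - t-cert n k) (sym Gv₁) ⟩
    t-cert n (suc k) - t-cert n k ∎
    where
    x = ι n ; y = ι k ; D = fact (k ℕ.* 2 ℕ.+ n) ; A = rf∸ (suc (suc n)) (k ℕ.* 2) ; H = 1/16ᵏk!⁴ k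

    poly : ∀ x y D A H →
      t-rec x (D * ((x + 1ℚ - ι 2 * y) * ((x + ι 2 - ι 2 * y) * A)) * H) ((ι 2 * y + x + 1ℚ) * D * ((x + ι 2 - ι 2 * y) * A) * H) ((ι 2 * y + x + ι 2) * ((ι 2 * y + x + 1ℚ) * D) * A * H)
      ≡ - (ι 2 * (ι 2 * x + ι 3) * ((ι 2 * y + x + ι 2) * ((ι 2 * y + x + 1ℚ) * D) * ((x + 1ℚ - ι 2 * y) * ((x + ι 2 - ι 2 * y) * A)) * H))
        - - (ι 2 * (ι 2 * x + ι 3) * (D * A * (ι 16 * (sq (sq y) * H))))
    poly = solve 5 (λ x y D A H →
      let sq′ = λ a → a :* a
          cube′ = λ a → a :* a :* a
          u₀ = D :* ((x :+ # 1 :- # 2 :* y) :* ((x :+ # 2 :- # 2 :* y) :* A)) :* H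
          u₁ = (# 2 :* y :+ x :+ # 1) :* D :* ((x :+ # 2 :- # 2 :* y) :* A) :* H
          u₂ = (# 2 :* y :+ x :+ # 2) :* ((# 2 :* y :+ x :+ # 1) :* D) :* A :* H
      in cube′ (x :+ # 2) :* u₂ :- (# 2 :* x :+ # 3) :* (# 3 :* sq′ (x :+ # 1) :+ # 3 :* (x :+ # 1) :+ # 1) :* u₁ :+ cube′ (x :+ # 1) :* u₀
         := :- (# 2 :* (# 2 :* x :+ # 3) :* ((# 2 :* y :+ x :+ # 2) :* ((# 2 :* y :+ x :+ # 1) :* D) :* ((x :+ # 1 :- # 2 :* y) :* ((x :+ # 2 :- # 2 :* y) :* A)) :* H))
         :- :- (# 2 :* (# 2 :* x :+ # 3) :* (D :* A :* (# 16 :* (sq′ (sq′ y) :* H))))) refl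

    r₁ : rf∸ (suc n) (k ℕ.* 2) ≡ (x + ι 2 - ι 2 * y) * A
    r₁ = trans (rf∸-unsuc (suc n) (k ℕ.* 2)) (cong (_* A) (trans (cong₂ (λ z w → z + 1ℚ - w) (ι-suc n) (ι-*2 k)) (solve 2 (λ x y → x :+ # 1 :+ # 1 :- y := x :+ # 2 :- y) refl x (ι 2 * y))))

    r₀ : rf∸ n (k ℕ.* 2) ≡ (x + 1ℚ - ι 2 * y) * ((x + ι 2 - ι 2 * y) * A)
    r₀ = trans (rf∸-unsuc n (k ℕ.* 2)) (cong₂ (λ z w → (x + 1ℚ - z) * w) (ι-*2 k) r₁)

    v₀ : t-term n k ≡ D * ((x + 1ℚ - ι 2 * y) * ((x + ι 2 - ι 2 * y) * A)) * H
    v₀ = cong (λ z → D * z * H) r₀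

    v₁ : t-term (suc n) k ≡ (ι 2 * y + x + 1ℚ) * D * ((x + ι 2 - ι 2 * y) * A) * H
    v₁ = cong₂ (λ z w → z * w * H) (trans (cong fact (ℕₚ.+-suc (k ℕ.* 2) n)) (fact-suc[2k+n] k n)) r₁

    v₂ : t-term (suc (suc n)) k ≡ (ι 2 * y + x + ι 2) * ((ι 2 * y + x + 1ℚ) * D) * A * H
    v₂ = cong (λ z → z * A * H) (trans (cong fact (trans (ℕₚ.+-suc (k ℕ.* 2) (suc n)) (cong suc (ℕₚ.+-suc (k ℕ.* 2) n)))) (fact-2+[2k+n] k n))

    Gv₁ : ι 2 * (ι 2 * x + ι 3) * (fact (suc k ℕ.* 2 ℕ.+ n) * rf∸ n (k ℕ.* 2) * (ι 16 * (sq (sq (ι (suc k))) * 1/16ᵏk!⁴ (suc k))))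
        ≡ ι 2 * (ι 2 * x + ι 3) * ((ι 2 * y + x + ι 2) * ((ι 2 * y + x + 1ℚ) * D) * ((x + 1ℚ - ι 2 * y) * ((x + ι 2 - ι 2 * y) * A)) * H)
    Gv₁ = cong (ι 2 * (ι 2 * x + ι 3) *_) (cong₂ _*_ (cong₂ _*_ (fact-2+[2k+n] k n) r₀)
      (trans (cong (λ z → ι 16 * (sq (sq z) * 1/16ᵏk!⁴ (suc k))) (ι-suc k)) (sym (1/16ᵏk!⁴-unsuc k))))

  Lin : ℚ → ℚ → ℚ → ℚ → ℚ → ℚ → ℚ
  Lin c₀ c₁ c₂ u₀ u₁ u₂ = c₂ * u₂ - c₁ * u₁ + c₀ * u₀

  -- Creative telescoping: the coefficients do not depend on k, so a recurrence that holds for the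
  -- summands up to a difference passes to the sums. `T-rec` and `t-rec` are instances of `Lin` by
  -- unfolding.
  ∑-Lin : ∀ n c₀ c₁ c₂ (f₀ f₁ f₂ g : ℕ → ℚ) → (∀ k → Lin c₀ c₁ c₂ (f₀ k) (f₁ k) (f₂ k) ≡ g (suc k) - g k) →
          Lin c₀ c₁ c₂ (∑ n f₀) (∑ n f₁) (∑ n f₂) ≡ g n - g 0
  ∑-Lin zero c₀ c₁ c₂ f₀ f₁ f₂ g eq = trans
    (solve 3 (λ a b c → c :* # 0 :- b :* # 0 :+ a :* # 0 := # 0) refl c₀ c₁ c₂) (sym (-‿inverseʳ (g 0)))
  ∑-Lin (suc n) c₀ c₁ c₂ f₀ f₁ f₂ g eq = begin
    Lin c₀ c₁ c₂ (∑ n f₀ + f₀ n) (∑ n f₁ + f₁ n) (∑ n f₂ + f₂ n)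
      ≡⟨ solve 9 (λ a b c d e f x y z → c :* (f :+ z) :- b :* (e :+ y) :+ a :* (d :+ x) := (c :* f :- b :* e :+ a :* d) :+ (c :* z :- b :* y :+ a :* x)) refl c₀ c₁ c₂ (∑ n f₀) (∑ n f₁) (∑ n f₂) (f₀ n) (f₁ n) (f₂ n) ⟩
    Lin c₀ c₁ c₂ (∑ n f₀) (∑ n f₁) (∑ n f₂) + Lin c₀ c₁ c₂ (f₀ n) (f₁ n) (f₂ n)
      ≡⟨ cong₂ _+_ (∑-Lin n c₀ c₁ c₂ f₀ f₁ f₂ g eq) (eq n) ⟩
    g n - g 0 + (g (suc n) - g n)
      ≡⟨ solve 3 (λ a b c → b :- c :+ (a :- b) := a :- c) refl (g (suc n)) (g n) (g 0) ⟩
    g (suc n) - g 0 ∎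

  -- T-term n, t-term n are supported on k ≤ n, so a fixed upper summation bound serves all n ≤ N.
  T-rec-∑ : ∀ N n → suc (suc n) ℕ.≤ N → T-rec (ι n) (∑ (suc N) (T-term n)) (∑ (suc N) (T-term (suc n))) (∑ (suc N) (T-term (suc (suc n)))) ≡ 0ℚ
  T-rec-∑ N n n+2≤N = trans (∑-Lin (suc N) _ _ _ (T-term n) (T-term (suc n)) (T-term (suc (suc n))) (T-cert n) (T-rec-term n)) (begin
    T-cert n (suc N) - T-cert n 0
      ≡⟨ cong₂ _-_
           (trans (cong (λ z → c (ι (suc N)) * sq ([2k]!/k! (suc N) * (z * rf∸ (suc N ℕ.* 2) (suc (suc n))))) (rf∸-zero {suc (suc n)} {suc N} (s≤s n+2≤N))) (solve 3 (λ a b d → let z = b :* (# 0 :* d) in a :* (z :* z) := # 0) refl (c (ι (suc N))) ([2k]!/k! (suc N)) (rf∸ (suc N ℕ.* 2) (suc (suc n)))))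
           (solve 3 (λ a b d → let z = b :* (d :* # 0) in a :* (z :* z) := # 0) refl (c (ι 0)) ([2k]!/k! 0) (rf∸ (suc (suc n)) 0)) ⟩
    0ℚ - 0ℚ ≡⟨ -‿inverseʳ 0ℚ ⟩
    0ℚ ∎)
    where
    x = ι n
    c : ℚ → ℚ
    c y = sq (x + ι 2) * (ι 7 * x + ι 10) - ι 8 * (ι 2 * x + ι 3) * (x + ι 2) * y + ι 4 * (ι 2 * x + ι 3) * sq y

  t-rec-∑ : ∀ N n → suc (suc n) ℕ.≤ N → t-rec (ι n) (∑ (suc N) (t-term n)) (∑ (suc N) (t-term (suc n))) (∑ (suc N) (t-term (suc (suc n)))) ≡ 0ℚ
  t-rec-∑ N n n+2≤N = trans (∑-Lin (suc N) _ _ _ (t-term n) (t-term (suc n)) (t-term (suc (suc n))) (t-cert n) (t-rec-term n)) (begin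
    t-cert n (suc N) - t-cert n 0
      ≡⟨ cong₂ _-_
           (trans (cong (λ z → - (c * (fact (suc N ℕ.* 2 ℕ.+ n) * z * d))) (rf∸-zero {n} {N ℕ.* 2} n<N*2)) (solve 3 (λ a b d → :- (a :* (b :* # 0 :* d)) := # 0) refl c (fact (suc N ℕ.* 2 ℕ.+ n)) d))
           (solve 2 (λ a b → :- (a :* (b :* (# 16 :* (# 0 :* # 0 :* (# 0 :* # 0) :* # 1)))) := # 0) refl c (fact n * rf (suc (suc n)))) ⟩
    0ℚ - 0ℚ ≡⟨ -‿inverseʳ 0ℚ ⟩
    0ℚ ∎)
    where
    c = ι 2 * (ι 2 * ι n + ι 3)
    d = ι 16 * (sq (sq (ι (suc N))) * 1/16ᵏk!⁴ (suc N))
    n<N*2 : n < N ℕ.* 2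
    n<N*2 = ℕₚ.≤-trans (ℕₚ.≤-trans (ℕₚ.n≤1+n _) n+2≤N) (ℕₚ.m≤m*n N 2)

  T-rec-scale : ∀ x w u₀ u₁ u₂ → T-rec x (w * u₀) (ι 4 * w * u₁) (ι 4 * (ι 4 * w) * u₂) ≡ ι 16 * w * t-rec x u₀ u₁ u₂
  T-rec-scale = solve 5 (λ x w u₀ u₁ u₂ →
      let sq′ = λ a → a :* a
          cube′ = λ a → a :* a :* a
      in cube′ (x :+ # 2) :* (# 4 :* (# 4 :* w) :* u₂) :- (# 2 :* x :+ # 3) :* (# 12 :* sq′ (x :+ # 1) :+ # 12 :* (x :+ # 1) :+ # 4) :* (# 4 :* w :* u₁) :+ # 16 :* cube′ (x :+ # 1) :* (w :* u₀)
         := # 16 :* w :* (cube′ (x :+ # 2) :* u₂ :- (# 2 :* x :+ # 3) :* (# 3 :* sq′ (x :+ # 1) :+ # 3 :* (x :+ # 1) :+ # 1) :* u₁ :+ cube′ (x :+ # 1) :* u₀)) refl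

  -- The leading coefficient (n+2)³ is nonzero; its three factors are cancelled one at a time.
  T-rec-unique : ∀ n u₀ u₁ {u₂ w₂} → T-rec (ι n) u₀ u₁ u₂ ≡ 0ℚ → T-rec (ι n) u₀ u₁ w₂ ≡ 0ℚ → u₂ ≡ w₂
  T-rec-unique n u₀ u₁ {u₂} {w₂} eq₁ eq₂ = ι-cancel (suc n) (ι-cancel (suc n) (ι-cancel (suc n) (begin
    y * (y * (y * u₂))
      ≡⟨ solve 4 (λ y u b a → y :* (y :* (y :* u)) := (y :* y :* y :* u :- b :+ a) :+ (b :- a)) refl y u₂ b a ⟩
    (cube y * u₂ - b + a) + (b - a)
      ≡⟨ cong (_+ (b - a)) (trans (trans (cong (λ z → cube z * u₂ - b + a) (ι-2+ n)) (trans eq₁ (sym eq₂))) (cong (λ z → cube z * w₂ - b + a) (sym (ι-2+ n)))) ⟩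
    (cube y * w₂ - b + a) + (b - a)
      ≡⟨ solve 4 (λ y u b a → y :* (y :* (y :* u)) := (y :* y :* y :* u :- b :+ a) :+ (b :- a)) refl y w₂ b a ⟨
    y * (y * (y * w₂)) ∎)))
    where
    y = ι (suc (suc n))
    x = ι n
    b = (ι 2 * x + ι 3) * (ι 12 * sq (x + 1ℚ) + ι 12 * (x + 1ℚ) + ι 4) * u₁
    a = ι 16 * cube (x + 1ℚ) * u₀

  ∑T-term≡4ⁿ∑t-term : ∀ N n → n ℕ.≤ N → ∑ (suc N) (T-term n) ≡ pow (ι 4) n * ∑ (suc N) (t-term n)
  ∑T-term≡4ⁿ∑t-term N zero _ = begin
    ∑ (suc N) (T-term 0)          ≡⟨ ∑-truncate 1 (suc N) F0≡0 (s≤s z≤n) ⟩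
    0ℚ + T-term 0 0               ≡⟨ solve 0 (let z = # 1 :* # 1 :* (# 1 :* # 1) in # 0 :+ z :* z := # 1 :* (# 0 :+ # 1 :* # 1 :* # 1)) refl ⟩
    1ℚ * (0ℚ + t-term 0 0)        ≡⟨ cong (1ℚ *_) (sym (∑-truncate 1 (suc N) v0≡0 (s≤s z≤n))) ⟩
    1ℚ * ∑ (suc N) (t-term 0)     ∎
    where
    F0≡0 : ∀ k → 1 ℕ.≤ k → T-term 0 k ≡ 0ℚ
    F0≡0 (suc k) _ = solve 2 (λ a b → let z = a :* (# 0 :* b) in z :* z := # 0) refl ([2k]!/k! (suc k)) (rf∸ (suc k ℕ.* 2) 0)
    v0≡0 : ∀ k → 1 ℕ.≤ k → t-term 0 k ≡ 0ℚ
    v0≡0 (suc k) _ = solve 2 (λ a b → a :* # 0 :* b := # 0) refl (fact (suc k ℕ.* 2 ℕ.+ 0)) (1/16ᵏk!⁴ (suc k))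
  ∑T-term≡4ⁿ∑t-term N (suc zero) 1≤N = begin
    ∑ (suc N) (T-term 1)          ≡⟨ ∑-truncate 2 (suc N) F1≡0 (s≤s 1≤N) ⟩
    -- `inv 0` is opaque and must become the constant 1 before the solver can compare numbers.
    0ℚ + T-term 1 0 + T-term 1 1       ≡⟨ cong (λ i → 0ℚ + sq (1ℚ * 1ℚ * (i * 1ℚ * 0ℚ)) + sq (ι 2 * (1ℚ * 1ℚ) * (i * 1ℚ) * (1ℚ * (i * 1ℚ)))) (trans (sym (*-identityˡ (inv 0))) (ι-inv 0)) ⟩
    _                        ≡⟨ solve 0 (let sq′ = λ a → a :* a in # 0 :+ sq′ (# 1 :* # 1 :* (# 1 :* # 1 :* # 0)) :+ sq′ (# 2 :* (# 1 :* # 1) :* (# 1 :* # 1) :* (# 1 :* (# 1 :* # 1))) := # 4 :* # 1 :* (# 0 :+ # 1 :* # 1 :* (# 1 :* # 1) :* # 1)) refl ⟩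
    _                        ≡⟨ cong (λ i → ι 4 * 1ℚ * (0ℚ + 1ℚ * 1ℚ * (i * 1ℚ) * 1ℚ)) (sym (trans (sym (*-identityˡ (inv 0))) (ι-inv 0))) ⟩
    ι 4 * 1ℚ * (0ℚ + t-term 1 0)  ≡⟨ cong (ι 4 * 1ℚ *_) (sym (∑-truncate 1 (suc N) v1≡0 (s≤s z≤n))) ⟩
    ι 4 * 1ℚ * ∑ (suc N) (t-term 1) ∎
    where
    F1≡0 : ∀ k → 2 ℕ.≤ k → T-term 1 k ≡ 0ℚ
    F1≡0 (suc (suc k)) _ = solve 2 (λ a b → let z = a :* (# 0 :* b) in z :* z := # 0) refl ([2k]!/k! (suc (suc k))) (rf∸ (suc (suc k) ℕ.* 2) 1)
    F1≡0 (suc zero) (s≤s ())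
    v1≡0 : ∀ k → 1 ℕ.≤ k → t-term 1 k ≡ 0ℚ
    v1≡0 (suc k) _ = solve 2 (λ a b → a :* # 0 :* b := # 0) refl (fact (suc k ℕ.* 2 ℕ.+ 1)) (1/16ᵏk!⁴ (suc k))
  ∑T-term≡4ⁿ∑t-term N (suc (suc n)) n+2≤N = T-rec-unique n (∑ (suc N) (T-term n)) (∑ (suc N) (T-term (suc n))) (T-rec-∑ N n n+2≤N) (begin
    T-rec (ι n) (∑ (suc N) (T-term n)) (∑ (suc N) (T-term (suc n))) (ι 4 * (ι 4 * w) * ∑ (suc N) (t-term (suc (suc n))))
      ≡⟨ cong₂ (λ a b → T-rec (ι n) a b (ι 4 * (ι 4 * w) * ∑ (suc N) (t-term (suc (suc n))))) (∑T-term≡4ⁿ∑t-term N n (ℕₚ.≤-trans (ℕₚ.n≤1+n _) n+1≤N)) (∑T-term≡4ⁿ∑t-term N (suc n) n+1≤N) ⟩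
    T-rec (ι n) (w * ∑ (suc N) (t-term n)) (ι 4 * w * ∑ (suc N) (t-term (suc n))) (ι 4 * (ι 4 * w) * ∑ (suc N) (t-term (suc (suc n))))
      ≡⟨ T-rec-scale (ι n) w _ _ _ ⟩
    ι 16 * w * t-rec (ι n) (∑ (suc N) (t-term n)) (∑ (suc N) (t-term (suc n))) (∑ (suc N) (t-term (suc (suc n))))
      ≡⟨ cong (ι 16 * w *_) (t-rec-∑ N n n+2≤N) ⟩
    ι 16 * w * 0ℚ ≡⟨ zeroʳ _ ⟩
    0ℚ ∎)
    where
    w = pow (ι 4) n
    n+1≤N : suc n ℕ.≤ N
    n+1≤N = ℕₚ.≤-trans (ℕₚ.n≤1+n _) n+2≤N

  -- Summation of (2n + 1)(±1)ⁿ T_n/4ⁿ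

  pow-* : ∀ x y n → pow (x * y) n ≡ pow x n * pow y n
  pow-* x y zero    = sym (*-identityˡ 1ℚ)
  pow-* x y (suc n) = trans (cong (x * y *_) (pow-* x y n))
    (solve 4 (λ x y a b → x :* y :* (a :* b) := x :* a :* (y :* b)) refl x y (pow x n) (pow y n))

  pow-1 : ∀ n → pow 1ℚ n ≡ 1ℚ
  pow-1 zero    = refl
  pow-1 (suc n) = trans (*-identityˡ _) (pow-1 n)

  -1ℚ : ℚ
  -1ℚ = - 1ℚ

  odd : ℕ → ℚ
  odd n = ι 2 * ι n + 1ℚ

  t-partial : ℕ → ℕ → ℚ
  t-partial N k = fact (k ℕ.* 2 ℕ.+ N) * rf∸ N (suc (k ℕ.* 2)) * 1/16ᵏk!⁴ k

  rf∸-odd : ∀ N k → rf∸ N (suc (k ℕ.* 2)) ≡ (ι N - ι 2 * ι k) * rf∸ N (k ℕ.* 2)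
  rf∸-odd N k = trans (rf∸-suc N (k ℕ.* 2)) (cong (λ z → (ι N - z) * rf∸ N (k ℕ.* 2)) (ι-*2 k))

  t-partial-suc : ∀ N k → t-partial (suc N) k ≡ (ι 2 * ι k + ι N + 1ℚ) * fact (k ℕ.* 2 ℕ.+ N) * rf∸ N (k ℕ.* 2) * 1/16ᵏk!⁴ k
  t-partial-suc N k = cong (λ z → z * rf∸ N (k ℕ.* 2) * 1/16ᵏk!⁴ k) (trans (cong fact (ℕₚ.+-suc (k ℕ.* 2) N)) (fact-suc[2k+n] k N))

  -- The induction step rests on N(N-2k) + (2k+1)(2N+1) = (N+1)(N+2k+1). At N = p the factor `ι N`
  -- is one of the two factors p of the first sum, and `odd k` is the origin of the weights
  -- 1/(2k+1).
  ∑-t-term : ∀ N k → odd k * ∑ N (λ n → odd n * t-term n k) ≡ ι N * t-partial N k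
  ∑-t-term zero    k = trans (zeroʳ _) (sym (zeroˡ _))
  ∑-t-term (suc N) k = begin
    odd k * (∑ N (λ n → odd n * t-term n k) + odd N * (D * R * H))
      ≡⟨ distribˡ _ _ _ ⟩
    odd k * ∑ N (λ n → odd n * t-term n k) + odd k * (odd N * (D * R * H))
      ≡⟨ cong (_+ odd k * (odd N * (D * R * H))) (trans (∑-t-term N k) (cong (λ z → x * (D * z * H)) (rf∸-odd N k))) ⟩
    x * (D * ((x - ι 2 * y) * R) * H) + odd k * (odd N * (D * R * H))
      ≡⟨ solve 5 (λ x y D R H → x :* (D :* ((x :- # 2 :* y) :* R) :* H) :+ (# 2 :* y :+ # 1) :* ((# 2 :* x :+ # 1) :* (D :* R :* H))
                   := (x :+ # 1) :* ((# 2 :* y :+ x :+ # 1) :* D :* R :* H)) refl x y D R H ⟩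
    (x + 1ℚ) * ((ι 2 * y + x + 1ℚ) * D * R * H)
      ≡⟨ cong₂ _*_ (sym (ι-suc N)) (sym (t-partial-suc N k)) ⟩
    ι (suc N) * t-partial (suc N) k ∎
    where x = ι N ; y = ι k ; D = fact (k ℕ.* 2 ℕ.+ N) ; R = rf∸ N (k ℕ.* 2) ; H = 1/16ᵏk!⁴ k

  -- With alternating signs the step is the linear identity (2N+1) - (N-2k) = N+2k+1. Neither a
  -- factor N nor a denominator 2k+1 appears, so the second sum has a single factor p and no
  -- weights.
  ∑-±t-term : ∀ N k → ∑ N (λ n → odd n * pow -1ℚ n * t-term n k) ≡ - (pow -1ℚ N * t-partial N k)
  ∑-±t-term zero    k = solve 2 (λ D H → # 0 := :- (# 1 :* (D :* # 0 :* H))) refl (fact (k ℕ.* 2 ℕ.+ 0)) (1/16ᵏk!⁴ k)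
  ∑-±t-term (suc N) k = begin
    ∑ N (λ n → odd n * pow -1ℚ n * t-term n k) + odd N * s * (D * R * H)
      ≡⟨ cong (_+ odd N * s * (D * R * H)) (trans (∑-±t-term N k) (cong (λ z → - (s * (D * z * H))) (rf∸-odd N k))) ⟩
    - (s * (D * ((x - ι 2 * y) * R) * H)) + odd N * s * (D * R * H)
      ≡⟨ solve 6 (λ x y D R H s → :- (s :* (D :* ((x :- # 2 :* y) :* R) :* H)) :+ (# 2 :* x :+ # 1) :* s :* (D :* R :* H)
                   := :- (:- # 1 :* s :* ((# 2 :* y :+ x :+ # 1) :* D :* R :* H))) refl x y D R H s ⟩
    - (-1ℚ * s * ((ι 2 * y + x + 1ℚ) * D * R * H))
      ≡⟨ cong (λ z → - (-1ℚ * s * z)) (sym (t-partial-suc N k)) ⟩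
    - (-1ℚ * s * t-partial (suc N) k) ∎
    where x = ι N ; y = ι k ; D = fact (k ℕ.* 2 ℕ.+ N) ; R = rf∸ N (k ℕ.* 2) ; H = 1/16ᵏk!⁴ k ; s = pow -1ℚ N

  -- (-1)ᵏ C(m,k) C(m+k,k)
  legendre : ℕ → ℕ → ℚ
  legendre m k = pow -1ℚ k * fact (k ℕ.+ m) * rf∸ m k * sq (rf k)

  legendre-suc : ∀ m k → legendre m (suc k) ≡ - ((ι k + ι m + 1ℚ) * (ι m - ι k) * sq (inv k)) * legendre m k
  legendre-suc m k = begin
    -1ℚ * s * (ι (suc (k ℕ.+ m)) * D) * rf∸ m (suc k) * sq (inv k * rf k)
      ≡⟨ cong₂ (λ z w → -1ℚ * s * (z * D) * w * sq (inv k * rf k)) (trans (ι-suc _) (cong (_+ 1ℚ) (ι-+ k m))) (rf∸-suc m k) ⟩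
    -1ℚ * s * ((ι k + ι m + 1ℚ) * D) * ((ι m - ι k) * rf∸ m k) * sq (inv k * rf k)
      ≡⟨ solve 7 (λ x y i s D R Q → :- # 1 :* s :* ((y :+ x :+ # 1) :* D) :* ((x :- y) :* R) :* (i :* Q :* (i :* Q)) := :- ((y :+ x :+ # 1) :* (x :- y) :* (i :* i)) :* (s :* D :* R :* (Q :* Q))) refl (ι m) (ι k) (inv k) s D (rf∸ m k) (rf k) ⟩
    - ((ι k + ι m + 1ℚ) * (ι m - ι k) * sq (inv k)) * legendre m k ∎
    where s = pow -1ℚ k ; D = fact (k ℕ.+ m)

  -- Π_{j≤k} (1 - p²/(2j)²)
  evenProduct : ℚ → ℕ → ℚ
  evenProduct p zero    = 1ℚ
  evenProduct p (suc k) = evenProduct p k * (1ℚ - sq p * (inv 3 * sq (inv k)))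

  ι-inv′ : ∀ k → (ι k + 1ℚ) * inv k ≡ 1ℚ
  ι-inv′ k = trans (cong (_* inv k) (sym (ι-suc k))) (ι-inv k)

  inv15 : inv 15 ≡ sq (inv 3)
  inv15 = ι-cancel 15 (trans (ι-inv 15) (sym (trans (solve 1 (λ e → # 16 :* (e :* e) := # 4 :* e :* (# 4 :* e)) refl (inv 3)) (trans (cong sq (ι-inv 3)) (*-identityˡ 1ℚ)))))

  -- With p = 2m+1, the quotient of consecutive terms in k has numerator
  -- (p+2k+1)(p-2k-1)(p+2k+2)(p-2k-2). The first two factors are 2(m+k+1) and 2(m-k) and give the
  -- quotient of Legendre coefficients; the last two give p² - (2k+2)², the new factor of
  -- `evenProduct`. At k = 0 both sides are p!/(p-1)! = p.
  t-partial≡ : ∀ m k → t-partial (suc (m ℕ.* 2)) k ≡ odd m * (legendre m k * evenProduct (odd m) k)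
  t-partial≡ m zero = begin
    ι (suc (m ℕ.* 2)) * fact (m ℕ.* 2) * rf (m ℕ.* 2) * 1ℚ
      ≡⟨ solve 3 (λ x y z → x :* y :* z :* # 1 := x :* (y :* z)) refl (ι (suc (m ℕ.* 2))) (fact (m ℕ.* 2)) (rf (m ℕ.* 2)) ⟩
    ι (suc (m ℕ.* 2)) * (fact (m ℕ.* 2) * rf (m ℕ.* 2))
      ≡⟨ cong₂ _*_ (trans (ι-suc _) (cong (_+ 1ℚ) (ι-*2 m))) (trans (fact*rf (m ℕ.* 2)) (sym (fact*rf m))) ⟩
    odd m * (fact m * rf m)
      ≡⟨ solve 3 (λ p x y → p :* (x :* y) := p :* ((# 1 :* x :* y :* (# 1 :* # 1)) :* # 1)) refl (odd m) (fact m) (rf m) ⟩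
    odd m * (legendre m zero * 1ℚ) ∎
  t-partial≡ m (suc k) = begin
    fact (suc k ℕ.* 2 ℕ.+ p) * rf∸ (m ℕ.* 2) (suc (suc (k ℕ.* 2))) * (inv 15 * (sq (sq i) * 1/16ᵏk!⁴ k))
      ≡⟨ cong₂ (λ z w → z * w * (inv 15 * (sq (sq i) * 1/16ᵏk!⁴ k))) (fact-2+[2k+n] k p)
         (trans (rf∸-suc (m ℕ.* 2) (suc (k ℕ.* 2))) (cong₂ _*_ (cong₂ _-_ (ι-*2 m) (trans (ι-suc _) (cong (_+ 1ℚ) (ι-*2 k)))) (trans (rf∸-suc (m ℕ.* 2) (k ℕ.* 2)) (cong (_* R) (cong₂ _-_ (ι-*2 m) (ι-*2 k)))))) ⟩
    (ι 2 * y + ι p + ι 2) * ((ι 2 * y + ι p + 1ℚ) * D) * ((ι 2 * x - (ι 2 * y + 1ℚ)) * ((ι 2 * x - ι 2 * y) * R)) * (inv 15 * (sq (sq i) * 1/16ᵏk!⁴ k))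
      ≡⟨ cong₂ (λ z w → (ι 2 * y + z + ι 2) * ((ι 2 * y + z + 1ℚ) * D) * ((ι 2 * x - (ι 2 * y + 1ℚ)) * ((ι 2 * x - ι 2 * y) * R)) * (w * (sq (sq i) * 1/16ᵏk!⁴ k))) ιp inv15 ⟩
    (ι 2 * y + odd m + ι 2) * ((ι 2 * y + odd m + 1ℚ) * D) * ((ι 2 * x - (ι 2 * y + 1ℚ)) * ((ι 2 * x - ι 2 * y) * R)) * (sq e * (sq (sq i) * 1/16ᵏk!⁴ k))
      ≡⟨ solve 7 (λ x y i e D R H → let z = # 2 :* x :+ # 1 in
           (# 2 :* y :+ z :+ # 2) :* ((# 2 :* y :+ z :+ # 1) :* D) :* ((# 2 :* x :- (# 2 :* y :+ # 1)) :* ((# 2 :* x :- # 2 :* y) :* R)) :* (e :* e :* (i :* i :* (i :* i) :* H))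
           := (# 4 :* e) :* (e :* (i :* i) :* (z :+ # 2 :* (y :+ # 1)) :* (z :- # 2 :* (y :+ # 1))) :* (((y :+ x :+ # 1) :* (x :- y) :* (i :* i))) :* (D :* R :* H)) refl x y i e D R (1/16ᵏk!⁴ k) ⟩
    (ι 4 * e) * (e * sq i * (odd m + ι 2 * (y + 1ℚ)) * (odd m - ι 2 * (y + 1ℚ))) * c * (D * R * 1/16ᵏk!⁴ k)
      ≡⟨ cong₂ (λ z w → z * (e * sq i * (odd m + ι 2 * (y + 1ℚ)) * (odd m - ι 2 * (y + 1ℚ))) * c * w) (ι-inv 3) (t-partial≡ m k) ⟩
    1ℚ * (e * sq i * (odd m + ι 2 * (y + 1ℚ)) * (odd m - ι 2 * (y + 1ℚ))) * c * (odd m * (legendre m k * evenProduct (odd m) k))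
      -- The 1 in `1ℚ - sq p * (inv 3 * sq (inv k))` is represented by 4e((y+1)i)², so that the
      -- identity becomes one of polynomials; the sign goes to `- c`.
      ≡⟨ solve 7 (λ p y i e c A B → # 1 :* (e :* (i :* i) :* (p :+ # 2 :* (y :+ # 1)) :* (p :- # 2 :* (y :+ # 1))) :* c :* (p :* (A :* B))
            := p :* (:- c :* A :* (B :* ((# 4 :* e) :* ((y :+ # 1) :* i) :* ((y :+ # 1) :* i) :- p :* p :* (e :* (i :* i)))))) refl (odd m) y i e c (legendre m k) (evenProduct (odd m) k) ⟩
    odd m * (- c * legendre m k * (evenProduct (odd m) k * ((ι 4 * e) * ((y + 1ℚ) * i) * ((y + 1ℚ) * i) - sq (odd m) * (e * sq i))))
      ≡⟨ cong₂ (λ z w → odd m * (- c * legendre m k * (evenProduct (odd m) k * (z * w * w - sq (odd m) * (e * sq i))))) (ι-inv 3) (ι-inv′ k) ⟩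
    odd m * (- c * legendre m k * (evenProduct (odd m) k * (1ℚ * 1ℚ * 1ℚ - sq (odd m) * (e * sq i))))
      ≡⟨ cong (λ z → odd m * (- c * legendre m k * (evenProduct (odd m) k * (z - sq (odd m) * (e * sq i))))) (trans (*-identityʳ _) (*-identityʳ _)) ⟩
    odd m * (- c * legendre m k * evenProduct (odd m) (suc k))
      ≡⟨ cong (λ z → odd m * (z * evenProduct (odd m) (suc k))) (sym (legendre-suc m k)) ⟩
    odd m * (legendre m (suc k) * evenProduct (odd m) (suc k)) ∎
    where
    p = suc (m ℕ.* 2) ; x = ι m ; y = ι k ; i = inv k ; e = inv 3
    D = fact (k ℕ.* 2 ℕ.+ p) ; R = rf∸ (m ℕ.* 2) (k ℕ.* 2)
    c = (ι k + ι m + 1ℚ) * (ι m - ι k) * sq (inv k)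
    ιp : ι p ≡ odd m
    ιp = trans (ι-suc _) (cong (_+ 1ℚ) (ι-*2 m))

  -- Sums over the coefficients of the shifted Legendre polynomial

  -- legendre m and legendre (suc m) are both multiples of pair m, whose sums telescope.
  pair : ℕ → ℕ → ℚ
  pair m k = pow -1ℚ k * fact (k ℕ.+ m) * rf∸ (suc m) k * sq (rf k)

  legendre≡pair : ∀ m k → legendre m k ≡ (ι m + 1ℚ - ι k) * pair m k × legendre (suc m) k ≡ (ι k + ι m + 1ℚ) * pair m k
  legendre≡pair m k =
    trans (cong (λ z → s * D * z * sq (rf k)) (rf∸-unsuc m k))
      (solve 5 (λ s D c R q → s :* D :* (c :* R) :* q := c :* (s :* D :* R :* q)) refl s D (ι m + 1ℚ - ι k) (rf∸ (suc m) k) (sq (rf k))) ,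
    trans (cong (λ z → s * z * rf∸ (suc m) k * sq (rf k)) (trans (cong fact (ℕₚ.+-suc k m)) (cong (_* D) (trans (ι-suc _) (cong (_+ 1ℚ) (ι-+ k m))))))
      (solve 5 (λ s D c R q → s :* (c :* D) :* R :* q := c :* (s :* D :* R :* q)) refl s D (ι k + ι m + 1ℚ) (rf∸ (suc m) k) (sq (rf k)))
    where s = pow -1ℚ k ; D = fact (k ℕ.+ m)

  -- In the sum of the multipliers m+1-k and m+1+k the index k cancels, so summation over k meets
  -- only `pair m`.
  legendre+legendre : ∀ m k → legendre (suc m) k + legendre m k ≡ ι 2 * (ι m + 1ℚ) * pair m k
  legendre+legendre m k = trans (cong₂ _+_ (proj₂ (legendre≡pair m k)) (proj₁ (legendre≡pair m k)))
    (solve 3 (λ x y b → (y :+ x :+ # 1) :* b :+ (x :+ # 1 :- y) :* b := # 2 :* (x :+ # 1) :* b) refl (ι m) (ι k) (pair m k))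

  -- The weights 2m+3 and 2m+1 are those for which 2k+1 factors out: (2m+3)(m+1+k) - (2m+1)(m+1-k) =
  -- (2k+1)(2m+2). This cancels the denominators in `∑legendre/odd`.
  odd*legendre-odd*legendre : ∀ m k → odd (suc m) * legendre (suc m) k - odd m * legendre m k ≡ odd k * (ι 2 * (ι m + 1ℚ) * pair m k)
  odd*legendre-odd*legendre m k = trans (cong₂ (λ z w → odd (suc m) * z - odd m * w) (proj₂ (legendre≡pair m k)) (proj₁ (legendre≡pair m k)))
    (trans (cong (λ z → (ι 2 * z + 1ℚ) * ((ι k + ι m + 1ℚ) * pair m k) - odd m * ((ι m + 1ℚ - ι k) * pair m k)) (ι-suc m))
    (solve 3 (λ x y b → (# 2 :* (x :+ # 1) :+ # 1) :* ((y :+ x :+ # 1) :* b) :- (# 2 :* x :+ # 1) :* ((x :+ # 1 :- y) :* b) := (# 2 :* y :+ # 1) :* (# 2 :* (x :+ # 1) :* b)) refl (ι m) (ι k) (pair m k)))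

  pair-cert : ℕ → ℕ → ℚ
  pair-cert m k = sq (ι k) * pair m k

  pair-suc : ∀ m k → pair m (suc k) ≡ - ((ι m + 1ℚ + ι k) * (ι m + 1ℚ - ι k) * sq (inv k)) * pair m k
  pair-suc m k = begin
    -1ℚ * s * (ι (suc (k ℕ.+ m)) * D) * rf∸ (suc m) (suc k) * sq (inv k * rf k)
      ≡⟨ cong₂ (λ z w → -1ℚ * s * (z * D) * w * sq (inv k * rf k)) (trans (ι-suc _) (cong (_+ 1ℚ) (ι-+ k m))) (trans (rf∸-suc (suc m) k) (cong (λ z → (z - ι k) * rf∸ (suc m) k) (ι-suc m))) ⟩
    -1ℚ * s * ((ι k + ι m + 1ℚ) * D) * ((ι m + 1ℚ - ι k) * rf∸ (suc m) k) * sq (inv k * rf k)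
      ≡⟨ solve 7 (λ x y i s D R Q → :- # 1 :* s :* ((y :+ x :+ # 1) :* D) :* ((x :+ # 1 :- y) :* R) :* (i :* Q :* (i :* Q)) := :- ((x :+ # 1 :+ y) :* (x :+ # 1 :- y) :* (i :* i)) :* (s :* D :* R :* (Q :* Q))) refl (ι m) (ι k) (inv k) s D (rf∸ (suc m) k) (rf k) ⟩
    - ((ι m + 1ℚ + ι k) * (ι m + 1ℚ - ι k) * sq (inv k)) * pair m k ∎
    where s = pow -1ℚ k ; D = fact (k ℕ.+ m)

  -- The quotient of consecutive terms gives (k+1)² `pair m (suc k)` = -((m+1)² - k²) `pair m k`,
  -- and subtracting k² `pair m k` removes k.
  pair-cert-suc : ∀ m k → pair-cert m (suc k) - pair-cert m k ≡ - (sq (ι m + 1ℚ)) * pair m k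
  pair-cert-suc m k = begin
    sq (ι (suc k)) * pair m (suc k) - pair-cert m k
      ≡⟨ cong₂ (λ z w → sq z * w - pair-cert m k) (ι-suc k) (pair-suc m k) ⟩
    sq (y + 1ℚ) * (- ((x + 1ℚ + y) * (x + 1ℚ - y) * sq i) * pair m k) - sq y * pair m k
      ≡⟨ solve 4 (λ x y i b → (y :+ # 1) :* (y :+ # 1) :* (:- ((x :+ # 1 :+ y) :* (x :+ # 1 :- y) :* (i :* i)) :* b) :- y :* y :* b
           := :- ((x :+ # 1 :+ y) :* (x :+ # 1 :- y)) :* (((y :+ # 1) :* i) :* ((y :+ # 1) :* i)) :* b :- y :* y :* b) refl x y i (pair m k) ⟩
    - ((x + 1ℚ + y) * (x + 1ℚ - y)) * sq ((y + 1ℚ) * i) * pair m k - sq y * pair m k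
      ≡⟨ cong (λ z → - ((x + 1ℚ + y) * (x + 1ℚ - y)) * sq z * pair m k - sq y * pair m k) (ι-inv′ k) ⟩
    - ((x + 1ℚ + y) * (x + 1ℚ - y)) * sq 1ℚ * pair m k - sq y * pair m k
      ≡⟨ solve 3 (λ x y b → :- ((x :+ # 1 :+ y) :* (x :+ # 1 :- y)) :* (# 1 :* # 1) :* b :- y :* y :* b := :- ((x :+ # 1) :* (x :+ # 1)) :* b) refl x y (pair m k) ⟩
    - (sq (x + 1ℚ)) * pair m k ∎
    where x = ι m ; y = ι k ; i = inv k

  H₂ : ℕ → ℚ
  H₂ n = ∑ n (λ j → sq (inv j))

  pair-zero : ∀ m k → suc m < k → pair m k ≡ 0ℚ
  pair-zero m k m<k = trans (cong (λ z → pow -1ℚ k * fact (k ℕ.+ m) * z * sq (rf k)) (rf∸-zero m<k))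
    (solve 2 (λ x y → x :* # 0 :* y := # 0) refl (pow -1ℚ k * fact (k ℕ.+ m)) (sq (rf k)))

  legendre-zero : ∀ m k → m < k → legendre m k ≡ 0ℚ
  legendre-zero m k m<k = trans (cong (λ z → pow -1ℚ k * fact (k ℕ.+ m) * z * sq (rf k)) (rf∸-zero m<k))
    (solve 2 (λ x y → x :* # 0 :* y := # 0) refl (pow -1ℚ k * fact (k ℕ.+ m)) (sq (rf k)))

  sq-cancel : ∀ m {x y} → - (sq (ι m + 1ℚ)) * x ≡ y → x ≡ - (sq (inv m)) * y
  sq-cancel m {x} {y} eq = begin
    x                                             ≡⟨ solve 1 (λ x → x := # 1 :* # 1 :* x) refl x ⟩
    1ℚ * 1ℚ * x                                   ≡⟨ cong (λ z → z * z * x) (sym (ι-inv′ m)) ⟩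
    (ι m + 1ℚ) * inv m * ((ι m + 1ℚ) * inv m) * x ≡⟨ solve 3 (λ m i x → (m :+ # 1) :* i :* ((m :+ # 1) :* i) :* x := :- (i :* i) :* (:- ((m :+ # 1) :* (m :+ # 1)) :* x)) refl (ι m) (inv m) x ⟩
    - (sq (inv m)) * (- (sq (ι m + 1ℚ)) * x)      ≡⟨ cong (- (sq (inv m)) *_) eq ⟩
    - (sq (inv m)) * y ∎

  ∑pair : ∀ m K → suc m < K → ∑ K (pair m) ≡ 0ℚ
  ∑pair m K m<K = trans (sq-cancel m (begin
    - (sq (ι m + 1ℚ)) * ∑ K (pair m)               ≡⟨ ∑-*ˡ K (- (sq (ι m + 1ℚ))) (pair m) ⟨
    ∑ K (λ k → - (sq (ι m + 1ℚ)) * pair m k)       ≡⟨ ∑-cong′ K (λ k → sym (pair-cert-suc m k)) ⟩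
    ∑ K (λ k → pair-cert m (suc k) - pair-cert m k)             ≡⟨ ∑-telescope K (pair-cert m) ⟩
    pair-cert m K - pair-cert m 0                               ≡⟨ cong (λ z → sq (ι K) * z - pair-cert m 0) (pair-zero m K m<K) ⟩
    sq (ι K) * 0ℚ - sq 0ℚ * pair m 0               ≡⟨ solve 2 (λ x y → x :* # 0 :- # 0 :* # 0 :* y := # 0) refl (sq (ι K)) (pair m 0) ⟩
    0ℚ ∎)) (zeroʳ _)

  -- Summation by parts.
  ∑pair-H₂ : ∀ m → ∑ (suc (suc m)) (λ k → pair m k * H₂ k) ≡ - (sq (inv m) * inv m)
  ∑pair-H₂ m = trans (sq-cancel m (begin
    - (sq (ι m + 1ℚ)) * ∑ K (λ k → pair m k * H₂ k)
      ≡⟨ ∑-*ˡ K (- (sq (ι m + 1ℚ))) _ ⟨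
    ∑ K (λ k → - (sq (ι m + 1ℚ)) * (pair m k * H₂ k))
      ≡⟨ ∑-cong′ K summand ⟩
    ∑ K (λ k → (pair-cert m (suc k) * H₂ (suc k) - pair-cert m k * H₂ k) + -1ℚ * pair m (suc k))
      ≡⟨ ∑-+ K _ _ ⟩
    ∑ K (λ k → pair-cert m (suc k) * H₂ (suc k) - pair-cert m k * H₂ k) + ∑ K (λ k → -1ℚ * pair m (suc k))
      ≡⟨ cong₂ _+_ (∑-telescope K (λ k → pair-cert m k * H₂ k)) (∑-*ˡ K -1ℚ _) ⟩
    pair-cert m K * H₂ K - pair-cert m 0 * H₂ 0 + -1ℚ * ∑ K (λ k → pair m (suc k))
      ≡⟨ cong₂ (λ z w → sq (ι K) * z * H₂ K - pair-cert m 0 * H₂ 0 + -1ℚ * w) (pair-zero m K ℕₚ.≤-refl) ∑b-suc ⟩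
    sq (ι K) * 0ℚ * H₂ K - sq 0ℚ * pair m 0 * 0ℚ + -1ℚ * - (inv m)
      ≡⟨ solve 4 (λ x h c i → x :* # 0 :* h :- # 0 :* # 0 :* c :* # 0 :+ :- # 1 :* :- i := i) refl (sq (ι K)) (H₂ K) (pair m 0) (inv m) ⟩
    inv m ∎)) (solve 1 (λ i → :- (i :* i) :* i := :- (i :* i :* i)) refl (inv m))
    where
    K = suc (suc m)

    summand : ∀ k → - (sq (ι m + 1ℚ)) * (pair m k * H₂ k) ≡ (pair-cert m (suc k) * H₂ (suc k) - pair-cert m k * H₂ k) + -1ℚ * pair m (suc k)
    summand k = begin
      - (sq (ι m + 1ℚ)) * (pair m k * H₂ k)
        ≡⟨ *-assoc _ _ _ ⟨
      - (sq (ι m + 1ℚ)) * pair m k * H₂ k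
        ≡⟨ cong (_* H₂ k) (pair-cert-suc m k) ⟨
      (pair-cert m (suc k) - pair-cert m k) * H₂ k
        -- The increment 1/(k+1)² of `H₂` meets the factor (k+1)² of the certificate. The correction
        -- is therefore `pair m (suc k)`, whose sum is the full sum 0 minus the term at k = 0.
        ≡⟨ solve 5 (λ j β G₀ h i → (j :* j :* β :- G₀) :* h := (j :* j :* β :* (h :+ i :* i) :- G₀ :* h) :+ :- # 1 :* ((j :* i) :* (j :* i) :* β)) refl (ι (suc k)) (pair m (suc k)) (pair-cert m k) (H₂ k) (inv k) ⟩
      (pair-cert m (suc k) * H₂ (suc k) - pair-cert m k * H₂ k) + -1ℚ * (sq (ι (suc k) * inv k) * pair m (suc k))
        ≡⟨ cong (λ z → (pair-cert m (suc k) * H₂ (suc k) - pair-cert m k * H₂ k) + -1ℚ * (sq z * pair m (suc k))) (ι-inv k) ⟩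
      (pair-cert m (suc k) * H₂ (suc k) - pair-cert m k * H₂ k) + -1ℚ * (sq 1ℚ * pair m (suc k))
        ≡⟨ cong (λ z → (pair-cert m (suc k) * H₂ (suc k) - pair-cert m k * H₂ k) + -1ℚ * z) (solve 1 (λ x → # 1 :* # 1 :* x := x) refl (pair m (suc k))) ⟩
      (pair-cert m (suc k) * H₂ (suc k) - pair-cert m k * H₂ k) + -1ℚ * pair m (suc k) ∎

    b0 : pair m 0 ≡ inv m
    b0 = begin
      1ℚ * fact m * (inv m * rf m) * sq 1ℚ
        ≡⟨ solve 3 (λ x i y → # 1 :* x :* (i :* y) :* (# 1 :* # 1) := i :* (x :* y)) refl (fact m) (inv m) (rf m) ⟩
      inv m * (fact m * rf m)
        ≡⟨ trans (cong (inv m *_) (fact*rf m)) (*-identityʳ _) ⟩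
      inv m ∎

    ∑b-suc : ∑ K (λ k → pair m (suc k)) ≡ - (inv m)
    ∑b-suc = begin
      ∑ K (λ k → pair m (suc k))
        ≡⟨ solve 2 (λ s t → s := :- t :+ (t :+ s)) refl _ (pair m 0) ⟩
      - pair m 0 + (pair m 0 + ∑ K (λ k → pair m (suc k)))
        ≡⟨ cong₂ (λ z w → - z + w) b0 (trans (sym (∑-head K (pair m))) (∑pair m (suc K) (ℕₚ.n≤1+n _))) ⟩
      - inv m + 0ℚ ≡⟨ +-identityʳ _ ⟩
      - inv m ∎

  ∑legendre ∑legendre/odd : ℕ → (ℕ → ℚ) → ℚ
  ∑legendre m φ = ∑ (suc m) (λ k → legendre m k * φ k)
  ∑legendre/odd m φ = ∑ (suc m) (λ k → legendre m k * φ k * inv (k ℕ.* 2))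

  odd-inv : ∀ k → odd k * inv (k ℕ.* 2) ≡ 1ℚ
  odd-inv k = trans (cong (_* inv (k ℕ.* 2)) (sym (trans (ι-suc (k ℕ.* 2)) (cong (_+ 1ℚ) (ι-*2 k))))) (ι-inv (k ℕ.* 2))

  ∑legendre-extend : ∀ m φ → ∑legendre m φ ≡ ∑ (suc (suc m)) (λ k → legendre m k * φ k)
  ∑legendre-extend m φ = sym (∑-truncate (suc m) (suc (suc m)) (λ k m<k → trans (cong (_* φ k) (legendre-zero m k m<k)) (zeroˡ _)) (ℕₚ.n≤1+n _))

  ∑legendre/odd-extend : ∀ m φ → ∑legendre/odd m φ ≡ ∑ (suc (suc m)) (λ k → legendre m k * φ k * inv (k ℕ.* 2))
  ∑legendre/odd-extend m φ = sym (∑-truncate (suc m) (suc (suc m)) (λ k m<k → trans (cong (λ z → z * φ k * inv (k ℕ.* 2)) (legendre-zero m k m<k)) (solve 2 (λ x y → # 0 :* x :* y := # 0) refl (φ k) (inv (k ℕ.* 2)))) (ℕₚ.n≤1+n _))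

  ∑legendre-suc : ∀ m φ → ∑legendre (suc m) φ + ∑legendre m φ ≡ ι 2 * (ι m + 1ℚ) * ∑ (suc (suc m)) (λ k → pair m k * φ k)
  ∑legendre-suc m φ = begin
    ∑legendre (suc m) φ + ∑legendre m φ
      ≡⟨ cong (λ z → ∑legendre (suc m) φ + z) (∑legendre-extend m φ) ⟩
    ∑legendre (suc m) φ + ∑ K (λ k → legendre m k * φ k)
      ≡⟨ ∑-+ K _ _ ⟨
    ∑ K (λ k → legendre (suc m) k * φ k + legendre m k * φ k)
      ≡⟨ ∑-cong′ K (λ k → trans (sym (distribʳ (φ k) _ _)) (trans (cong (_* φ k) (legendre+legendre m k)) (*-assoc _ _ _))) ⟩
    ∑ K (λ k → ι 2 * (ι m + 1ℚ) * (pair m k * φ k))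
      ≡⟨ ∑-*ˡ K _ _ ⟩
    ι 2 * (ι m + 1ℚ) * ∑ K (λ k → pair m k * φ k) ∎
    where K = suc (suc m)

  ∑legendre/odd-suc : ∀ m φ → odd (suc m) * ∑legendre/odd (suc m) φ - odd m * ∑legendre/odd m φ ≡ ι 2 * (ι m + 1ℚ) * ∑ (suc (suc m)) (λ k → pair m k * φ k)
  ∑legendre/odd-suc m φ = begin
    odd (suc m) * ∑legendre/odd (suc m) φ - odd m * ∑legendre/odd m φ
      ≡⟨ cong (λ z → odd (suc m) * ∑legendre/odd (suc m) φ - odd m * z) (∑legendre/odd-extend m φ) ⟩
    odd (suc m) * ∑legendre/odd (suc m) φ - odd m * ∑ K (λ k → legendre m k * φ k * inv (k ℕ.* 2))
      ≡⟨ solve 4 (λ p s q t → p :* s :- q :* t := p :* s :+ (:- q) :* t) refl (odd (suc m)) (∑legendre/odd (suc m) φ) (odd m) _ ⟩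
    odd (suc m) * ∑legendre/odd (suc m) φ + - odd m * ∑ K (λ k → legendre m k * φ k * inv (k ℕ.* 2))
      ≡⟨ cong₂ _+_ (∑-*ˡ K (odd (suc m)) _) (∑-*ˡ K (- odd m) _) ⟨
    ∑ K (λ k → odd (suc m) * (legendre (suc m) k * φ k * inv (k ℕ.* 2))) + ∑ K (λ k → - odd m * (legendre m k * φ k * inv (k ℕ.* 2)))
      ≡⟨ ∑-+ K _ _ ⟨
    ∑ K (λ k → odd (suc m) * (legendre (suc m) k * φ k * inv (k ℕ.* 2)) + - odd m * (legendre m k * φ k * inv (k ℕ.* 2)))
      ≡⟨ ∑-cong′ K summand ⟩
    ∑ K (λ k → ι 2 * (ι m + 1ℚ) * (pair m k * φ k))
      ≡⟨ ∑-*ˡ K _ _ ⟩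
    ι 2 * (ι m + 1ℚ) * ∑ K (λ k → pair m k * φ k) ∎
    where
    K = suc (suc m)
    summand : ∀ k → odd (suc m) * (legendre (suc m) k * φ k * inv (k ℕ.* 2)) + - odd m * (legendre m k * φ k * inv (k ℕ.* 2)) ≡ ι 2 * (ι m + 1ℚ) * (pair m k * φ k)
    summand k = begin
      odd (suc m) * (legendre (suc m) k * φ k * j) + - odd m * (legendre m k * φ k * j)
        ≡⟨ solve 6 (λ p s q t f j → p :* (s :* f :* j) :+ (:- q) :* (t :* f :* j) := (p :* s :- q :* t) :* f :* j) refl (odd (suc m)) (legendre (suc m) k) (odd m) (legendre m k) (φ k) j ⟩
      (odd (suc m) * legendre (suc m) k - odd m * legendre m k) * φ k * j
        ≡⟨ cong (λ z → z * φ k * j) (odd*legendre-odd*legendre m k) ⟩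
      odd k * (ι 2 * (ι m + 1ℚ) * pair m k) * φ k * j
        ≡⟨ solve 5 (λ o c β f j → o :* (c :* β) :* f :* j := o :* j :* (c :* (β :* f))) refl (odd k) (ι 2 * (ι m + 1ℚ)) (pair m k) (φ k) j ⟩
      odd k * j * (ι 2 * (ι m + 1ℚ) * (pair m k * φ k))
        ≡⟨ trans (cong (_* (ι 2 * (ι m + 1ℚ) * (pair m k * φ k))) (odd-inv k)) (*-identityˡ _) ⟩
      ι 2 * (ι m + 1ℚ) * (pair m k * φ k) ∎
      where j = inv (k ℕ.* 2)

  one : ℕ → ℚ
  one _ = 1ℚ

  2m+2*∑pair : ∀ m → ι 2 * (ι m + 1ℚ) * ∑ (suc (suc m)) (λ k → pair m k * one k) ≡ 0ℚ
  2m+2*∑pair m = trans (cong (ι 2 * (ι m + 1ℚ) *_) (trans (∑-cong′ (suc (suc m)) (λ k → *-identityʳ _)) (∑pair m (suc (suc m)) ℕₚ.≤-refl))) (zeroʳ _)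

  2m+2*∑pair-H₂ : ∀ m → ι 2 * (ι m + 1ℚ) * ∑ (suc (suc m)) (λ k → pair m k * H₂ k) ≡ - (ι 2 * sq (inv m))
  2m+2*∑pair-H₂ m = begin
    ι 2 * (ι m + 1ℚ) * ∑ (suc (suc m)) (λ k → pair m k * H₂ k)  ≡⟨ cong (ι 2 * (ι m + 1ℚ) *_) (∑pair-H₂ m) ⟩
    ι 2 * (ι m + 1ℚ) * - (sq (inv m) * inv m)                ≡⟨ solve 2 (λ x i → # 2 :* (x :+ # 1) :* :- (i :* i :* i) := :- (# 2 :* (((x :+ # 1) :* i) :* (i :* i)))) refl (ι m) (inv m) ⟩
    - (ι 2 * ((ι m + 1ℚ) * inv m * sq (inv m)))              ≡⟨ cong (λ z → - (ι 2 * z)) (trans (cong (_* sq (inv m)) (ι-inv′ m)) (*-identityˡ _)) ⟩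
    - (ι 2 * sq (inv m)) ∎

  +-moveʳ : ∀ {x y z} → x + y ≡ z → x ≡ z - y
  +-moveʳ {x} {y} refl = solve 2 (λ x y → x := x :+ y :- y) refl x y

  -- The value at x = 1 of the shifted Legendre polynomial P_m(1-2x). Here it follows because
  -- consecutive values add up to a multiple of the sum of `pair m`, which is 0.
  ∑legendre-one : ∀ m → ∑legendre m one ≡ pow -1ℚ m
  ∑legendre-one zero = solve 0 (# 0 :+ # 1 :* # 1 :* # 1 :* (# 1 :* # 1) :* # 1 := # 1) refl
  ∑legendre-one (suc m) = trans (+-moveʳ (trans (∑legendre-suc m one) (2m+2*∑pair m))) (trans (cong (λ z → 0ℚ - z) (∑legendre-one m)) (solve 1 (λ x → # 0 :- x := :- # 1 :* x) refl (pow -1ℚ m)))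

  -- Σ_{j=1}^n (-1)ʲ/j²
  A₂ : ℕ → ℚ
  A₂ n = ∑ n (λ j → pow -1ℚ (suc j) * sq (inv j))

  pow-±-sq : ∀ n → sq (pow -1ℚ n) ≡ 1ℚ
  pow-±-sq n = trans (sym (pow-* -1ℚ -1ℚ n)) (trans (cong (λ z → pow z n) (solve 0 (:- # 1 :* :- # 1 := # 1) refl)) (pow-1 n))

  -- The sum of consecutive values is -2/(m+1)². Solving this recurrence introduces the sign (-1)ᵐ
  -- and turns the harmonic sum into an alternating one.
  ∑legendre-H₂ : ∀ m → ∑legendre m H₂ ≡ - (ι 2 * (pow -1ℚ m * A₂ m))
  ∑legendre-H₂ zero = solve 0 (# 0 :+ # 1 :* # 1 :* # 1 :* (# 1 :* # 1) :* # 0 := :- (# 2 :* (# 1 :* # 0))) refl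
  ∑legendre-H₂ (suc m) = begin
    ∑legendre (suc m) H₂
      ≡⟨ +-moveʳ (trans (∑legendre-suc m H₂) (2m+2*∑pair-H₂ m)) ⟩
    - (ι 2 * i) - ∑legendre m H₂
      ≡⟨ cong₂ (λ z w → - (ι 2 * z) - w) (trans (sym (*-identityˡ i)) (cong (_* i) (sym (pow-±-sq m)))) (∑legendre-H₂ m) ⟩
    - (ι 2 * (sq s * i)) - - (ι 2 * (s * A₂ m))
      ≡⟨ solve 3 (λ s i A → :- (# 2 :* (s :* s :* i)) :- :- (# 2 :* (s :* A)) := :- (# 2 :* (:- # 1 :* s :* (A :+ :- # 1 :* s :* i)))) refl s i (A₂ m) ⟩
    - (ι 2 * (-1ℚ * s * (A₂ m + -1ℚ * s * i))) ∎
    where i = sq (inv m) ; s = pow -1ℚ m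

  -- The integral of P_m(1-2x²) over [0,1] is 1/(2m+1). The factor `odd m` stays on the left since
  -- it becomes p; with it the left side is constant in m.
  odd*∑legendre/odd-one : ∀ m → odd m * ∑legendre/odd m one ≡ 1ℚ
  odd*∑legendre/odd-one zero = trans (solve 1 (λ i → (# 2 :* # 0 :+ # 1) :* (# 0 :+ # 1 :* # 1 :* # 1 :* (# 1 :* # 1) :* # 1 :* i) := # 1 :* i) refl (inv 0)) (ι-inv 0)
  odd*∑legendre/odd-one (suc m) = trans (solve 2 (λ x y → x := x :- y :+ y) refl _ (odd m * ∑legendre/odd m one)) (trans (cong₂ _+_ (trans (∑legendre/odd-suc m one) (2m+2*∑pair m)) (odd*∑legendre/odd-one m)) (+-identityˡ _))

  odd*∑legendre/odd-H₂ : ∀ m → odd m * ∑legendre/odd m H₂ ≡ - (ι 2 * H₂ m)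
  odd*∑legendre/odd-H₂ zero = solve 1 (λ i → (# 2 :* # 0 :+ # 1) :* (# 0 :+ # 1 :* # 1 :* # 1 :* (# 1 :* # 1) :* # 0 :* i) := :- (# 2 :* # 0)) refl (inv 0)
  odd*∑legendre/odd-H₂ (suc m) = trans (solve 2 (λ x y → x := x :- y :+ y) refl _ (odd m * ∑legendre/odd m H₂)) (trans (cong₂ _+_ (trans (∑legendre/odd-suc m H₂) (2m+2*∑pair-H₂ m)) (odd*∑legendre/odd-H₂ m))
    (solve 2 (λ i h → :- (# 2 :* i) :+ :- (# 2 :* h) := :- (# 2 :* (h :+ i))) refl (sq (inv m)) (H₂ m)))

  -- Arithmetic in ℤ₍ₚ₎

  ι-inverse : ∀ n → 0 < n → ∃ λ d → d * ι n ≡ 1ℚ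
  ι-inverse (suc n) _ = inv n , trans (*-comm _ _) (ι-inv n)

  module Local (p : ℕ) (p-prime : Prime p) where

    π : ℚ
    π = ι p

    -- Any denominator prime to p is accepted, reduced or not; products of denominators stay
    -- admissible by Euclid's lemma.
    record Int (x : ℚ) : Set where
      constructor mkInt
      field
        den   : ℕ
        num   : ℤ
        p∤den : ¬ (p ∣ den)
        x*den : x * ι den ≡ fromℤ num

    -- x ∈ pʲ ℤ₍ₚ₎
    record Ord (j : ℕ) (x : ℚ) : Set where
      constructor mkOrd
      field
        quot     : ℚ
        int-quot : Int quot
        x≡       : x ≡ pow π j * quot

    p∤* : ∀ {v w} → ¬ (p ∣ v) → ¬ (p ∣ w) → ¬ (p ∣ v ℕ.* w)
    p∤* {v} {w} p∤v p∤w p∣vw = [ p∤v , p∤w ]′ (euclidsLemma v w p-prime p∣vw)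

    p∤< : ∀ {n} → suc n < p → ¬ (p ∣ suc n)
    p∤< n<p p∣n = ℕₚ.<⇒≱ n<p (∣⇒≤ p∣n)

    1<p : 1 < p
    1<p = ℕ.nonTrivial⇒n>1 p {{prime⇒nonTrivial p-prime}}

    int-fromℤ : ∀ z → Int (fromℤ z)
    int-fromℤ z = mkInt 1 z (p∤< 1<p) (*-identityʳ _)

    int-ι : ∀ n → Int (ι n)
    int-ι n = int-fromℤ (+ n)

    int-+ : ∀ {x y} → Int x → Int y → Int (x + y)
    int-+ {x} {y} (mkInt v z p∤v xv≡z) (mkInt w u p∤w yw≡u) = mkInt (v ℕ.* w) (z ℤ.* + w ℤ.+ u ℤ.* + v) (p∤* p∤v p∤w) (begin
      (x + y) * ι (v ℕ.* w)              ≡⟨ cong ((x + y) *_) (ι-* v w) ⟩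
      (x + y) * (ι v * ι w)              ≡⟨ solve 4 (λ x y v w → (x :+ y) :* (v :* w) := x :* v :* w :+ y :* w :* v) refl x y (ι v) (ι w) ⟩
      x * ι v * ι w + y * ι w * ι v      ≡⟨ cong₂ (λ s t → s * ι w + t * ι v) xv≡z yw≡u ⟩
      fromℤ z * ι w + fromℤ u * ι v      ≡⟨ cong₂ _+_ (fromℤ-* z (+ w)) (fromℤ-* u (+ v)) ⟨
      fromℤ (z ℤ.* + w) + fromℤ (u ℤ.* + v) ≡⟨ fromℤ-+ (z ℤ.* + w) (u ℤ.* + v) ⟨
      fromℤ (z ℤ.* + w ℤ.+ u ℤ.* + v)    ∎)

    int-* : ∀ {x y} → Int x → Int y → Int (x * y)
    int-* {x} {y} (mkInt v z p∤v xv≡z) (mkInt w u p∤w yw≡u) = mkInt (v ℕ.* w) (z ℤ.* u) (p∤* p∤v p∤w) (begin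
      x * y * ι (v ℕ.* w)       ≡⟨ cong (x * y *_) (ι-* v w) ⟩
      x * y * (ι v * ι w)       ≡⟨ solve 4 (λ x y v w → x :* y :* (v :* w) := x :* v :* (y :* w)) refl x y (ι v) (ι w) ⟩
      x * ι v * (y * ι w)       ≡⟨ cong₂ _*_ xv≡z yw≡u ⟩
      fromℤ z * fromℤ u         ≡⟨ fromℤ-* z u ⟨
      fromℤ (z ℤ.* u)           ∎)

    int-resp : ∀ {x y} → x ≡ y → Int x → Int y
    int-resp = subst Int

    int-1 : Int 1ℚ
    int-1 = int-ι 1

    int-0 : Int 0ℚ
    int-0 = int-ι 0

    int-neg : ∀ {x} → Int x → Int (- x)
    int-neg {x} ix = int-resp (trans (cong (_* x) (fromℤ-neg (+ 1))) (solve 1 (λ x → :- # 1 :* x := :- x) refl x)) (int-* (int-fromℤ -[1+ 0 ]) ix)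

    int-- : ∀ {x y} → Int x → Int y → Int (x - y)
    int-- ix iy = int-+ ix (int-neg iy)

    int-sq : ∀ {x} → Int x → Int (sq x)
    int-sq ix = int-* ix ix

    int-pow : ∀ {x} → Int x → ∀ n → Int (pow x n)
    int-pow ix zero    = int-1
    int-pow ix (suc n) = int-* ix (int-pow ix n)

    int-inv : ∀ {n} → suc n < p → Int (inv n)
    int-inv {n} n<p = mkInt (suc n) (+ 1) (p∤< n<p) (trans (*-comm _ _) (ι-inv n))

    int-∑ : ∀ n {f : ℕ → ℚ} → (∀ k → k < n → Int (f k)) → Int (∑ n f)
    int-∑ zero    if = int-0
    int-∑ (suc n) if = int-+ (int-∑ n λ k k<n → if k (ℕₚ.m<n⇒m<1+n k<n)) (if n ℕₚ.≤-refl)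

    int-rf : ∀ {n} → n < p → Int (rf n)
    int-rf {zero}  _   = int-1
    int-rf {suc n} n<p = int-* (int-inv n<p) (int-rf (ℕₚ.<-trans (ℕₚ.n<1+n n) n<p))

    int-r : ∀ {n} k → n < p → Int (rf∸ n k)
    int-r zero n<p = int-rf n<p
    int-r {zero}  (suc k) n<p = int-0
    int-r {suc n} (suc k) n<p = int-r k (ℕₚ.<-trans (ℕₚ.n<1+n n) n<p)

    int-fact : ∀ n → Int (fact n)
    int-fact zero    = int-1
    int-fact (suc n) = int-* (int-ι (suc n)) (int-fact n)

    int-π : Int π
    int-π = int-ι p

    int-ord : ∀ {j x} → Ord j x → Int x
    int-ord {j} (mkOrd c ic x≡) = int-resp (sym x≡) (int-* (int-pow int-π j) ic)

    ord-resp : ∀ {j x y} → x ≡ y → Ord j x → Ord j y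
    ord-resp {j} = subst (Ord j)

    ord-zero : ∀ {j} → Ord j 0ℚ
    ord-zero {j} = mkOrd 0ℚ int-0 (sym (zeroʳ _))

    ord-+ : ∀ {j x y} → Ord j x → Ord j y → Ord j (x + y)
    ord-+ (mkOrd c ic x≡) (mkOrd d id y≡) = mkOrd (c + d) (int-+ ic id) (trans (cong₂ _+_ x≡ y≡) (sym (distribˡ _ c d)))

    ord-*ˡ : ∀ {j y x} → Int y → Ord j x → Ord j (y * x)
    ord-*ˡ {j} {y} iy (mkOrd c ic x≡) = mkOrd (y * c) (int-* iy ic)
      (trans (cong (y *_) x≡) (solve 3 (λ y p c → y :* (p :* c) := p :* (y :* c)) refl y (pow π j) c))

    ord-neg : ∀ {j x} → Ord j x → Ord j (- x)
    ord-neg {j} {x} ox = ord-resp (solve 1 (λ x → :- # 1 :* x := :- x) refl x) (ord-*ˡ (int-neg int-1) ox)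

    ord-- : ∀ {j x y} → Ord j x → Ord j y → Ord j (x - y)
    ord-- ox oy = ord-+ ox (ord-neg oy)

    ord-pred : ∀ {j x} → Ord (suc j) x → Ord j x
    ord-pred {j} (mkOrd c ic x≡) = mkOrd (π * c) (int-* int-π ic)
      (trans x≡ (solve 3 (λ p q c → p :* q :* c := q :* (p :* c)) refl π (pow π j) c))

    ord-π : ∀ {j x} → Ord j x → Ord (suc j) (π * x)
    ord-π (mkOrd c ic x≡) = mkOrd c ic (trans (cong (π *_) x≡) (sym (*-assoc _ _ c)))

    int⇒ord : ∀ {x} → Int x → Ord 0 x
    int⇒ord {x} ix = mkOrd x ix (sym (*-identityˡ x))

    ord-∑ : ∀ {j} n {f : ℕ → ℚ} → (∀ k → k < n → Ord j (f k)) → Ord j (∑ n f)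
    ord-∑ zero    of = ord-zero
    ord-∑ (suc n) of = ord-+ (ord-∑ n λ k k<n → of k (ℕₚ.m<n⇒m<1+n k<n)) (of n ℕₚ.≤-refl)

    ord-cancel : ∀ {j n x} → suc n < p → Ord j (ι (suc n) * x) → Ord j x
    ord-cancel {j} {n} {x} n<p o = ord-resp
      (trans (solve 3 (λ a i x → i :* (a :* x) := a :* i :* x) refl (ι (suc n)) (inv n) x) (trans (cong (_* x) (ι-inv n)) (*-identityˡ x)))
      (ord-*ˡ (int-inv n<p) o)

    π-inverse : ∃ λ d → d * π ≡ 1ℚ
    π-inverse = ι-inverse p (ℕₚ.<-trans ℕₚ.≤-refl 1<p)

    ord-cancel-π : ∀ {j x} → Ord (suc j) (π * x) → Ord j x
    ord-cancel-π (mkOrd c ic x≡) = mkOrd c ic (*-cancelˡ-inverse (proj₂ π-inverse) (trans x≡ (*-assoc _ _ c)))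

  -- Exponential generating functions

  Seq : Set
  Seq = ℕ → ℚ

  D : Seq → Seq
  D f n = f (suc n)

  infixl 7 _⋆_
  infixl 6 _⊕_
  infix  4 _≗′_

  _⊕_ : Seq → Seq → Seq
  (f ⊕ g) n = f n + g n

  _≗′_ : Seq → Seq → Set
  f ≗′ g = ∀ n → f n ≡ g n

  -- The product of exponential generating functions, Σ_k C(n,k) f k g (n - k)
  -- (see ⋆-binomial), defined through the Leibniz rule.
  _⋆_ : Seq → Seq → Seq
  (f ⋆ g) zero    = f 0 * g 0
  (f ⋆ g) (suc n) = (D f ⋆ g) n + (f ⋆ D g) n

  ⋆-cong : ∀ {f f′ g g′} → f ≗′ f′ → g ≗′ g′ → f ⋆ g ≗′ f′ ⋆ g′
  ⋆-cong f≗ g≗ zero    = cong₂ _*_ (f≗ 0) (g≗ 0)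
  ⋆-cong f≗ g≗ (suc n) = cong₂ _+_ (⋆-cong (λ k → f≗ (suc k)) g≗ n) (⋆-cong f≗ (λ k → g≗ (suc k)) n)

  ⋆-comm : ∀ f g → f ⋆ g ≗′ g ⋆ f
  ⋆-comm f g zero    = *-comm (f 0) (g 0)
  ⋆-comm f g (suc n) = trans (+-comm _ _) (cong₂ _+_ (⋆-comm f (D g) n) (⋆-comm (D f) g n))

  ⋆-distribʳ : ∀ f g h → (f ⊕ g) ⋆ h ≗′ f ⋆ h ⊕ g ⋆ h
  ⋆-distribʳ f g h zero    = distribʳ (h 0) (f 0) (g 0)
  ⋆-distribʳ f g h (suc n) = trans (cong₂ _+_ (⋆-distribʳ (D f) (D g) h n) (⋆-distribʳ f g (D h) n))
    (solve 4 (λ a b c d → (a :+ b) :+ (c :+ d) := (a :+ c) :+ (b :+ d)) refl ((D f ⋆ h) n) ((D g ⋆ h) n) ((f ⋆ D h) n) ((g ⋆ D h) n))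

  ⋆-distribˡ : ∀ f g h → f ⋆ (g ⊕ h) ≗′ f ⋆ g ⊕ f ⋆ h
  ⋆-distribˡ f g h n = trans (⋆-comm f (g ⊕ h) n) (trans (⋆-distribʳ g h f n) (cong₂ _+_ (⋆-comm g f n) (⋆-comm h f n)))

  ⋆-assoc : ∀ f g h → (f ⋆ g) ⋆ h ≗′ f ⋆ (g ⋆ h)
  ⋆-assoc f g h zero    = *-assoc (f 0) (g 0) (h 0)
  ⋆-assoc f g h (suc n) = begin
    (D (f ⋆ g) ⋆ h) n + ((f ⋆ g) ⋆ D h) n
      ≡⟨ cong (_+ ((f ⋆ g) ⋆ D h) n) (⋆-distribʳ (D f ⋆ g) (f ⋆ D g) h n) ⟩
    ((D f ⋆ g) ⋆ h) n + ((f ⋆ D g) ⋆ h) n + ((f ⋆ g) ⋆ D h) n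
      ≡⟨ cong₂ _+_ (cong₂ _+_ (⋆-assoc (D f) g h n) (⋆-assoc f (D g) h n)) (⋆-assoc f g (D h) n) ⟩
    (D f ⋆ (g ⋆ h)) n + (f ⋆ (D g ⋆ h)) n + (f ⋆ (g ⋆ D h)) n
      ≡⟨ trans (+-assoc _ _ _) (cong (λ z → (D f ⋆ (g ⋆ h)) n + z) (sym (⋆-distribˡ f (D g ⋆ h) (g ⋆ D h) n))) ⟩
    (D f ⋆ (g ⋆ h)) n + (f ⋆ D (g ⋆ h)) n ∎

  ⋆-scaleˡ : ∀ c f g → (λ n → c * f n) ⋆ g ≗′ (λ n → c * (f ⋆ g) n)
  ⋆-scaleˡ c f g zero    = *-assoc c (f 0) (g 0)
  ⋆-scaleˡ c f g (suc n) = trans (cong₂ _+_ (⋆-scaleˡ c (D f) g n) (⋆-scaleˡ c f (D g) n)) (sym (distribˡ c _ _))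

  ⋆-scaleʳ : ∀ c f g → f ⋆ (λ n → c * g n) ≗′ (λ n → c * (f ⋆ g) n)
  ⋆-scaleʳ c f g n = trans (⋆-comm f _ n) (trans (⋆-scaleˡ c g f n) (cong (c *_) (⋆-comm g f n)))

  -- `pow x` has the generating function exp(xt), so this is the binomial theorem.
  pow-⋆ : ∀ x y → pow x ⋆ pow y ≗′ pow (x + y)
  pow-⋆ x y zero    = *-identityˡ 1ℚ
  pow-⋆ x y (suc n) = trans (cong₂ _+_ (⋆-scaleˡ x (pow x) (pow y) n) (⋆-scaleʳ y (pow x) (pow y) n))
    (trans (sym (distribʳ _ x y)) (cong ((x + y) *_) (pow-⋆ x y n)))

  -- The sequences with generating functions 1 and t.
  δ₀ δ₁ : Seq
  δ₀ zero    = 1ℚ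
  δ₀ (suc n) = 0ℚ
  δ₁ zero    = 0ℚ
  δ₁ (suc n) = δ₀ n

  0⋆ : ∀ g → (λ _ → 0ℚ) ⋆ g ≗′ (λ _ → 0ℚ)
  0⋆ g zero    = zeroˡ (g 0)
  0⋆ g (suc n) = trans (cong₂ _+_ (0⋆ g n) (0⋆ (D g) n)) (+-identityˡ 0ℚ)

  δ₀-⋆ : ∀ g → δ₀ ⋆ g ≗′ g
  δ₀-⋆ g zero    = *-identityˡ (g 0)
  δ₀-⋆ g (suc n) = trans (cong₂ _+_ (0⋆ g n) (δ₀-⋆ (D g) n)) (+-identityˡ _)

  δ₁-⋆ : ∀ g n → (δ₁ ⋆ g) (suc n) ≡ ι (suc n) * g n
  δ₁-⋆ g zero    = trans (cong₂ _+_ (*-identityˡ (g 0)) (zeroˡ (g 1))) (trans (+-identityʳ _) (sym (*-identityˡ (g 0))))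
  δ₁-⋆ g (suc n) = trans (cong₂ _+_ (δ₀-⋆ g (suc n)) (δ₁-⋆ (D g) n))
    (trans (solve 2 (λ a b → a :+ b :* a := (b :+ # 1) :* a) refl (g (suc n)) (ι (suc n))) (cong (_* g (suc n)) (sym (ι-suc (suc n)))))

  pow-0 : pow 0ℚ ≗′ δ₀
  pow-0 zero    = refl
  pow-0 (suc n) = zeroˡ _

  ⋆-pow-0 : ∀ f → f ⋆ pow 0ℚ ≗′ f
  ⋆-pow-0 f n = trans (⋆-cong {f} (λ _ → refl) pow-0 n) (trans (⋆-comm f δ₀ n) (δ₀-⋆ f n))

  ι-C : ∀ n k → ι (n C k) ≡ fact n * (rf k * rf∸ n k)
  ι-C zero    zero    = solve 0 (# 1 := # 1 :* (# 1 :* # 1)) refl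
  ι-C (suc n) zero    = sym (trans (solve 2 (λ x y → x :* (# 1 :* y) := x :* y) refl (fact (suc n)) (rf (suc n))) (fact*rf (suc n)))
  ι-C zero    (suc k) = solve 2 (λ x y → # 0 := x :* (y :* # 0)) refl 1ℚ (rf (suc k))
  ι-C (suc n) (suc k) = begin
    ι (suc n C suc k)
      ≡⟨ cong ι (nCk+nC[k+1]≡[n+1]C[k+1] n k) ⟨
    ι ((n C k) ℕ.+ (n C suc k))
      ≡⟨ trans (ι-+ (n C k) (n C suc k)) (cong₂ _+_ (ι-C n k) (ι-C n (suc k))) ⟩
    fact n * (rf k * rf∸ n k) + fact n * (rf (suc k) * rf∸ n (suc k))
      ≡⟨ cong₂ (λ z w → fact n * (z * rf∸ n k) + fact n * (rf (suc k) * w)) (trans (rf-unsuc k) (cong (_* rf (suc k)) (ι-suc k))) (rf∸-suc n k) ⟩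
    fact n * ((ι k + 1ℚ) * rf (suc k) * rf∸ n k) + fact n * (rf (suc k) * ((ι n - ι k) * rf∸ n k))
      ≡⟨ solve 5 (λ x y F K R → F :* ((y :+ # 1) :* K :* R) :+ F :* (K :* ((x :- y) :* R)) := (x :+ # 1) :* F :* (K :* R)) refl (ι n) (ι k) (fact n) (rf (suc k)) (rf∸ n k) ⟩
    (ι n + 1ℚ) * fact n * (rf (suc k) * rf∸ n k)
      ≡⟨ cong (λ z → z * fact n * (rf (suc k) * rf∸ n k)) (ι-suc n) ⟨
    fact (suc n) * (rf (suc k) * rf∸ n k) ∎

  ι-C-0 : ∀ n → ι (n C 0) ≡ 1ℚ
  ι-C-0 n = trans (ι-C n 0) (trans (cong (fact n *_) (*-identityˡ (rf n))) (fact*rf n))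

  rf∸-diag : ∀ n → rf∸ n n ≡ 1ℚ
  rf∸-diag zero    = refl
  rf∸-diag (suc n) = rf∸-diag n

  ι-C-n : ∀ n → ι (n C n) ≡ 1ℚ
  ι-C-n n = trans (ι-C n n) (trans (cong (λ z → fact n * (rf n * z)) (rf∸-diag n)) (trans (cong (fact n *_) (*-identityʳ (rf n))) (fact*rf n)))

  ι-C-zero : ∀ {n k} → n < k → ι (n C k) ≡ 0ℚ
  ι-C-zero {n} {k} n<k = trans (ι-C n k) (trans (cong (λ z → fact n * (rf k * z)) (rf∸-zero n<k)) (solve 2 (λ x y → x :* (y :* # 0) := # 0) refl (fact n) (rf k)))

  -- The two summands of the Leibniz rule carry C(n,k) and C(n,k+1), which Pascal's rule combines.
  ⋆-binomial : ∀ f g n → (f ⋆ g) n ≡ ∑ (suc n) (λ k → ι (n C k) * (f k * g (n ∸ k)))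
  ⋆-binomial f g zero    = solve 2 (λ x y → x :* y := # 0 :+ # 1 :* (x :* y)) refl (f 0) (g 0)
  ⋆-binomial f g (suc n) = begin
    (D f ⋆ g) n + (f ⋆ D g) n
      ≡⟨ cong₂ _+_ (⋆-binomial (D f) g n) (⋆-binomial f (D g) n) ⟩
    ∑ (suc n) s + ∑ (suc n) (λ k → ι (n C k) * (f k * g (suc (n ∸ k))))
      ≡⟨ cong (λ z → ∑ (suc n) s + z) (∑-cong (suc n) (λ { k (s≤s k≤n) → cong (λ i → ι (n C k) * (f k * g i)) (sym (ℕₚ.+-∸-assoc 1 k≤n)) })) ⟩
    ∑ (suc n) s + ∑ (suc n) t
      ≡⟨ cong (λ z → ∑ (suc n) s + z) (∑-truncate (suc n) (suc (suc n)) (λ k n<k → trans (cong (_* (f k * g (suc n ∸ k))) (ι-C-zero n<k)) (zeroˡ _)) (ℕₚ.n≤1+n _)) ⟨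
    ∑ (suc n) s + ∑ (suc (suc n)) t
      ≡⟨ cong (λ z → ∑ (suc n) s + z) (∑-head (suc n) t) ⟩
    ∑ (suc n) s + (t 0 + ∑ (suc n) (λ k → t (suc k)))
      ≡⟨ solve 3 (λ a b c → a :+ (b :+ c) := b :+ (a :+ c)) refl (∑ (suc n) s) (t 0) _ ⟩
    t 0 + (∑ (suc n) s + ∑ (suc n) (λ k → t (suc k)))
      ≡⟨ cong₂ _+_ (cong (_* (f 0 * g (suc n))) (trans (ι-C-0 n) (sym (ι-C-0 (suc n))))) (sym (∑-+ (suc n) s (λ k → t (suc k)))) ⟩
    u 0 + ∑ (suc n) (λ k → s k + t (suc k))
      ≡⟨ cong (λ z → u 0 + z) (∑-cong′ (suc n) (λ k → trans (sym (distribʳ (f (suc k) * g (n ∸ k)) _ _)) (cong (_* (f (suc k) * g (n ∸ k))) (trans (sym (ι-+ (n C k) (n C suc k))) (cong ι (nCk+nC[k+1]≡[n+1]C[k+1] n k)))))) ⟩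
    u 0 + ∑ (suc n) (λ k → u (suc k))
      ≡⟨ ∑-head (suc n) u ⟨
    ∑ (suc (suc n)) u ∎
    where
    s t u : ℕ → ℚ
    s k = ι (n C k) * (f (suc k) * g (n ∸ k))
    t k = ι (n C k) * (f k * g (suc n ∸ k))
    u k = ι (suc n C k) * (f k * g (suc n ∸ k))

  module _ (p : ℕ) (p-prime : Prime p) where
    open Local p p-prime

    ⋆-int : ∀ {f g : Seq} → (∀ n → Int (f n)) → (∀ n → Int (g n)) → ∀ n → Int ((f ⋆ g) n)
    ⋆-int if ig zero    = int-* (if 0) (ig 0)
    ⋆-int if ig (suc n) = int-+ (⋆-int (λ k → if (suc k)) ig n) (⋆-int if (λ k → ig (suc k)) n)

    -- exp(pt) has coefficients pᵏ and is 1 modulo p.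
    ⋆-pow-π₁ : ∀ f n → (∀ k → k ℕ.≤ n → Int (f k)) → Ord 1 ((f ⋆ pow π) n - f n)
    ⋆-pow-π₁ f zero    if = ord-resp (solve 1 (λ x → # 0 := x :* # 1 :- x) refl (f 0)) ord-zero
    ⋆-pow-π₁ f (suc n) if = ord-resp eq (ord-+ (⋆-pow-π₁ (D f) n (λ k k≤n → if (suc k) (s≤s k≤n))) (ord-π (int⇒ord int)))
      where
      rest = ⋆-pow-π₁ f n (λ k k≤n → if k (ℕₚ.m≤n⇒m≤1+n k≤n))
      int : Int ((f ⋆ pow π) n)
      int = int-resp (solve 2 (λ x y → x :- y :+ y := x) refl _ (f n)) (int-+ (int-ord rest) (if n (ℕₚ.n≤1+n n)))
      eq : (D f ⋆ pow π) n - f (suc n) + π * (f ⋆ pow π) n ≡ (f ⋆ pow π) (suc n) - f (suc n)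
      eq = trans (cong (λ z → (D f ⋆ pow π) n - f (suc n) + z) (sym (⋆-scaleʳ π f (pow π) n)))
        (solve 3 (λ x y z → x :- y :+ z := x :+ z :- y) refl ((D f ⋆ pow π) n) (f (suc n)) ((f ⋆ (λ k → π * pow π k)) n))

    -- Modulo p² the coefficients of exp(pt) are those of 1 + pt. Integrality is demanded only up to
    -- n because `bernoulli` is one of the sequences used, and B_{p-1} is not p-integral.
    ⋆-pow-π₂ : ∀ f n → (∀ k → k ℕ.≤ n → Int (f k)) → Ord 2 ((f ⋆ pow π) (suc n) - (f (suc n) + ι (suc n) * (π * f n)))
    ⋆-pow-π₂ f zero if = ord-resp (solve 3 (λ x y p → # 0 := y :* # 1 :+ x :* (p :* # 1) :- (y :+ # 1 :* (p :* x))) refl (f 0) (f 1) π) ord-zero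
    ⋆-pow-π₂ f (suc n) if = ord-resp eq (ord-+ (⋆-pow-π₂ (D f) n (λ k k≤n → if (suc k) (s≤s k≤n))) (ord-π (⋆-pow-π₁ f (suc n) if)))
      where
      eq : (D f ⋆ pow π) (suc n) - (f (suc (suc n)) + ι (suc n) * (π * f (suc n))) + π * ((f ⋆ pow π) (suc n) - f (suc n))
         ≡ (D f ⋆ pow π) (suc n) + (f ⋆ D (pow π)) (suc n) - (f (suc (suc n)) + ι (suc (suc n)) * (π * f (suc n)))
      eq = begin
        (D f ⋆ pow π) (suc n) - (f (suc (suc n)) + ι (suc n) * (π * f (suc n))) + π * ((f ⋆ pow π) (suc n) - f (suc n))
          ≡⟨ solve 6 (λ x y i p f₁ z → x :- (y :+ i :* (p :* f₁)) :+ p :* (z :- f₁) := x :+ p :* z :- (y :+ (i :+ # 1) :* (p :* f₁))) refl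
               ((D f ⋆ pow π) (suc n)) (f (suc (suc n))) (ι (suc n)) π (f (suc n)) ((f ⋆ pow π) (suc n)) ⟩
        (D f ⋆ pow π) (suc n) + π * (f ⋆ pow π) (suc n) - (f (suc (suc n)) + (ι (suc n) + 1ℚ) * (π * f (suc n)))
          ≡⟨ cong₂ (λ z w → (D f ⋆ pow π) (suc n) + z - (f (suc (suc n)) + w * (π * f (suc n)))) (sym (⋆-scaleʳ π f (pow π) (suc n))) (sym (ι-suc (suc n))) ⟩
        _ ∎

    -- p divides C(p,k) for 0 < k < p, by the factorial formula.
    fermat : ∀ n → Ord 1 (pow (ι n) p - ι n)
    fermat zero = ord-resp (trans (solve 0 (# 0 := # 0 :- # 0) refl) (cong (_- 0ℚ) (sym (pow-0> p (ℕₚ.<-trans ℕₚ.≤-refl 1<p))))) ord-zero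
      where
      pow-0> : ∀ n → 0 < n → pow 0ℚ n ≡ 0ℚ
      pow-0> (suc n) _ = zeroˡ _
    fermat (suc n) = ord-resp (trans (solve 3 (λ s t x → s :+ (t :- x) := s :+ t :+ # 1 :- (x :+ # 1)) refl mid (pow (ι n) p) (ι n)) (cong₂ _-_ (sym pow-suc) (sym (ι-suc n))))
      (ord-+ ord-mid (fermat n))
      where
      term : ℕ → ℚ
      term k = ι (p C k) * (pow (ι n) k * pow 1ℚ (p ∸ k))
      mid : ℚ
      mid = ∑ (p ∸ 1) (λ k → term (suc k))

      suc-pred : suc (p ∸ 1) ≡ p
      suc-pred = ℕₚ.m+[n∸m]≡n (ℕₚ.<⇒≤ 1<p)

      ord-C : ∀ k → k < p ∸ 1 → Ord 1 (ι (p C suc k))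
      ord-C k k<p-1 = ord-resp (trans (trans (sym (*-assoc π _ _)) (cong (λ i → ι i * fact (p ∸ 1) * (rf (suc k) * rf∸ (p ∸ 1) k)) (sym suc-pred))) (trans (sym (ι-C (suc (p ∸ 1)) (suc k))) (cong (λ i → ι (i C suc k)) suc-pred)))
        (ord-π (int⇒ord (int-* (int-fact (p ∸ 1)) (int-* (int-rf (subst (suc k <_) suc-pred (s≤s k<p-1))) (int-r k (subst (p ∸ 1 <_) suc-pred ℕₚ.≤-refl))))))

      ord-mid : Ord 1 mid
      ord-mid = ord-∑ (p ∸ 1) λ k k<p-1 → ord-resp (*-comm _ _) (ord-*ˡ (int-* (int-pow (int-ι n) (suc k)) (int-pow int-1 (p ∸ suc k))) (ord-C k k<p-1))

      pow-suc : pow (ι (suc n)) p ≡ mid + pow (ι n) p + 1ℚ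
      pow-suc = begin
        pow (ι (suc n)) p               ≡⟨ cong (λ z → pow z p) (ι-suc n) ⟩
        pow (ι n + 1ℚ) p                ≡⟨ pow-⋆ (ι n) 1ℚ p ⟨
        (pow (ι n) ⋆ pow 1ℚ) p          ≡⟨ ⋆-binomial (pow (ι n)) (pow 1ℚ) p ⟩
        ∑ p term + term p               ≡⟨ cong (λ i → ∑ i term + term p) suc-pred ⟨
        ∑ (suc (p ∸ 1)) term + term p   ≡⟨ cong (_+ term p) (∑-head (p ∸ 1) term) ⟩
        term 0 + mid + term p           ≡⟨ cong₂ (λ z w → z + mid + w)
                                             (cong₂ (λ z w → z * (1ℚ * w)) (ι-C-0 p) (pow-1 p))
                                             (cong₂ (λ z w → z * (pow (ι n) p * w)) (ι-C-n p) (pow-1 (p ∸ p))) ⟩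
        1ℚ * (1ℚ * 1ℚ) + mid + 1ℚ * (pow (ι n) p * 1ℚ)
          ≡⟨ solve 2 (λ m x → # 1 :* (# 1 :* # 1) :+ m :+ # 1 :* (x :* # 1) := m :+ x :+ # 1) refl mid (pow (ι n) p) ⟩
        mid + pow (ι n) p + 1ℚ ∎

  -- Bernoulli and Euler numbers

  open Defs using (sumℚ; lastℚ; bernoulli; bernoulliUpTo; euler; eulerUpTo)

  last-∷ʳ : ∀ xs x → lastℚ (xs ++ [ x ]) ≡ x
  last-∷ʳ xs x = Listₚ.foldl-∷ʳ (λ _ y → y) (+ 0 ℚ./ 1) x xs

  zipWith-mapʳ : ∀ {A B C : Set} (f : A → B → C) (g : A → B) xs → zipWith f xs (map g xs) ≡ map (λ x → f x (g x)) xs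
  zipWith-mapʳ f g []       = refl
  zipWith-mapʳ f g (x ∷ xs) = cong (f x (g x) ∷_) (zipWith-mapʳ f g xs)

  -- Each list extends the previous one, so its entries are the last entries of the shorter lists.
  -- This turns the recursion on lists into a recurrence for the numbers.
  bernoulliUpTo≡map : ∀ n → bernoulliUpTo n ≡ map bernoulli (upTo (suc n))
  bernoulliUpTo≡map zero    = refl
  bernoulliUpTo≡map (suc n) = trans (cong₂ (λ l x → l ++ [ x ]) (bernoulliUpTo≡map n) (sym (last-∷ʳ (bernoulliUpTo n) _)))
    (trans (sym (Listₚ.map-++ bernoulli (upTo (suc n)) [ suc n ])) (cong (map bernoulli) (Listₚ.upTo-∷ʳ (suc n))))

  eulerUpTo≡map : ∀ n → eulerUpTo n ≡ map euler (upTo (suc n))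
  eulerUpTo≡map zero    = refl
  eulerUpTo≡map (suc n) = trans (cong₂ (λ l x → l ++ [ x ]) (eulerUpTo≡map n) (sym (last-∷ʳ (eulerUpTo n) _)))
    (trans (sym (Listₚ.map-++ euler (upTo (suc n)) [ suc n ])) (cong (map euler) (Listₚ.upTo-∷ʳ (suc n))))

  opaque
    unfolding _+_

    sum-applyUpTo : ∀ (f : ℕ → ℚ) n → sumℚ (applyUpTo f n) ≡ ∑ n f
    sum-applyUpTo f zero    = refl
    sum-applyUpTo f (suc n) = trans (cong (λ z → f 0 + z) (sum-applyUpTo (λ k → f (suc k)) n)) (sym (∑-head n f))

    sum-map-upTo : ∀ (f : ℕ → ℚ) n → sumℚ (map f (upTo n)) ≡ ∑ n f
    sum-map-upTo f n = trans (cong sumℚ (Listₚ.map-upTo f n)) (sum-applyUpTo f n)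

    bernoulli-0 : bernoulli 0 ≡ 1ℚ
    bernoulli-0 = refl

    bernoulli-suc : ∀ n → bernoulli (suc n) ≡ - (inv (suc n) * ∑ (suc n) (λ k → ι (suc (suc n) C k) * bernoulli k))
    bernoulli-suc n = trans (last-∷ʳ (bernoulliUpTo n) _) (cong (λ z → - (inv (suc n) * z))
      (trans (cong sumℚ (trans (cong (zipWith (λ k x → ι (suc (suc n) C k) * x) (upTo (suc n))) (bernoulliUpTo≡map n)) (zipWith-mapʳ _ bernoulli (upTo (suc n)))))
        (sum-map-upTo _ (suc n))))

    euler-0 : euler 0 ≡ 1ℚ
    euler-0 = refl

    euler-suc : ∀ n → euler (suc n) ≡ - ∑ (suc n) (λ k → if ((suc n ℕ.+ k) % 2 ≡ᵇ 0) then ι (suc n C k) * euler k else 0ℚ)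
    euler-suc n = trans (last-∷ʳ (eulerUpTo n) _) (cong (λ z → - z)
      (trans (cong sumℚ (trans (cong (zipWith (λ k x → if ((suc n ℕ.+ k) % 2 ≡ᵇ 0) then ι (suc n C k) * x else 0ℚ) (upTo (suc n))) (eulerUpTo≡map n)) (zipWith-mapʳ _ euler (upTo (suc n)))))
        (sum-map-upTo _ (suc n))))

  ∑-bernoulli : ∀ n → ∑ (suc (suc n)) (λ k → ι (suc (suc n) C k) * bernoulli k) ≡ 0ℚ
  ∑-bernoulli n = begin
    s + ι (suc (suc n) C suc n) * bernoulli (suc n)
      ≡⟨ cong₂ (λ z w → s + ι z * w) C≡ (bernoulli-suc n) ⟩
    s + ι (suc (suc n)) * - (inv (suc n) * s)
      ≡⟨ solve 3 (λ s x i → s :+ x :* :- (i :* s) := s :- x :* i :* s) refl s (ι (suc (suc n))) (inv (suc n)) ⟩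
    s - ι (suc (suc n)) * inv (suc n) * s
      ≡⟨ cong (λ z → s - z * s) (ι-inv (suc n)) ⟩
    s - 1ℚ * s
      ≡⟨ solve 1 (λ s → s :- # 1 :* s := # 0) refl s ⟩
    0ℚ ∎
    where
    s = ∑ (suc n) (λ k → ι (suc (suc n) C k) * bernoulli k)
    C≡ : suc (suc n) C suc n ≡ suc (suc n)
    C≡ = trans (nCk≡nC[n∸k] (ℕₚ.n≤1+n (suc n))) (trans (cong (suc (suc n) C_) (ℕₚ.m+n∸n≡m 1 (suc n))) (nC1≡n (suc (suc n))))

  -- With B(t) = t/(e^t - 1) this is B(t)e^t = B(t) + t. The recurrence covers the indices from 2
  -- on; index 1 yields the summand t.
  bernoulli-⋆ : bernoulli ⋆ pow 1ℚ ≗′ bernoulli ⊕ δ₁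
  bernoulli-⋆ zero = solve 1 (λ x → x :* # 1 := x :+ # 0) refl (bernoulli 0)
  bernoulli-⋆ (suc zero) = trans (solve 2 (λ x y → y :* # 1 :+ x :* (# 1 :* # 1) := y :+ x) refl (bernoulli 0) (bernoulli 1)) (cong (λ z → bernoulli 1 + z) bernoulli-0)
  bernoulli-⋆ (suc (suc n)) = begin
    (bernoulli ⋆ pow 1ℚ) N
      ≡⟨ ⋆-binomial bernoulli (pow 1ℚ) N ⟩
    ∑ (suc N) (λ k → ι (N C k) * (bernoulli k * pow 1ℚ (N ∸ k)))
      ≡⟨ ∑-cong′ (suc N) (λ k → cong (ι (N C k) *_) (trans (cong (bernoulli k *_) (pow-1 (N ∸ k))) (*-identityʳ _))) ⟩
    ∑ N (λ k → ι (N C k) * bernoulli k) + ι (N C N) * bernoulli N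
      ≡⟨ cong₂ (λ z w → z + w * bernoulli N) (∑-bernoulli n) (ι-C-n N) ⟩
    0ℚ + 1ℚ * bernoulli N
      ≡⟨ solve 1 (λ x → # 0 :+ # 1 :* x := x :+ # 0) refl (bernoulli N) ⟩
    bernoulli N + 0ℚ ∎
    where N = suc (suc n)

  -- `(bernoulli ⋆ pow x) n` is the Bernoulli polynomial B_n(x), and this is its difference
  -- equation.
  bernoulli-⋆-shift : ∀ x n → (bernoulli ⋆ pow (x + 1ℚ)) (suc n) ≡ (bernoulli ⋆ pow x) (suc n) + ι (suc n) * pow x n
  bernoulli-⋆-shift x n = begin
    (bernoulli ⋆ pow (x + 1ℚ)) (suc n)
      ≡⟨ ⋆-cong {bernoulli} (λ _ → refl) (λ k → trans (cong (λ z → pow z k) (+-comm x 1ℚ)) (sym (pow-⋆ 1ℚ x k))) (suc n) ⟩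
    (bernoulli ⋆ (pow 1ℚ ⋆ pow x)) (suc n)
      ≡⟨ ⋆-assoc bernoulli (pow 1ℚ) (pow x) (suc n) ⟨
    ((bernoulli ⋆ pow 1ℚ) ⋆ pow x) (suc n)
      ≡⟨ ⋆-cong bernoulli-⋆ (λ _ → refl) (suc n) ⟩
    ((bernoulli ⊕ δ₁) ⋆ pow x) (suc n)
      ≡⟨ trans (⋆-distribʳ bernoulli δ₁ (pow x) (suc n)) (cong (λ z → (bernoulli ⋆ pow x) (suc n) + z) (δ₁-⋆ (pow x) n)) ⟩
    (bernoulli ⋆ pow x) (suc n) + ι (suc n) * pow x n ∎

  faulhaber : ∀ N n → ι (suc n) * ∑ N (λ j → pow (ι j) n) ≡ (bernoulli ⋆ pow (ι N)) (suc n) - bernoulli (suc n)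
  faulhaber zero n = trans (zeroʳ _) (trans (sym (-‿inverseʳ _)) (cong (_- bernoulli (suc n)) (sym (⋆-pow-0 bernoulli (suc n)))))
  faulhaber (suc N) n = begin
    ι (suc n) * (∑ N (λ j → pow (ι j) n) + pow (ι N) n)
      ≡⟨ trans (distribˡ _ _ _) (cong (_+ ι (suc n) * pow (ι N) n) (faulhaber N n)) ⟩
    (bernoulli ⋆ pow (ι N)) (suc n) - bernoulli (suc n) + ι (suc n) * pow (ι N) n
      ≡⟨ solve 3 (λ x y z → x :- y :+ z := x :+ z :- y) refl _ (bernoulli (suc n)) _ ⟩
    (bernoulli ⋆ pow (ι N)) (suc n) + ι (suc n) * pow (ι N) n - bernoulli (suc n)
      ≡⟨ cong (_- bernoulli (suc n)) (trans (sym (bernoulli-⋆-shift (ι N) n)) (cong (λ z → (bernoulli ⋆ pow z) (suc n)) (sym (ι-suc N)))) ⟩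
    (bernoulli ⋆ pow (ι (suc N))) (suc n) - bernoulli (suc n) ∎

  ½ : ℚ
  ½ = inv 1

  -- The coefficients of cosh t; as a factor they replace the parity test in the definition of the
  -- Euler numbers.
  evens : Seq
  evens n = ½ * (pow 1ℚ n + pow -1ℚ n)

  evens-2+ : ∀ n → evens (suc (suc n)) ≡ evens n
  evens-2+ n = solve 3 (λ h x y → h :* (# 1 :* (# 1 :* x) :+ :- # 1 :* (:- # 1 :* y)) := h :* (x :+ y)) refl ½ (pow 1ℚ n) (pow -1ℚ n)

  evens-0 : evens 0 ≡ 1ℚ
  evens-0 = trans (solve 1 (λ h → h :* (# 1 :+ # 1) := # 2 :* h) refl ½) (ι-inv 1)

  if-parity : ∀ d x → (if (d % 2 ≡ᵇ 0) then x else 0ℚ) ≡ evens d * x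
  if-parity zero          x = sym (trans (cong (_* x) evens-0) (*-identityˡ x))
  if-parity (suc zero)    x = solve 2 (λ h x → # 0 := h :* (# 1 :* # 1 :+ :- # 1 :* # 1) :* x) refl ½ x
  if-parity (suc (suc d)) x = trans (if-parity d x) (cong (_* x) (sym (evens-2+ d)))

  parity-∸ : ∀ {n k} → k ℕ.≤ n → (n ℕ.+ k) % 2 ≡ (n ∸ k) % 2
  parity-∸ {n} {k} k≤n = trans (cong (_% 2) eq) (DivMod.[m+kn]%n≡m%n (n ∸ k) k 2)
    where
    eq : n ℕ.+ k ≡ (n ∸ k) ℕ.+ k ℕ.* 2
    eq = trans (cong (ℕ._+ k) (sym (ℕₚ.m∸n+n≡m k≤n))) (trans (ℕₚ.+-assoc (n ∸ k) k k) (cong ((n ∸ k) ℕ.+_) (trans (cong (k ℕ.+_) (sym (ℕₚ.+-identityʳ k))) (ℕₚ.*-comm 2 k))))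

  euler-⋆ : euler ⋆ evens ≗′ δ₀
  euler-⋆ zero    = trans (cong₂ _*_ euler-0 evens-0) (*-identityˡ 1ℚ)
  euler-⋆ (suc n) = begin
    (euler ⋆ evens) N
      ≡⟨ ⋆-binomial euler evens N ⟩
    ∑ N (λ k → ι (N C k) * (euler k * evens (N ∸ k))) + ι (N C N) * (euler N * evens (N ∸ N))
      ≡⟨ cong₂ _+_ (∑-cong N λ k k<N → summand k (ℕₚ.<⇒≤ k<N))
          (trans (cong₂ (λ z w → z * (euler N * w)) (ι-C-n N) (trans (cong evens (ℕₚ.n∸n≡0 N)) evens-0)) (solve 1 (λ x → # 1 :* (x :* # 1) := x) refl (euler N))) ⟩
    s + euler N
      ≡⟨ trans (cong (λ z → s + z) (euler-suc n)) (-‿inverseʳ s) ⟩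
    0ℚ ∎
    where
    N = suc n
    s = ∑ N (λ k → if ((N ℕ.+ k) % 2 ≡ᵇ 0) then ι (N C k) * euler k else 0ℚ)
    summand : ∀ k → k ℕ.≤ N → ι (N C k) * (euler k * evens (N ∸ k)) ≡ (if ((N ℕ.+ k) % 2 ≡ᵇ 0) then ι (N C k) * euler k else 0ℚ)
    summand k k≤N = trans (solve 3 (λ x y z → x :* (y :* z) := z :* (x :* y)) refl (ι (N C k)) (euler k) (evens (N ∸ k)))
      (trans (sym (if-parity (N ∸ k) _)) (cong (λ i → if (i ≡ᵇ 0) then ι (N C k) * euler k else 0ℚ) (sym (parity-∸ k≤N))))

  -- exp((x+1)t) + exp((x-1)t) = 2 cosh t exp(xt), and sech t cancels cosh t. In terms of Euler
  -- polynomials `(euler ⋆ pow x) n` is 2ⁿ E_n((x+1)/2).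
  euler-⋆-shift : ∀ x n → (euler ⋆ pow (x + 1ℚ)) n + (euler ⋆ pow (x - 1ℚ)) n ≡ ι 2 * pow x n
  euler-⋆-shift x n = begin
    (euler ⋆ pow (x + 1ℚ)) n + (euler ⋆ pow (x - 1ℚ)) n
      ≡⟨ ⋆-distribˡ euler (pow (x + 1ℚ)) (pow (x - 1ℚ)) n ⟨
    (euler ⋆ (pow (x + 1ℚ) ⊕ pow (x - 1ℚ))) n
      ≡⟨ ⋆-cong {euler} (λ _ → refl) split n ⟩
    (euler ⋆ (evens ⋆ (λ k → ι 2 * pow x k))) n
      ≡⟨ ⋆-assoc euler evens _ n ⟨
    ((euler ⋆ evens) ⋆ (λ k → ι 2 * pow x k)) n
      ≡⟨ trans (⋆-cong {g = λ k → ι 2 * pow x k} euler-⋆ (λ _ → refl) n) (δ₀-⋆ _ n) ⟩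
    ι 2 * pow x n ∎
    where
    split : pow (x + 1ℚ) ⊕ pow (x - 1ℚ) ≗′ evens ⋆ (λ k → ι 2 * pow x k)
    split k = begin
      pow (x + 1ℚ) k + pow (x - 1ℚ) k
        ≡⟨ cong₂ (λ z w → pow z k + pow w k) (+-comm x 1ℚ) (+-comm x -1ℚ) ⟩
      pow (1ℚ + x) k + pow (-1ℚ + x) k
        ≡⟨ cong₂ _+_ (pow-⋆ 1ℚ x k) (pow-⋆ -1ℚ x k) ⟨
      (pow 1ℚ ⋆ pow x) k + (pow -1ℚ ⋆ pow x) k
        ≡⟨ ⋆-distribʳ (pow 1ℚ) (pow -1ℚ) (pow x) k ⟨
      ((pow 1ℚ ⊕ pow -1ℚ) ⋆ pow x) k
        ≡⟨ solve 2 (λ h y → y := # 1 :* y) refl ½ _ ⟩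
      1ℚ * ((pow 1ℚ ⊕ pow -1ℚ) ⋆ pow x) k
        ≡⟨ trans (cong (_* ((pow 1ℚ ⊕ pow -1ℚ) ⋆ pow x) k) (sym (ι-inv 1))) (*-assoc (ι 2) ½ _) ⟩
      ι 2 * (½ * ((pow 1ℚ ⊕ pow -1ℚ) ⋆ pow x) k)
        ≡⟨ cong (ι 2 *_) (⋆-scaleˡ ½ (pow 1ℚ ⊕ pow -1ℚ) (pow x) k) ⟨
      ι 2 * (evens ⋆ pow x) k
        ≡⟨ ⋆-scaleʳ (ι 2) evens (pow x) k ⟨
      (evens ⋆ (λ k → ι 2 * pow x k)) k ∎

  -- The substitution t ↦ -t.
  alternate : Seq → Seq
  alternate f n = pow -1ℚ n * f n

  alternate-⋆ : ∀ f g → alternate (f ⋆ g) ≗′ alternate f ⋆ alternate g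
  alternate-⋆ f g zero    = solve 2 (λ x y → # 1 :* (x :* y) := # 1 :* x :* (# 1 :* y)) refl (f 0) (g 0)
  alternate-⋆ f g (suc n) = begin
    -1ℚ * pow -1ℚ n * ((D f ⋆ g) n + (f ⋆ D g) n)
      ≡⟨ solve 3 (λ s x y → :- # 1 :* s :* (x :+ y) := :- # 1 :* (s :* x) :+ :- # 1 :* (s :* y)) refl (pow -1ℚ n) _ _ ⟩
    -1ℚ * alternate (D f ⋆ g) n + -1ℚ * alternate (f ⋆ D g) n
      ≡⟨ cong₂ (λ z w → -1ℚ * z + -1ℚ * w) (alternate-⋆ (D f) g n) (alternate-⋆ f (D g) n) ⟩
    -1ℚ * (alternate (D f) ⋆ alternate g) n + -1ℚ * (alternate f ⋆ alternate (D g)) n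
      ≡⟨ cong₂ _+_ (⋆-scaleˡ -1ℚ (alternate (D f)) (alternate g) n) (⋆-scaleʳ -1ℚ (alternate f) (alternate (D g)) n) ⟨
    ((λ k → -1ℚ * alternate (D f) k) ⋆ alternate g) n + (alternate f ⋆ (λ k → -1ℚ * alternate (D g) k)) n
      ≡⟨ cong₂ _+_ (⋆-cong {g = alternate g} (λ k → sym (*-assoc -1ℚ (pow -1ℚ k) _)) (λ _ → refl) n) (⋆-cong {alternate f} (λ _ → refl) (λ k → sym (*-assoc -1ℚ (pow -1ℚ k) _)) n) ⟩
    (D (alternate f) ⋆ alternate g) n + (alternate f ⋆ D (alternate g)) n ∎

  alternate-evens : alternate evens ≗′ evens
  alternate-evens n = begin
    s * (½ * (pow 1ℚ n + s))   ≡⟨ cong (λ z → s * (½ * (z + s))) (pow-1 n) ⟩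
    s * (½ * (1ℚ + s))         ≡⟨ solve 2 (λ s h → s :* (h :* (# 1 :+ s)) := h :* (s :* s :+ s)) refl s ½ ⟩
    ½ * (sq s + s)             ≡⟨ cong (λ z → ½ * (z + s)) (trans (pow-±-sq n) (sym (pow-1 n))) ⟩
    ½ * (pow 1ℚ n + s)         ∎
    where s = pow -1ℚ n

  alternate-δ₀ : alternate δ₀ ≗′ δ₀
  alternate-δ₀ zero    = *-identityˡ 1ℚ
  alternate-δ₀ (suc n) = zeroʳ _

  -- sech is even, as its inverse cosh is.
  alternate-euler : alternate euler ≗′ euler
  alternate-euler n = begin
    alternate euler n
      ≡⟨ δ₀-⋆ (alternate euler) n ⟨
    (δ₀ ⋆ alternate euler) n
      ≡⟨ ⋆-cong {g = alternate euler} (λ k → sym (euler-⋆ k)) (λ _ → refl) n ⟩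
    ((euler ⋆ evens) ⋆ alternate euler) n
      ≡⟨ ⋆-assoc euler evens (alternate euler) n ⟩
    (euler ⋆ (evens ⋆ alternate euler)) n
      ≡⟨ ⋆-cong {euler} (λ _ → refl) inverse n ⟩
    (euler ⋆ δ₀) n
      ≡⟨ trans (⋆-comm euler δ₀ n) (δ₀-⋆ euler n) ⟩
    euler n ∎
    where
    inverse : evens ⋆ alternate euler ≗′ δ₀
    inverse k = begin
      (evens ⋆ alternate euler) k
        ≡⟨ ⋆-cong {g = alternate euler} (λ j → sym (alternate-evens j)) (λ _ → refl) k ⟩
      (alternate evens ⋆ alternate euler) k
        ≡⟨ alternate-⋆ evens euler k ⟨
      alternate (evens ⋆ euler) k
        ≡⟨ cong (pow -1ℚ k *_) (trans (⋆-comm evens euler k) (euler-⋆ k)) ⟩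
      alternate δ₀ k
        ≡⟨ alternate-δ₀ k ⟩
      δ₀ k ∎

  euler-⋆-pow-neg : ∀ x n → (euler ⋆ pow (- x)) n ≡ pow -1ℚ n * (euler ⋆ pow x) n
  euler-⋆-pow-neg x n = trans (⋆-cong (λ k → sym (alternate-euler k)) (λ k → trans (cong (λ z → pow z k) (solve 1 (λ x → :- x := :- # 1 :* x) refl x)) (pow-* -1ℚ x k)) n)
    (sym (alternate-⋆ euler (pow x) n))

  pow-even : ∀ m → pow -1ℚ (m ℕ.* 2) ≡ 1ℚ
  pow-even zero    = refl
  pow-even (suc m) = trans (solve 1 (λ x → :- # 1 :* (:- # 1 :* x) := x) refl (pow -1ℚ (m ℕ.* 2))) (pow-even m)

  -- The Euler polynomials of positive even degree vanish at 0: the values for x = 1 and x = -1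
  -- agree by parity, and by the shift at x = 0 they add up to 2·0ⁿ = 0.
  euler-⋆-pow-minus-one : ∀ m → (euler ⋆ pow -1ℚ) (suc m ℕ.* 2) ≡ 0ℚ
  euler-⋆-pow-minus-one m = ι-cancel 1 (begin
    ι 2 * x ≡⟨ solve 1 (λ x → # 2 :* x := # 1 :* x :+ x) refl x ⟩
    1ℚ * x + x
      ≡⟨ cong (λ z → z * x + x) (sym (pow-even (suc m))) ⟩
    pow -1ℚ n * x + x
      ≡⟨ cong₂ _+_ (sym (euler-⋆-pow-neg -1ℚ n)) refl ⟩
    (euler ⋆ pow (- -1ℚ)) n + x
      ≡⟨ cong₂ (λ z w → (euler ⋆ pow z) n + (euler ⋆ pow w) n) (solve 0 (:- :- # 1 := # 0 :+ # 1) refl) (solve 0 (:- # 1 := # 0 :- # 1) refl) ⟩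
    (euler ⋆ pow (0ℚ + 1ℚ)) n + (euler ⋆ pow (0ℚ - 1ℚ)) n
      ≡⟨ euler-⋆-shift 0ℚ n ⟩
    ι 2 * pow 0ℚ n
      ≡⟨ cong (ι 2 *_) (zeroˡ _) ⟩
    ι 2 * 0ℚ ∎)
    where
    n = suc m ℕ.* 2
    x = (euler ⋆ pow -1ℚ) n

  -- The analogue of `faulhaber`: the shift at the odd number 2i+1 links the values at 2i and 2i+2,
  -- and the alternating sum telescopes.
  ∑-±odd : ∀ N n → ι 2 * ∑ N (λ i → pow -1ℚ i * pow (odd i) n) ≡ euler n - pow -1ℚ N * (euler ⋆ pow (ι 2 * ι N)) n
  ∑-±odd zero n = trans (zeroʳ _) (sym (trans (cong (λ z → euler n - 1ℚ * z) (trans (cong (λ z → (euler ⋆ pow z) n) (zeroʳ (ι 2))) (⋆-pow-0 euler n))) (solve 1 (λ x → x :- # 1 :* x := # 0) refl (euler n))))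
  ∑-±odd (suc N) n = begin
    ι 2 * (∑ N (λ i → pow -1ℚ i * pow (odd i) n) + s * pow (odd N) n)
      ≡⟨ solve 3 (λ a s x → # 2 :* (a :+ s :* x) := # 2 :* a :+ s :* (# 2 :* x)) refl _ s (pow (odd N) n) ⟩
    ι 2 * ∑ N (λ i → pow -1ℚ i * pow (odd i) n) + s * (ι 2 * pow (odd N) n)
      ≡⟨ cong₂ (λ z w → z + s * w) (∑-±odd N n) (sym (euler-⋆-shift (odd N) n)) ⟩
    euler n - s * (euler ⋆ pow (ι 2 * ι N)) n + s * ((euler ⋆ pow (odd N + 1ℚ)) n + (euler ⋆ pow (odd N - 1ℚ)) n)
      ≡⟨ cong₂ (λ z w → euler n - s * (euler ⋆ pow (ι 2 * ι N)) n + s * ((euler ⋆ pow z) n + (euler ⋆ pow w) n))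
          (trans (solve 1 (λ x → # 2 :* x :+ # 1 :+ # 1 := # 2 :* (x :+ # 1)) refl (ι N)) (cong (ι 2 *_) (sym (ι-suc N))))
          (solve 1 (λ x → # 2 :* x :+ # 1 :- # 1 := # 2 :* x) refl (ι N)) ⟩
    euler n - s * (euler ⋆ pow (ι 2 * ι N)) n + s * ((euler ⋆ pow (ι 2 * ι (suc N))) n + (euler ⋆ pow (ι 2 * ι N)) n)
      ≡⟨ solve 4 (λ e s x y → e :- s :* x :+ s :* (y :+ x) := e :- :- # 1 :* s :* y) refl (euler n) s _ _ ⟩
    euler n - -1ℚ * s * (euler ⋆ pow (ι 2 * ι (suc N))) n ∎
    where s = pow -1ℚ N

  -- Congruences modulo p and p²

  ι-∸ : ∀ {m n} → n ℕ.≤ m → ι (m ∸ n) ≡ ι m - ι n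
  ι-∸ {m} {n} n≤m = +-moveʳ (trans (sym (ι-+ (m ∸ n) n)) (cong ι (ℕₚ.m∸n+n≡m n≤m)))

  ∑-lin : ∀ n (u v w : ℕ → ℚ) c → ∑ n (λ k → u k - (v k + c * w k)) ≡ ∑ n u - (∑ n v + c * ∑ n w)
  ∑-lin zero    u v w c = solve 1 (λ c → # 0 := # 0 :- (# 0 :+ c :* # 0)) refl c
  ∑-lin (suc n) u v w c = trans (cong (_+ (u n - (v n + c * w n))) (∑-lin n u v w c))
    (solve 7 (λ a b d x y z c → a :- (b :+ c :* d) :+ (x :- (y :+ c :* z)) := a :+ x :- (b :+ y :+ c :* (d :+ z))) refl (∑ n u) (∑ n v) (∑ n w) (u n) (v n) (w n) c)

  ∑-- : ∀ n (u v : ℕ → ℚ) → ∑ n (λ k → u k - v k) ≡ ∑ n u - ∑ n v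
  ∑-- zero    u v = sym (-‿inverseʳ 0ℚ)
  ∑-- (suc n) u v = trans (cong (_+ (u n - v n)) (∑-- n u v))
    (solve 4 (λ a b x y → a :- b :+ (x :- y) := a :+ x :- (b :+ y)) refl (∑ n u) (∑ n v) (u n) (v n))

  n*2≡n+n : ∀ n → n ℕ.* 2 ≡ n ℕ.+ n
  n*2≡n+n n = trans (ℕₚ.*-comm n 2) (cong (n ℕ.+_) (ℕₚ.+-identityʳ n))

  -- 1/n, with 1/0 = 0
  ν : ℕ → ℚ
  ν zero    = 0ℚ
  ν (suc n) = inv n

  ν-*2 : ∀ n → ν (n ℕ.* 2) ≡ ½ * ν n
  ν-*2 zero    = sym (zeroʳ ½)
  ν-*2 (suc n) = ι-cancel (suc (n ℕ.* 2)) (begin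
    ι (suc n ℕ.* 2) * inv (suc (n ℕ.* 2))   ≡⟨ ι-inv (suc (n ℕ.* 2)) ⟩
    1ℚ                                      ≡⟨ solve 0 (# 1 := # 1 :* # 1) refl ⟩
    1ℚ * 1ℚ                                 ≡⟨ cong₂ _*_ (sym (ι-inv 1)) (sym (ι-inv n)) ⟩
    ι 2 * ½ * (ι (suc n) * inv n)           ≡⟨ solve 4 (λ a h x i → a :* h :* (x :* i) := a :* x :* (h :* i)) refl (ι 2) ½ (ι (suc n)) (inv n) ⟩
    ι 2 * ι (suc n) * (½ * inv n)           ≡⟨ cong (_* (½ * inv n)) (sym (ι-*2 (suc n))) ⟩
    ι (suc n ℕ.* 2) * (½ * inv n) ∎)

  ι-ν : ∀ {n} → 0 < n → ι n * ν n ≡ 1ℚ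
  ι-ν {suc n} _ = ι-inv n

  pow-neg-even : ∀ x k → pow (- x) (k ℕ.* 2) ≡ pow x (k ℕ.* 2)
  pow-neg-even x k = begin
    pow (- x) (k ℕ.* 2)                        ≡⟨ cong (λ z → pow z (k ℕ.* 2)) (solve 1 (λ x → :- x := :- # 1 :* x) refl x) ⟩
    pow (-1ℚ * x) (k ℕ.* 2)                    ≡⟨ pow-* -1ℚ x (k ℕ.* 2) ⟩
    pow -1ℚ (k ℕ.* 2) * pow x (k ℕ.* 2)        ≡⟨ trans (cong (_* pow x (k ℕ.* 2)) (pow-even k)) (*-identityˡ _) ⟩
    pow x (k ℕ.* 2) ∎

  pow-+ : ∀ x i j → pow x (i ℕ.+ j) ≡ pow x i * pow x j
  pow-+ x zero    j = sym (*-identityˡ _)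
  pow-+ x (suc i) j = trans (cong (x *_) (pow-+ x i j)) (sym (*-assoc x _ _))

  pow-±-∸ : ∀ {i j} → j ℕ.≤ i → pow -1ℚ (i ∸ j) ≡ pow -1ℚ i * pow -1ℚ j
  pow-±-∸ {i} {j} j≤i = begin
    pow -1ℚ (i ∸ j)                             ≡⟨ trans (sym (*-identityʳ _)) (cong (pow -1ℚ (i ∸ j) *_) (sym (pow-±-sq j))) ⟩
    pow -1ℚ (i ∸ j) * sq (pow -1ℚ j)            ≡⟨ sym (*-assoc _ _ _) ⟩
    pow -1ℚ (i ∸ j) * pow -1ℚ j * pow -1ℚ j     ≡⟨ cong (_* pow -1ℚ j) (trans (sym (pow-+ -1ℚ (i ∸ j) j)) (cong (pow -1ℚ) (ℕₚ.m∸n+n≡m j≤i))) ⟩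
    pow -1ℚ i * pow -1ℚ j ∎

  module Congruences (n : ℕ) (p-prime : Prime (5 ℕ.+ n ℕ.* 2)) where
    -- m = (p-1)/2, s = p-3 and s-1 = p-4. Parametrised by `n`, the equations p = 2m+1, p = 3+s and
    -- p∸3 = s, and the evenness of s, hold by computation.
    p m s s-1 : ℕ
    p   = 5 ℕ.+ n ℕ.* 2
    m   = 2 ℕ.+ n
    s   = suc n ℕ.* 2
    s-1 = suc (n ℕ.* 2)

    open Local p p-prime

    4<p : 4 < p
    4<p = s≤s (s≤s (s≤s (s≤s (s≤s z≤n))))

    2<p : 2 < p
    2<p = ℕₚ.<-trans (ℕₚ.<-trans (ℕₚ.n<1+n 2) (ℕₚ.n<1+n 3)) 4<p

    m<p : m < p
    m<p = s≤s (s≤s (s≤s (ℕₚ.≤-trans (ℕₚ.m≤m*n n 2) (ℕₚ.≤-trans (ℕₚ.n≤1+n _) (ℕₚ.n≤1+n _)))))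

    π≡ : π ≡ odd m
    π≡ = trans (ι-suc (m ℕ.* 2)) (cong (_+ 1ℚ) (ι-*2 m))

    ord-*₁ : ∀ {j x y} → Ord 1 x → Ord j y → Ord (suc j) (x * y)
    ord-*₁ {j} {x} {y} (mkOrd c ic x≡) oy = ord-resp (trans (solve 3 (λ p c y → p :* (c :* y) := p :* # 1 :* c :* y) refl π c y) (cong (_* y) (sym x≡))) (ord-π (ord-*ˡ ic oy))

    int-ν : ∀ {k} → k < p → Int (ν k)
    int-ν {zero}  _   = int-0
    int-ν {suc k} k<p = int-inv k<p

    -- Fermat's congruence k^p ≡ k multiplied by 1/k³, as p = s + 3.
    fermat-inverse : ∀ {k} → 0 < k → k < p → Ord 1 (pow (ι k) s - sq (ν k))
    fermat-inverse {k} 0<k k<p = ord-resp eq (ord-*ˡ (int-* i (int-* i i)) (fermat p p-prime k))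
      where
      x = ι k ; y = ν k ; P = pow (ι k) s
      i = int-ν k<p
      eq : y * (y * y) * (x * (x * (x * P)) - x) ≡ P - sq y
      eq = trans (solve 3 (λ x y P → y :* (y :* y) :* (x :* (x :* (x :* P)) :- x) := x :* y :* (x :* y) :* (x :* y) :* P :- x :* y :* (y :* y)) refl x y P)
        (trans (cong (λ z → z * z * z * P - z * (y * y)) (ι-ν 0<k)) (solve 2 (λ P y → # 1 :* # 1 :* # 1 :* P :- # 1 :* (y :* y) := P :- y :* y) refl P y))

    -- The recurrence for B_k divides by k+1, a p-adic unit as long as k+1 < p.
    int-bernoulli : ∀ N → suc N < p → ∀ k → k ℕ.≤ N → Int (bernoulli k)
    int-bernoulli zero    _   zero z≤n = int-resp (sym bernoulli-0) int-1
    int-bernoulli (suc N) N<p k k≤N with ℕₚ.m≤n⇒m<n∨m≡n k≤N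
    ... | inj₁ (s≤s k≤) = int-bernoulli N (ℕₚ.<-trans (ℕₚ.n<1+n _) N<p) k k≤
    ... | inj₂ refl     = int-resp (sym (bernoulli-suc N)) (int-neg (int-* (int-inv N<p)
      (int-∑ (suc N) λ { j (s≤s j≤N) → int-* (int-ι (suc (suc N) C j)) (int-bernoulli N (ℕₚ.<-trans (ℕₚ.n<1+n _) N<p) j j≤N) })))

    int-euler≤ : ∀ N k → k ℕ.≤ N → Int (euler k)
    int-euler≤ zero    zero z≤n = int-resp (sym euler-0) int-1
    int-euler≤ (suc N) k k≤N with ℕₚ.m≤n⇒m<n∨m≡n k≤N
    ... | inj₁ (s≤s k≤) = int-euler≤ N k k≤
    ... | inj₂ refl     = int-resp (sym (euler-suc N)) (int-neg (int-∑ (suc N) λ { j (s≤s j≤N) →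
        int-if ((suc N ℕ.+ j) % 2 ≡ᵇ 0) (int-* (int-ι (suc N C j)) (int-euler≤ N j j≤N)) }))
      where
      int-if : ∀ c {x} → Int x → Int (if c then x else 0ℚ)
      int-if true  ix = ix
      int-if false ix = int-0

    int-euler : ∀ k → Int (euler k)
    int-euler k = int-euler≤ k k ℕₚ.≤-refl

    -- By `faulhaber`, s+1 times the sum is B_{s+1}(p) - B_{s+1} ≡ (s+1) p B_s modulo p², and s+1 =
    -- p-2 is a unit.
    power-sum≡πB : Ord 2 (∑ (m ℕ.* 2) (λ k → pow (ι (suc k)) s) - π * bernoulli s)
    power-sum≡πB = ord-cancel (ℕₚ.<-trans (ℕₚ.n<1+n _) (ℕₚ.n<1+n _)) (ord-resp eq (⋆-pow-π₂ p p-prime bernoulli s (int-bernoulli s (ℕₚ.<-trans (ℕₚ.n<1+n _) (ℕₚ.n<1+n _)))))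
      where
      S = ∑ (m ℕ.* 2) (λ k → pow (ι (suc k)) s)
      x = (bernoulli ⋆ pow π) (suc s)
      y = bernoulli (suc s)
      head≡ : ∑ p (λ j → pow (ι j) s) ≡ S
      head≡ = trans (∑-head (m ℕ.* 2) (λ j → pow (ι j) s)) (trans (cong (_+ S) (zeroˡ _)) (+-identityˡ S))
      eq : x - (y + ι (suc s) * (π * bernoulli s)) ≡ ι (suc s) * (S - π * bernoulli s)
      eq = begin
        x - (y + ι (suc s) * (π * bernoulli s))            ≡⟨ solve 4 (λ x y c b → x :- (y :+ c :* b) := x :- y :- c :* b) refl x y (ι (suc s)) (π * bernoulli s) ⟩
        x - y - ι (suc s) * (π * bernoulli s)              ≡⟨ cong (_- ι (suc s) * (π * bernoulli s)) (sym (faulhaber p s)) ⟩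
        ι (suc s) * ∑ p (λ j → pow (ι j) s) - ι (suc s) * (π * bernoulli s)
          ≡⟨ cong (λ z → ι (suc s) * z - ι (suc s) * (π * bernoulli s)) head≡ ⟩
        ι (suc s) * S - ι (suc s) * (π * bernoulli s)      ≡⟨ solve 3 (λ c s b → c :* s :- c :* b := c :* (s :- b)) refl (ι (suc s)) S (π * bernoulli s) ⟩
        ι (suc s) * (S - π * bernoulli s) ∎

    ord-pow-π₂ : ∀ {x} → Int x → ∀ k → Ord 2 (pow (π - x) (suc k) - (pow (- x) (suc k) + ι (suc k) * (π * pow (- x) k)))
    ord-pow-π₂ {x} ix k = ord-resp (cong (_- (pow (- x) (suc k) + ι (suc k) * (π * pow (- x) k))) (trans (pow-⋆ (- x) π (suc k)) (cong (λ z → pow z (suc k)) (+-comm (- x) π))))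
      (⋆-pow-π₂ p p-prime (pow (- x)) k (λ j _ → int-pow (int-neg ix) j))

    ord-pow-π₁ : ∀ {x} → Int x → ∀ k → Ord 1 (pow (π - x) k - pow (- x) k)
    ord-pow-π₁ {x} ix k = ord-resp (cong (_- pow (- x) k) (trans (pow-⋆ (- x) π k) (cong (λ z → pow z k) (+-comm (- x) π))))
      (⋆-pow-π₁ p p-prime (pow (- x)) k (λ j _ → int-pow (int-neg ix) j))

    -- Used for φ(j) = 1/j² with γ(j) = 1/j³, d = 2, and for φ(j) = j^s with γ(j) = j^{s-1}, d = -s.
    -- The sum over 1, ..., p-1 is reduced in two ways to sums up to m; as φ and γ are homogeneous,
    -- doubling the argument only costs the factors α and β. Subtracting the two results eliminates
    -- the full sum and relates `φ̄` to p `γ̄`.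
    module Reflection
      (φ γ : ℕ → ℚ) (α β d : ℚ)
      (reflect  : ∀ k → 0 < k → k < p → Ord 2 (φ (p ∸ k) - (φ k + π * d * γ k)))
      (φ-double : ∀ k → φ (k ℕ.* 2) ≡ α * φ k)
      (γ-double : ∀ k → γ (k ℕ.* 2) ≡ β * γ k)
      where
      S φ̄ γ̄ : ℚ
      S = ∑ (m ℕ.* 2) (λ k → φ (suc k))
      φ̄ = ∑ m (λ k → φ (suc k))
      γ̄ = ∑ m (λ k → γ (suc k))

      -- The upper half of 1, …, p - 1 consists of the p - k, k ≤ m.
      ord-halves : Ord 2 (S - (ι 2 * φ̄ + π * d * γ̄))
      ord-halves = ord-resp eq (ord-∑ m (λ k k<m → reflect (suc k) (s≤s z≤n) (ℕₚ.≤-<-trans k<m m<p)))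
        where
        m+m≡ : m ℕ.* 2 ≡ m ℕ.+ m
        m+m≡ = n*2≡n+n m
        index : ∀ k → k < m → suc ((m ∸ suc k) ℕ.+ m) ≡ p ∸ suc k
        index k k<m = trans (cong suc (sym (ℕₚ.+-∸-comm m k<m))) (trans (sym (ℕₚ.+-∸-assoc 1 {m ℕ.+ m} (ℕₚ.≤-trans k<m (ℕₚ.m≤m+n m m)))) (cong (λ z → suc z ∸ suc k) (sym m+m≡)))
        upper : ∑ m (λ k → φ (p ∸ suc k)) ≡ ∑ m (λ k → φ (suc (k ℕ.+ m)))
        upper = trans (∑-cong m (λ k k<m → cong φ (sym (index k k<m)))) (sym (∑-reverse m (λ k → φ (suc (k ℕ.+ m)))))
        S≡ : S ≡ φ̄ + ∑ m (λ k → φ (p ∸ suc k))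
        S≡ = trans (cong (λ N → ∑ N (λ k → φ (suc k))) m+m≡) (trans (∑-++ m m (λ k → φ (suc k))) (cong (λ z → φ̄ + z) (sym upper)))
        eq : ∑ m (λ k → φ (p ∸ suc k) - (φ (suc k) + π * d * γ (suc k))) ≡ S - (ι 2 * φ̄ + π * d * γ̄)
        eq = trans (∑-lin m (λ k → φ (p ∸ suc k)) (λ k → φ (suc k)) (λ k → γ (suc k)) (π * d))
          (trans (solve 3 (λ u h c → u :- (h :+ c) := h :+ u :- (# 2 :* h :+ c)) refl _ φ̄ (π * d * γ̄)) (cong (_- (ι 2 * φ̄ + π * d * γ̄)) (sym S≡)))

      -- The odd numbers below p are the p - 2k, k ≤ m.
      ord-parity : Ord 2 (S - (ι 2 * (α * φ̄) + π * d * (β * γ̄)))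
      ord-parity = ord-resp eq (ord-∑ m (λ k k<m → reflect (suc k ℕ.* 2) (s≤s z≤n) (s≤s (ℕₚ.*-monoˡ-≤ 2 k<m))))
        where
        index : ∀ k → k < m → suc ((m ∸ suc k) ℕ.* 2) ≡ p ∸ suc k ℕ.* 2
        index k k<m = trans (cong suc (ℕₚ.*-distribʳ-∸ 2 m (suc k))) (sym (ℕₚ.+-∸-assoc 1 {m ℕ.* 2} (ℕₚ.*-monoˡ-≤ 2 k<m)))
        odds : ∑ m (λ k → φ (p ∸ suc k ℕ.* 2)) ≡ ∑ m (λ k → φ (suc (k ℕ.* 2)))
        odds = trans (∑-cong m (λ k k<m → cong φ (sym (index k k<m)))) (sym (∑-reverse m (λ k → φ (suc (k ℕ.* 2)))))
        S≡ : S ≡ ∑ m (λ k → φ (p ∸ suc k ℕ.* 2)) + α * φ̄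
        S≡ = begin
          S ≡⟨ ∑-pairs m (λ k → φ (suc k)) ⟩
          ∑ m (λ k → φ (suc (k ℕ.* 2)) + φ (suc k ℕ.* 2)) ≡⟨ ∑-+ m _ _ ⟩
          ∑ m (λ k → φ (suc (k ℕ.* 2))) + ∑ m (λ k → φ (suc k ℕ.* 2))
            ≡⟨ cong₂ _+_ (sym odds) (trans (∑-cong′ m (λ k → φ-double (suc k))) (∑-*ˡ m α (λ k → φ (suc k)))) ⟩
          ∑ m (λ k → φ (p ∸ suc k ℕ.* 2)) + α * φ̄ ∎
        eq : ∑ m (λ k → φ (p ∸ suc k ℕ.* 2) - (φ (suc k ℕ.* 2) + π * d * γ (suc k ℕ.* 2))) ≡ S - (ι 2 * (α * φ̄) + π * d * (β * γ̄))
        eq = begin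
          ∑ m (λ k → φ (p ∸ suc k ℕ.* 2) - (φ (suc k ℕ.* 2) + π * d * γ (suc k ℕ.* 2)))
            ≡⟨ ∑-lin m _ _ _ (π * d) ⟩
          ∑ m (λ k → φ (p ∸ suc k ℕ.* 2)) - (∑ m (λ k → φ (suc k ℕ.* 2)) + π * d * ∑ m (λ k → γ (suc k ℕ.* 2)))
            ≡⟨ cong₂ (λ z w → ∑ m (λ k → φ (p ∸ suc k ℕ.* 2)) - (z + π * d * w))
                 (trans (∑-cong′ m (λ k → φ-double (suc k))) (∑-*ˡ m α (λ k → φ (suc k))))
                 (trans (∑-cong′ m (λ k → γ-double (suc k))) (∑-*ˡ m β (λ k → γ (suc k)))) ⟩
          ∑ m (λ k → φ (p ∸ suc k ℕ.* 2)) - (α * φ̄ + π * d * (β * γ̄))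
            ≡⟨ solve 3 (λ u h c → u :- (h :+ c) := u :+ h :- (# 2 :* h :+ c)) refl _ (α * φ̄) (π * d * (β * γ̄)) ⟩
          ∑ m (λ k → φ (p ∸ suc k ℕ.* 2)) + α * φ̄ - (ι 2 * (α * φ̄) + π * d * (β * γ̄))
            ≡⟨ cong (_- (ι 2 * (α * φ̄) + π * d * (β * γ̄))) (sym S≡) ⟩
          S - (ι 2 * (α * φ̄) + π * d * (β * γ̄)) ∎

    -- With i = 1/k and y = 1/(p-k) one has y = -i + p i y. Squaring this and substituting it once
    -- more for the y of the cross term leaves the explicit remainder p²((iy)² - 2i³y).
    ν-reflect : ∀ k → 0 < k → k < p → Ord 2 (sq (ν (p ∸ k)) - (sq (ν k) + π * ι 2 * (ν k * sq (ν k))))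
    ν-reflect k 0<k k<p = ord-resp eq (ord-π (ord-π (int⇒ord (int-- (int-sq (int-* ii iy)) (int-* (int-ι 2) (int-* ii (int-* (int-sq ii) iy)))))))
      where
      i = ν k ; y = ν (p ∸ k)
      ii = int-ν k<p
      iy : Int y
      iy = int-ν (ℕₚ.∸-monoʳ-< 0<k (ℕₚ.<⇒≤ k<p))
      yx : (π - ι k) * y ≡ 1ℚ
      yx = trans (cong (_* y) (sym (ι-∸ (ℕₚ.<⇒≤ k<p)))) (ι-ν (ℕₚ.m<n⇒0<n∸m k<p))
      y≡ : y ≡ - i + π * (i * y)
      y≡ = begin
        y                                   ≡⟨ solve 1 (λ y → y := # 1 :* y) refl y ⟩
        1ℚ * y                              ≡⟨ cong (_* y) (sym (ι-ν 0<k)) ⟩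
        ι k * i * y                         ≡⟨ solve 4 (λ x i y p → x :* i :* y := :- (i :* ((p :- x) :* y)) :+ p :* (i :* y)) refl (ι k) i y π ⟩
        - (i * ((π - ι k) * y)) + π * (i * y) ≡⟨ cong (λ z → - z + π * (i * y)) (trans (cong (i *_) yx) (*-identityʳ i)) ⟩
        - i + π * (i * y) ∎
      eq : π * (π * (sq (i * y) - ι 2 * (i * (sq i * y)))) ≡ sq y - (sq i + π * ι 2 * (i * sq i))
      eq = begin
        π * (π * (sq (i * y) - ι 2 * (i * (sq i * y))))
          ≡⟨ solve 3 (λ i y p → p :* (p :* (i :* y :* (i :* y) :- # 2 :* (i :* (i :* i :* y))))
               := (:- i :+ p :* (i :* y)) :* (:- i :+ p :* (i :* y)) :- (i :* i :+ p :* # 2 :* (i :* (i :* i))) :+ # 2 :* p :* (i :* i) :* (y :- (:- i :+ p :* (i :* y)))) refl i y π ⟩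
        sq (- i + π * (i * y)) - (sq i + π * ι 2 * (i * sq i)) + ι 2 * π * (i * i) * (y - (- i + π * (i * y)))
          ≡⟨ cong₂ (λ z w → sq z - (sq i + π * ι 2 * (i * sq i)) + ι 2 * π * (i * i) * (y - w)) (sym y≡) (sym y≡) ⟩
        sq y - (sq i + π * ι 2 * (i * sq i)) + ι 2 * π * (i * i) * (y - y)
          ≡⟨ solve 3 (λ a c y → a :+ c :* (y :- y) := a) refl (sq y - (sq i + π * ι 2 * (i * sq i))) (ι 2 * π * (i * i)) y ⟩
        sq y - (sq i + π * ι 2 * (i * sq i)) ∎

    H₃ : ℚ
    H₃ = ∑ m (λ k → inv k * sq (inv k))

    module R₁ = Reflection (λ k → sq (ν k)) (λ k → ν k * sq (ν k)) (sq ½) (½ * sq ½) (ι 2) ν-reflect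
      (λ k → trans (cong sq (ν-*2 k)) (solve 2 (λ h x → h :* x :* (h :* x) := h :* h :* (x :* x)) refl ½ (ν k)))
      (λ k → trans (cong (λ z → z * sq z) (ν-*2 k)) (solve 2 (λ h x → h :* x :* (h :* x :* (h :* x)) := h :* (h :* h) :* (x :* (x :* x))) refl ½ (ν k)))

    -- Here α = 1/4, β = 1/8 and d = 2, so the two splittings differ by (3/2) `H₂ m` + (7/4) p `H₃`;
    -- the factor 4 clears the denominators.
    ord-H₂-H₃ : Ord 2 (ι 6 * H₂ m + ι 7 * (π * H₃))
    ord-H₂-H₃ = ord-resp (begin
      ι 4 * (S - (ι 2 * (sq ½ * H₂ m) + π * ι 2 * (½ * sq ½ * H₃)) - (S - (ι 2 * H₂ m + π * ι 2 * H₃)))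
        ≡⟨ solve 5 (λ s t h g p → # 4 :* (s :- (# 2 :* (t :* t :* h) :+ p :* # 2 :* (t :* (t :* t) :* g)) :- (s :- (# 2 :* h :+ p :* # 2 :* g)))
             := (# 8 :- # 2 :* (# 2 :* t :* (# 2 :* t))) :* h :+ (# 8 :- # 2 :* t :* (# 2 :* t) :* (# 2 :* t)) :* (p :* g)) refl S ½ (H₂ m) H₃ π ⟩
      (ι 8 - ι 2 * (ι 2 * ½ * (ι 2 * ½))) * H₂ m + (ι 8 - ι 2 * ½ * (ι 2 * ½) * (ι 2 * ½)) * (π * H₃)
        ≡⟨ cong (λ z → (ι 8 - ι 2 * (z * z)) * H₂ m + (ι 8 - z * z * z) * (π * H₃)) (ι-inv 1) ⟩
      (ι 8 - ι 2 * (1ℚ * 1ℚ)) * H₂ m + (ι 8 - 1ℚ * 1ℚ * 1ℚ) * (π * H₃)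
        ≡⟨ solve 2 (λ h g → (# 8 :- # 2 :* (# 1 :* # 1)) :* h :+ (# 8 :- # 1 :* # 1 :* # 1) :* g := # 6 :* h :+ # 7 :* g) refl (H₂ m) (π * H₃) ⟩
      ι 6 * H₂ m + ι 7 * (π * H₃) ∎)
      (ord-*ˡ (int-ι 4) (ord-- R₁.ord-parity R₁.ord-halves))
      where S = ∑ (m ℕ.* 2) (λ k → sq (inv k))

    -- Negative because the linear term s p (-x)^{s-1} of (p-x)^s has an odd exponent.
    d : ℚ
    d = - ι s

    pow-reflect : ∀ k → 0 < k → k < p → Ord 2 (pow (ι (p ∸ k)) s - (pow (ι k) s + π * d * pow (ι k) s-1))
    pow-reflect k 0<k k<p = ord-resp (cong₂ _-_ (cong (λ z → pow z s) (sym (ι-∸ (ℕₚ.<⇒≤ k<p))))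
        (cong₂ _+_ (pow-neg-even x (suc n)) (begin
          ι s * (π * (- x * pow (- x) (n ℕ.* 2)))   ≡⟨ cong (λ z → ι s * (π * (- x * z))) (pow-neg-even x n) ⟩
          ι s * (π * (- x * pow x (n ℕ.* 2)))       ≡⟨ solve 4 (λ s p x y → s :* (p :* (:- x :* y)) := p :* :- s :* (x :* y)) refl (ι s) π x (pow x (n ℕ.* 2)) ⟩
          π * d * pow x s-1                         ∎)))
      (ord-pow-π₂ (int-ι k) s-1)
      where x = ι k

    pow-double : ∀ j k → pow (ι (k ℕ.* 2)) j ≡ pow (ι 2) j * pow (ι k) j
    pow-double j k = trans (cong (λ z → pow z j) (ι-*2 k)) (pow-* (ι 2) (ι k) j)

    module R₂ = Reflection (λ k → pow (ι k) s) (λ k → pow (ι k) s-1) (pow (ι 2) s) (pow (ι 2) s-1) d pow-reflect (pow-double s) (pow-double s-1)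

    G₃ : ℚ
    G₃ = ∑ m (λ k → pow (ι (suc k)) s-1)

    ord-G₃-H₃ : Ord 1 (G₃ - H₃)
    ord-G₃-H₃ = ord-resp
      (∑-- m (λ k → pow (ι (suc k)) s-1) (λ k → inv k * sq (inv k)))
      (ord-∑ m λ k k<m → let k<p = ℕₚ.≤-<-trans k<m m<p in ord-resp (eq k) (ord-*ˡ (int-inv k<p) (fermat-inverse (s≤s z≤n) k<p)))
      where
      eq : ∀ k → inv k * (ι (suc k) * pow (ι (suc k)) s-1 - sq (inv k)) ≡ pow (ι (suc k)) s-1 - inv k * sq (inv k)
      eq k = trans (solve 4 (λ i x P q → i :* (x :* P :- q) := x :* i :* P :- i :* q) refl (inv k) (ι (suc k)) (pow (ι (suc k)) s-1) (sq (inv k)))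
        (cong (_- inv k * sq (inv k)) (trans (cong (_* pow (ι (suc k)) s-1) (ι-inv k)) (*-identityˡ _)))

    -- For powers the doubling factors are 2^s and 2^{s-1}, which agree with 1/4 and 1/8 modulo p
    -- only, while the splittings are compared modulo p². The error `ε` is multiplied by `h₀`, so it
    -- becomes negligible once `h₀` is known to be divisible by p. Eliminating `h₀` gives 2S + p
    -- `G₃` ≡ 0, and S ≡ pB allows division by p.
    ord-2B+G₃ : Ord 1 (ι 2 * bernoulli s + G₃)
    ord-2B+G₃ = ord-cancel-π (ord-resp
      (solve 4 (λ p B S g₀ → # 2 :* S :+ p :* g₀ :- # 2 :* (S :- p :* B) := p :* (# 2 :* B :+ g₀)) refl π (bernoulli s) S g₀)
      (ord-- 2S+πg (ord-*ˡ (int-ι 2) power-sum≡πB)))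
      where
      S h₀ g₀ β ε Δ : ℚ
      S = ∑ (m ℕ.* 2) (λ k → pow (ι (suc k)) s)
      h₀ = ∑ m (λ k → pow (ι (suc k)) s)
      g₀ = G₃
      β = pow (ι 2) s-1
      ε = ι 8 * β - 1ℚ
      Δ = (S - (ι 2 * (ι 2 * β * h₀) + π * d * (β * g₀))) - (S - (ι 2 * h₀ + π * d * g₀))

      int-β : Int β
      int-β = int-pow (int-ι 2) s-1
      int-d : Int d
      int-d = int-neg (int-ι s)
      int-g : Int g₀
      int-g = int-∑ m λ k _ → int-pow (int-ι (suc k)) s-1
      int-h : Int h₀
      int-h = int-∑ m λ k _ → int-pow (int-ι (suc k)) s

      d≡ : d ≡ ι 3 - π
      d≡ = trans (solve 1 (λ x → :- x := # 3 :- (# 3 :+ x)) refl (ι s)) (cong (λ z → ι 3 - z) (sym (ι-+ 3 s)))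

      -- 8β = 2^{s+2} = 2^{p-1}, so this is Fermat's theorem for the base 2.
      ord-ε : Ord 1 ε
      ord-ε = ord-resp
        (trans (solve 2 (λ b t → # 4 :* (# 2 :* b :- t :* t) := # 8 :* b :- # 2 :* t :* (# 2 :* t)) refl β ½) (cong (λ z → ι 8 * β - z) (trans (cong sq (ι-inv 1)) (*-identityˡ 1ℚ))))
        (ord-*ˡ (int-ι 4) (fermat-inverse (s≤s z≤n) 2<p))

      ord-Δ : Ord 2 Δ
      ord-Δ = ord-- R₂.ord-parity R₂.ord-halves

      -- Modulo p the difference of the splittings is 2(1 - 2β)`h₀`; as 8β ≡ 1, eight times it is 12
      -- `h₀`, and 3 and 4 are units because p > 4.
      ord-h : Ord 1 h₀
      ord-h = ord-cancel 3<p (ord-cancel 4<p (ord-resp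
        (solve 6 (λ S b h₀ p d g₀ → # 8 :* (S :- (# 2 :* (# 2 :* b :* h₀) :+ p :* d :* (b :* g₀)) :- (S :- (# 2 :* h₀ :+ p :* d :* g₀))) :+ (# 4 :* h₀) :* (# 8 :* b :- # 1) :- p :* (# 8 :* (d :* ((# 1 :- b) :* g₀)))
           := # 4 :* (# 3 :* h₀)) refl S β h₀ π d g₀)
        (ord-- (ord-+ (ord-*ˡ (int-ι 8) (ord-pred ord-Δ)) (ord-*ˡ (int-* (int-ι 4) int-h) ord-ε))
               (ord-π (int⇒ord (int-* (int-ι 8) (int-* int-d (int-* (int-- int-1 int-β) int-g))))))))
        where
        3<p : 3 < p
        3<p = ℕₚ.<-trans (ℕₚ.n<1+n 3) 4<p

      -- 8Δ is 12 `h₀` + 7πd `g₀` up to multiples of `ε * h₀` and `ε * π`, both divisible by p².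
      -- Replacing d = 3 - p by 3 costs another multiple of p², and the common factor 3 is
      -- cancelled.
      4h+7πg : Ord 2 (ι 4 * h₀ + ι 7 * (π * g₀))
      4h+7πg = ord-cancel (ℕₚ.<-trans (ℕₚ.n<1+n 3) 4<p) (ord-resp
        (trans (cong (λ δ → ι 8 * ((S - (ι 2 * (ι 2 * β * h₀) + π * δ * (β * g₀))) - (S - (ι 2 * h₀ + π * δ * g₀))) + ι 4 * (ε * h₀) + π * (π * (ι 7 * g₀)) + ε * (π * (δ * g₀))) d≡)
          (solve 5 (λ S b h₀ p g₀ → let δ = # 3 :- p ; e = # 8 :* b :- # 1 in
            # 8 :* (S :- (# 2 :* (# 2 :* b :* h₀) :+ p :* δ :* (b :* g₀)) :- (S :- (# 2 :* h₀ :+ p :* δ :* g₀))) :+ # 4 :* (e :* h₀) :+ p :* (p :* (# 7 :* g₀)) :+ e :* (p :* (δ :* g₀))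
            := # 3 :* (# 4 :* h₀ :+ # 7 :* (p :* g₀))) refl S β h₀ π g₀))
        (ord-+ (ord-+ (ord-+ (ord-*ˡ (int-ι 8) ord-Δ) (ord-*ˡ (int-ι 4) (ord-*₁ ord-ε ord-h))) (ord-π (ord-π (int⇒ord (int-* (int-ι 7) int-g)))))
          (ord-*₁ ord-ε (ord-π (int⇒ord (int-* int-d int-g))))))

      2S+πg : Ord 2 (ι 2 * S + π * g₀)
      2S+πg = ord-resp
        (trans (cong (λ δ → ι 2 * (S - (ι 2 * h₀ + π * δ * g₀)) + (ι 4 * h₀ + ι 7 * (π * g₀)) - π * (π * (ι 2 * g₀))) d≡)
          (solve 4 (λ S h₀ p g₀ → # 2 :* (S :- (# 2 :* h₀ :+ p :* (# 3 :- p) :* g₀)) :+ (# 4 :* h₀ :+ # 7 :* (p :* g₀)) :- p :* (p :* (# 2 :* g₀)) := # 2 :* S :+ p :* g₀) refl S h₀ π g₀))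
        (ord-- (ord-+ (ord-*ˡ (int-ι 2) R₂.ord-halves) 4h+7πg) (ord-π (ord-π (int⇒ord (int-* (int-ι 2) int-g)))))

    -- 6 `H₂ m` ≡ -7p `H₃` ≡ -7p `G₃` ≡ 14p B_s modulo p². The last two steps are congruences modulo
    -- p multiplied by p.
    ord-H₂-bernoulli : Ord 2 (ι 3 * H₂ m - ι 7 * (π * bernoulli s))
    ord-H₂-bernoulli = ord-cancel 2<p (ord-resp
      (solve 5 (λ H G p B g → # 6 :* H :+ # 7 :* (p :* G) :- # 7 :* (p :* (# 2 :* B :+ g :- (g :- G))) := # 2 :* (# 3 :* H :- # 7 :* (p :* B))) refl (H₂ m) H₃ π (bernoulli s) G₃)
      (ord-- ord-H₂-H₃ (ord-*ˡ (int-ι 7) (ord-π (ord-- ord-2B+G₃ ord-G₃-H₃)))))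

    -- The sum `W` over the odd numbers below p-1 is evaluated twice modulo p: as half an Euler
    -- number, and, through 2i+1 = p - 2(k+1), as a quarter of the signed alternating sum.
    ord-A₂-euler : Ord 1 (pow -1ℚ m * A₂ m - ι 2 * euler s)
    ord-A₂-euler = ord-resp
      (solve 3 (λ W E A → # 2 :* (# 2 :* W :- E) :- # 4 :* (W :- A) := # 4 :* A :- # 2 :* E) refl W (euler s) _ ∙
       cong (_- ι 2 * euler s) quarter)
      (ord-- (ord-*ˡ (int-ι 2) 2W-E) (ord-*ˡ (int-ι 4) W-A))
      where
      infixr 5 _∙_
      _∙_ : ∀ {x y z : ℚ} → x ≡ y → y ≡ z → x ≡ z
      _∙_ = trans

      W : ℚ
      W = ∑ m (λ i → pow -1ℚ i * pow (odd i) s)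

      quarter : ι 4 * (pow -1ℚ m * (sq ½ * A₂ m)) ≡ pow -1ℚ m * A₂ m
      quarter = solve 3 (λ s h a → # 4 :* (s :* (h :* h :* a)) := # 2 :* h :* (# 2 :* h) :* (s :* a)) refl (pow -1ℚ m) ½ (A₂ m)
        ∙ cong (λ z → z * z * (pow -1ℚ m * A₂ m)) (ι-inv 1) ∙ solve 1 (λ x → # 1 :* # 1 :* x := x) refl _

      -- The boundary value at 2m = p - 1 in `∑-±odd` is congruent to the value at -1, which
      -- vanishes since s is even and positive.
      2W-E : Ord 1 (ι 2 * W - euler s)
      2W-E = ord-resp
        (trans (cong (λ z → - pow -1ℚ m * (z - (euler ⋆ pow -1ℚ) s)) (trans (⋆-assoc euler (pow -1ℚ) (pow π) s) (⋆-cong {euler} (λ _ → refl) (λ k → trans (pow-⋆ -1ℚ π k) (cong (λ z → pow z k) 2m≡)) s)))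
          (trans (cong (λ z → - pow -1ℚ m * ((euler ⋆ pow (ι 2 * ι m)) s - z)) (euler-⋆-pow-minus-one n))
            (trans (solve 3 (λ s x e → :- s :* (x :- # 0) := e :- s :* x :- e) refl (pow -1ℚ m) _ (euler s)) (cong (_- euler s) (sym (∑-±odd m s))))))
        (ord-*ˡ (int-neg (int-pow (int-neg int-1) m)) (⋆-pow-π₁ p p-prime (euler ⋆ pow -1ℚ) s (λ k _ → ⋆-int p p-prime int-euler (int-pow (int-neg int-1)) k)))
        where
        2m≡ : -1ℚ + π ≡ ι 2 * ι m
        2m≡ = trans (cong (λ z → -1ℚ + z) π≡) (solve 1 (λ x → :- # 1 :+ (# 2 :* x :+ # 1) := # 2 :* x) refl (ι m))

      -- In reversed order the base is p - 2(k+1). Its even power s is ≡ (2(k+1))^s ≡ 1/(4(k+1)²),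
      -- and the sign (-1)^{m-k-1} factors as (-1)ᵐ(-1)^{k+1}.
      term : ∀ k → k < m → Ord 1 (pow -1ℚ (m ∸ suc k) * pow (odd (m ∸ suc k)) s - pow -1ℚ m * (sq ½ * (pow -1ℚ (suc k) * sq (inv k))))
      term k k<m = ord-resp eq (ord-*ˡ (int-* (int-pow (int-neg int-1) m) (int-pow (int-neg int-1) (suc k)))
          (ord-+ (ord-pow-π₁ (int-ι 2k) s) (fermat-inverse (s≤s z≤n) 2k<p)))
        where
        2k = suc k ℕ.* 2
        2k<p : 2k < p
        2k<p = s≤s (ℕₚ.*-monoˡ-≤ 2 k<m)
        base≡ : π - ι 2k ≡ odd (m ∸ suc k)
        base≡ = trans (cong₂ _-_ π≡ (ι-*2 (suc k))) (trans (solve 2 (λ x y → # 2 :* x :+ # 1 :- # 2 :* y := # 2 :* (x :- y) :+ # 1) refl (ι m) (ι (suc k))) (cong (λ z → ι 2 * z + 1ℚ) (sym (ι-∸ k<m))))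
        eq : pow -1ℚ m * pow -1ℚ (suc k) * (pow (π - ι 2k) s - pow (- ι 2k) s + (pow (ι 2k) s - sq (ν 2k)))
           ≡ pow -1ℚ (m ∸ suc k) * pow (odd (m ∸ suc k)) s - pow -1ℚ m * (sq ½ * (pow -1ℚ (suc k) * sq (inv k)))
        eq = begin
          pow -1ℚ m * pow -1ℚ (suc k) * (pow (π - ι 2k) s - pow (- ι 2k) s + (pow (ι 2k) s - sq (ν 2k)))
            ≡⟨ cong₂ (λ z w → pow -1ℚ m * pow -1ℚ (suc k) * (pow (π - ι 2k) s - z + (pow (ι 2k) s - sq w))) (pow-neg-even (ι 2k) (suc n)) (ν-*2 (suc k)) ⟩
          pow -1ℚ m * pow -1ℚ (suc k) * (pow (π - ι 2k) s - pow (ι 2k) s + (pow (ι 2k) s - sq (½ * inv k)))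
            ≡⟨ solve 6 (λ a b x y h i → a :* b :* (x :- y :+ (y :- h :* i :* (h :* i))) := a :* b :* x :- a :* (h :* h :* (b :* (i :* i)))) refl (pow -1ℚ m) (pow -1ℚ (suc k)) (pow (π - ι 2k) s) (pow (ι 2k) s) ½ (inv k) ⟩
          pow -1ℚ m * pow -1ℚ (suc k) * pow (π - ι 2k) s - pow -1ℚ m * (sq ½ * (pow -1ℚ (suc k) * sq (inv k)))
            ≡⟨ cong₂ (λ z w → z * pow w s - pow -1ℚ m * (sq ½ * (pow -1ℚ (suc k) * sq (inv k)))) (sym (pow-±-∸ k<m)) base≡ ⟩
          pow -1ℚ (m ∸ suc k) * pow (odd (m ∸ suc k)) s - pow -1ℚ m * (sq ½ * (pow -1ℚ (suc k) * sq (inv k))) ∎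

      W-A : Ord 1 (W - pow -1ℚ m * (sq ½ * A₂ m))
      W-A = ord-resp (begin
        ∑ m (λ k → u k - pow -1ℚ m * (sq ½ * w k))
          ≡⟨ ∑-cong′ m (λ k → solve 4 (λ u s h w → u :- s :* (h :* w) := u :- (# 0 :+ s :* h :* w)) refl (u k) (pow -1ℚ m) (sq ½) (w k)) ⟩
        ∑ m (λ k → u k - (0ℚ + pow -1ℚ m * sq ½ * w k))
          ≡⟨ ∑-lin m u (λ _ → 0ℚ) w (pow -1ℚ m * sq ½) ⟩
        ∑ m u - (∑ m (λ _ → 0ℚ) + pow -1ℚ m * sq ½ * A₂ m)
          ≡⟨ cong₂ (λ z t → z - (t + pow -1ℚ m * sq ½ * A₂ m)) (sym (∑-reverse m (λ i → pow -1ℚ i * pow (odd i) s))) (∑-zero m) ⟩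
        W - (0ℚ + pow -1ℚ m * sq ½ * A₂ m)
          ≡⟨ solve 4 (λ W s h A → W :- (# 0 :+ s :* h :* A) := W :- s :* (h :* A)) refl W (pow -1ℚ m) (sq ½) (A₂ m) ⟩
        W - pow -1ℚ m * (sq ½ * A₂ m) ∎)
        (ord-∑ m term)
        where
        u w : ℕ → ℚ
        u k = pow -1ℚ (m ∸ suc k) * pow (odd (m ∸ suc k)) s
        w k = pow -1ℚ (suc k) * sq (inv k)

  -- The two sums

  ι-^ : ∀ n j → ι (n ℕ.^ j) ≡ pow (ι n) j
  ι-^ n zero    = refl
  ι-^ n (suc j) = trans (ι-* n (n ℕ.^ j)) (cong (ι n *_) (ι-^ n j))

  ι-^2 : ∀ n → ι (n ℕ.^ 2) ≡ sq (ι n)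
  ι-^2 n = trans (ι-^ n 2) (cong (ι n *_) (*-identityʳ (ι n)))

  ι-sum : ∀ (f : ℕ → ℕ) n → ι (sumℕ (map f (upTo n))) ≡ ∑ n (λ k → ι (f k))
  ι-sum f n = trans (cong (λ l → ι (sumℕ l)) (Listₚ.map-upTo f n)) (go f n)
    where
    go : ∀ (f : ℕ → ℕ) n → ι (sumℕ (applyUpTo f n)) ≡ ∑ n (λ k → ι (f k))
    go f zero    = refl
    go f (suc n) = trans (ι-+ (f 0) _) (trans (cong (λ z → ι (f 0) + z) (go (λ k → f (suc k)) n)) (sym (∑-head n (λ k → ι (f k)))))

  ι-T-term : ∀ n k → ι ((n C k) ℕ.^ 2 ℕ.* ((2 ℕ.* k) C n) ℕ.^ 2) ≡ T-term n k
  ι-T-term n k = begin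
    ι ((n C k) ℕ.^ 2 ℕ.* ((2 ℕ.* k) C n) ℕ.^ 2)
      ≡⟨ ι-* ((n C k) ℕ.^ 2) (((2 ℕ.* k) C n) ℕ.^ 2) ⟩
    ι ((n C k) ℕ.^ 2) * ι (((2 ℕ.* k) C n) ℕ.^ 2)
      ≡⟨ cong₂ _*_ (ι-^2 (n C k)) (ι-^2 ((2 ℕ.* k) C n)) ⟩
    sq (ι (n C k)) * sq (ι ((2 ℕ.* k) C n))
      ≡⟨ cong (λ i → sq (ι (n C k)) * sq (ι (i C n))) (ℕₚ.*-comm 2 k) ⟩
    sq (ι (n C k)) * sq (ι ((k ℕ.* 2) C n))
      ≡⟨ cong₂ (λ z w → sq z * sq w) (ι-C n k) (ι-C (k ℕ.* 2) n) ⟩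
    sq (fact n * (rf k * rf∸ n k)) * sq (fact (k ℕ.* 2) * (rf n * rf∸ (k ℕ.* 2) n))
      ≡⟨ solve 6 (λ x y K R D S → let u = x :* (K :* R) ; w = D :* (y :* S) ; z = D :* K :* (R :* S) in u :* u :* (w :* w) := x :* y :* (x :* y) :* (z :* z)) refl (fact n) (rf n) (rf k) (rf∸ n k) (fact (k ℕ.* 2)) (rf∸ (k ℕ.* 2) n) ⟩
    fact n * rf n * (fact n * rf n) * T-term n k
      ≡⟨ trans (cong (λ z → z * z * T-term n k) (fact*rf n)) (solve 1 (λ x → # 1 :* # 1 :* x := x) refl (T-term n k)) ⟩
    T-term n k ∎

  ι-T : ∀ n → ι (T n) ≡ ∑ (suc n) (T-term n)
  ι-T n = trans (ι-sum _ (suc n)) (∑-cong′ (suc n) (ι-T-term n))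

  ι-T≡ : ∀ N n → n ℕ.≤ N → ι (T n) ≡ pow (ι 4) n * ∑ (suc N) (t-term n)
  ι-T≡ N n n≤N = begin
    ι (T n)                        ≡⟨ ι-T n ⟩
    ∑ (suc n) (T-term n)                ≡⟨ ∑-truncate (suc n) (suc N) (λ k n<k → trans (cong (λ z → sq ([2k]!/k! k * (z * rf∸ (k ℕ.* 2) n))) (rf∸-zero n<k)) (solve 2 (λ x y → let z = x :* (# 0 :* y) in z :* z := # 0) refl ([2k]!/k! k) (rf∸ (k ℕ.* 2) n))) (s≤s n≤N) ⟨
    ∑ (suc N) (T-term n)                ≡⟨ ∑T-term≡4ⁿ∑t-term N n n≤N ⟩
    pow (ι 4) n * ∑ (suc N) (t-term n)  ∎

  ι-2k+1 : ∀ k → ι (2 ℕ.* k ℕ.+ 1) ≡ odd k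
  ι-2k+1 k = trans (ι-+ (2 ℕ.* k) 1) (cong (_+ 1ℚ) (ι-* 2 k))

  pow-4-¼ : ∀ n → pow (ι 4) n * pow (inv 3) n ≡ 1ℚ
  pow-4-¼ n = trans (sym (pow-* (ι 4) (inv 3) n)) (trans (cong (λ z → pow z n) (ι-inv 3)) (pow-1 n))

  t-partial-zero : ∀ m k → m < k → t-partial (suc (m ℕ.* 2)) k ≡ 0ℚ
  t-partial-zero m k m<k = trans (cong (λ z → fact (k ℕ.* 2 ℕ.+ suc (m ℕ.* 2)) * z * 1/16ᵏk!⁴ k) (rf∸-zero (ℕₚ.*-monoˡ-< 2 m<k)))
    (solve 2 (λ x y → x :* # 0 :* y := # 0) refl (fact (k ℕ.* 2 ℕ.+ suc (m ℕ.* 2))) (1/16ᵏk!⁴ k))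

  module Sums (m : ℕ) where
    N : ℕ
    N = m ℕ.* 2

    ιN≡ : ι (suc N) ≡ odd m
    ιN≡ = trans (ι-suc N) (cong (_+ 1ℚ) (ι-*2 m))

    m≤N : suc m ℕ.≤ suc N
    m≤N = s≤s (ℕₚ.m≤m*n m 2)

    sum-T/4ⁿ : ∑ (suc N) (λ k → ι (2 ℕ.* k ℕ.+ 1) * ι (T k) * pow (inv 3) k) ≡ odd m * (odd m * ∑legendre/odd m (evenProduct (odd m)))
    sum-T/4ⁿ = begin
      ∑ (suc N) (λ k → ι (2 ℕ.* k ℕ.+ 1) * ι (T k) * pow (inv 3) k)
        ≡⟨ ∑-cong (suc N) term ⟩
      ∑ (suc N) (λ n → ∑ (suc N) (λ k → odd n * t-term n k))
        ≡⟨ ∑-swap (suc N) (suc N) _ ⟩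
      ∑ (suc N) (λ k → ∑ (suc N) (λ n → odd n * t-term n k))
        ≡⟨ ∑-cong′ (suc N) inner ⟩
      ∑ (suc N) (λ k → odd m * t-partial (suc N) k * inv (k ℕ.* 2))
        ≡⟨ ∑-truncate (suc m) (suc N) (λ k m<k → trans (cong (λ z → odd m * z * inv (k ℕ.* 2)) (t-partial-zero m k m<k)) (solve 2 (λ x y → x :* # 0 :* y := # 0) refl (odd m) (inv (k ℕ.* 2)))) m≤N ⟩
      ∑ (suc m) (λ k → odd m * t-partial (suc N) k * inv (k ℕ.* 2))
        ≡⟨ ∑-cong′ (suc m) (λ k → trans (cong (λ z → odd m * z * inv (k ℕ.* 2)) (t-partial≡ m k)) (solve 3 (λ p x i → p :* (p :* x) :* i := p :* p :* (x :* i)) refl (odd m) (legendre m k * evenProduct (odd m) k) (inv (k ℕ.* 2)))) ⟩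
      ∑ (suc m) (λ k → odd m * odd m * (legendre m k * evenProduct (odd m) k * inv (k ℕ.* 2)))
        ≡⟨ trans (∑-*ˡ (suc m) (odd m * odd m) _) (*-assoc _ _ _) ⟩
      odd m * (odd m * ∑legendre/odd m (evenProduct (odd m))) ∎
      where
      term : ∀ n → n < suc N → ι (2 ℕ.* n ℕ.+ 1) * ι (T n) * pow (inv 3) n ≡ ∑ (suc N) (λ k → odd n * t-term n k)
      term n (s≤s n≤N) = begin
        ι (2 ℕ.* n ℕ.+ 1) * ι (T n) * pow (inv 3) n
          ≡⟨ cong₂ (λ z w → z * w * pow (inv 3) n) (ι-2k+1 n) (ι-T≡ N n n≤N) ⟩
        odd n * (pow (ι 4) n * t) * pow (inv 3) n
          ≡⟨ solve 4 (λ o x t y → o :* (x :* t) :* y := x :* y :* (o :* t)) refl (odd n) (pow (ι 4) n) t (pow (inv 3) n) ⟩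
        pow (ι 4) n * pow (inv 3) n * (odd n * t)
          ≡⟨ trans (cong (_* (odd n * t)) (pow-4-¼ n)) (*-identityˡ _) ⟩
        odd n * t
          ≡⟨ ∑-*ˡ (suc N) (odd n) (t-term n) ⟨
        ∑ (suc N) (λ k → odd n * t-term n k) ∎
        where t = ∑ (suc N) (t-term n)
      inner : ∀ k → ∑ (suc N) (λ n → odd n * t-term n k) ≡ odd m * t-partial (suc N) k * inv (k ℕ.* 2)
      inner k = begin
        x                                  ≡⟨ solve 1 (λ x → x := # 1 :* x) refl x ⟩
        1ℚ * x                             ≡⟨ cong (_* x) (sym (odd-inv k)) ⟩
        odd k * inv (k ℕ.* 2) * x          ≡⟨ solve 3 (λ o i x → o :* i :* x := o :* x :* i) refl (odd k) (inv (k ℕ.* 2)) x ⟩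
        odd k * x * inv (k ℕ.* 2)          ≡⟨ cong (_* inv (k ℕ.* 2)) (trans (∑-t-term (suc N) k) (cong (_* t-partial (suc N) k) ιN≡)) ⟩
        odd m * t-partial (suc N) k * inv (k ℕ.* 2) ∎
        where x = ∑ (suc N) (λ n → odd n * t-term n k)

    sum-T/-4ⁿ : ∑ (suc N) (λ k → ι (2 ℕ.* k ℕ.+ 1) * ι (T k) * pow (- inv 3) k) ≡ odd m * ∑legendre m (evenProduct (odd m))
    sum-T/-4ⁿ = begin
      ∑ (suc N) (λ k → ι (2 ℕ.* k ℕ.+ 1) * ι (T k) * pow (- inv 3) k)
        ≡⟨ ∑-cong (suc N) term ⟩
      ∑ (suc N) (λ n → ∑ (suc N) (λ k → odd n * pow -1ℚ n * t-term n k))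
        ≡⟨ ∑-swap (suc N) (suc N) _ ⟩
      ∑ (suc N) (λ k → ∑ (suc N) (λ n → odd n * pow -1ℚ n * t-term n k))
        ≡⟨ ∑-cong′ (suc N) inner ⟩
      ∑ (suc N) (λ k → t-partial (suc N) k)
        ≡⟨ ∑-truncate (suc m) (suc N) (t-partial-zero m) m≤N ⟩
      ∑ (suc m) (λ k → t-partial (suc N) k)
        ≡⟨ ∑-cong′ (suc m) (t-partial≡ m) ⟩
      ∑ (suc m) (λ k → odd m * (legendre m k * evenProduct (odd m) k))
        ≡⟨ ∑-*ˡ (suc m) (odd m) _ ⟩
      odd m * ∑legendre m (evenProduct (odd m)) ∎
      where
      term : ∀ n → n < suc N → ι (2 ℕ.* n ℕ.+ 1) * ι (T n) * pow (- inv 3) n ≡ ∑ (suc N) (λ k → odd n * pow -1ℚ n * t-term n k)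
      term n (s≤s n≤N) = begin
        ι (2 ℕ.* n ℕ.+ 1) * ι (T n) * pow (- inv 3) n
          ≡⟨ cong₂ _*_ (cong₂ _*_ (ι-2k+1 n) (ι-T≡ N n n≤N)) (trans (cong (λ z → pow z n) (solve 1 (λ x → :- x := :- # 1 :* x) refl (inv 3))) (pow-* -1ℚ (inv 3) n)) ⟩
        odd n * (pow (ι 4) n * t) * (pow -1ℚ n * pow (inv 3) n)
          ≡⟨ solve 5 (λ o x t y s → o :* (x :* t) :* (s :* y) := x :* y :* (o :* s :* t)) refl (odd n) (pow (ι 4) n) t (pow (inv 3) n) (pow -1ℚ n) ⟩
        pow (ι 4) n * pow (inv 3) n * (odd n * pow -1ℚ n * t)
          ≡⟨ trans (cong (_* (odd n * pow -1ℚ n * t)) (pow-4-¼ n)) (*-identityˡ _) ⟩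
        odd n * pow -1ℚ n * t
          ≡⟨ ∑-*ˡ (suc N) (odd n * pow -1ℚ n) (t-term n) ⟨
        ∑ (suc N) (λ k → odd n * pow -1ℚ n * t-term n k) ∎
        where t = ∑ (suc N) (t-term n)
      inner : ∀ k → ∑ (suc N) (λ n → odd n * pow -1ℚ n * t-term n k) ≡ t-partial (suc N) k
      -- The number of terms 2m+1 is odd, so the outer minus sign cancels against (-1)^{2m+1}.
      inner k = trans (∑-±t-term (suc N) k) (trans (cong (λ z → - (-1ℚ * z * t-partial (suc N) k)) (pow-even m)) (solve 1 (λ x → :- (:- # 1 :* # 1 :* x) := x) refl (t-partial (suc N) k)))

  -- The exact remainder of `evenProduct p k` beyond its p² term, divided by p⁴. The recursion comes
  -- from multiplying the expansion by the next factor; keeping the remainder exact lets the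
  -- integrality argument be made separately.
  ρ : ℚ → ℕ → ℚ
  ρ p zero    = 0ℚ
  ρ p (suc k) = ρ p k * (1ℚ - sq p * (inv 3 * sq (inv k))) + sq (inv 3) * H₂ k * sq (inv k)

  evenProduct-expand : ∀ p k → evenProduct p k ≡ 1ℚ - sq p * inv 3 * H₂ k + sq (sq p) * ρ p k
  evenProduct-expand p zero    = solve 2 (λ p e → # 1 := # 1 :- p :* p :* e :* # 0 :+ p :* p :* (p :* p) :* # 0) refl p (inv 3)
  evenProduct-expand p (suc k) = trans (cong (_* (1ℚ - sq p * (inv 3 * sq (inv k)))) (evenProduct-expand p k))
    (solve 5 (λ p e h i ρ → (# 1 :- p :* p :* e :* h :+ p :* p :* (p :* p) :* ρ) :* (# 1 :- p :* p :* (e :* (i :* i)))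
      := # 1 :- p :* p :* e :* (h :+ i :* i) :+ p :* p :* (p :* p) :* (ρ :* (# 1 :- p :* p :* (e :* (i :* i))) :+ e :* e :* h :* (i :* i))) refl p (inv 3) (H₂ k) (inv k) (ρ p k))

  ∑-expand : ∀ n (w : ℕ → ℚ) p → ∑ n (λ k → w k * evenProduct p k) ≡ ∑ n (λ k → w k * one k) - sq p * inv 3 * ∑ n (λ k → w k * H₂ k) + sq (sq p) * ∑ n (λ k → w k * ρ p k)
  ∑-expand zero    w p = solve 2 (λ x y → # 0 := # 0 :- x :* # 0 :+ y :* # 0) refl (sq p * inv 3) (sq (sq p))
  ∑-expand (suc n) w p = trans (cong₂ (λ z t → z + w n * t) (∑-expand n w p) (evenProduct-expand p n))
    (solve 8 (λ A B C x y w h ρ → A :- x :* B :+ y :* C :+ w :* (# 1 :- x :* h :+ y :* ρ) := A :+ w :* # 1 :- x :* (B :+ w :* h) :+ y :* (C :+ w :* ρ)) refl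
      (∑ n (λ k → w k * one k)) (∑ n (λ k → w k * H₂ k)) (∑ n (λ k → w k * ρ p k)) (sq p * inv 3) (sq (sq p)) (w n) (H₂ n) (ρ p n))

  ∑legendre-expand : ∀ m p → ∑legendre m (evenProduct p) ≡ ∑legendre m one - sq p * inv 3 * ∑legendre m H₂ + sq (sq p) * ∑legendre m (ρ p)
  ∑legendre-expand m p = ∑-expand (suc m) (legendre m) p

  ∑legendre/odd-weight : ∀ m φ → ∑legendre/odd m φ ≡ ∑ (suc m) (λ k → legendre m k * inv (k ℕ.* 2) * φ k)
  ∑legendre/odd-weight m φ = ∑-cong′ (suc m) (λ k → solve 3 (λ x y z → x :* y :* z := x :* z :* y) refl (legendre m k) (φ k) (inv (k ℕ.* 2)))

  ∑legendre/odd-expand : ∀ m p → ∑legendre/odd m (evenProduct p) ≡ ∑legendre/odd m one - sq p * inv 3 * ∑legendre/odd m H₂ + sq (sq p) * ∑legendre/odd m (ρ p)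
  ∑legendre/odd-expand m p = trans (∑legendre/odd-weight m (evenProduct p)) (trans (∑-expand (suc m) (λ k → legendre m k * inv (k ℕ.* 2)) p)
    (sym (cong₂ _+_ (cong₂ (λ z w → z - sq p * inv 3 * w) (∑legendre/odd-weight m one) (∑legendre/odd-weight m H₂)) (cong (sq (sq p) *_) (∑legendre/odd-weight m (ρ p))))))

  ¼*2 : inv 3 * ι 2 ≡ ½
  ¼*2 = ι-cancel 1 (trans (solve 1 (λ e → # 2 :* (e :* # 2) := # 4 :* e) refl (inv 3)) (trans (ι-inv 3) (sym (ι-inv 1))))

  module Final (n : ℕ) (p-prime : Prime (5 ℕ.+ n ℕ.* 2)) where
    open Congruences n p-prime
    open Local p p-prime
    open Sums m using (sum-T/4ⁿ; sum-T/-4ⁿ)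

    e : ℚ
    e = inv 3

    int-¼ : Int (inv 3)
    int-¼ = int-inv 4<p

    int-H₂ : ∀ k → k ℕ.≤ m → Int (H₂ k)
    int-H₂ k k≤m = int-∑ k λ j j<k → int-sq (int-inv (ℕₚ.≤-<-trans (ℕₚ.≤-trans j<k k≤m) m<p))

    int-ρ : ∀ k → k ℕ.≤ m → Int (ρ π k)
    int-ρ zero    _   = int-0
    int-ρ (suc k) k<m = int-+ (int-* (int-ρ k k≤m) (int-- int-1 (int-* (int-sq int-π) (int-* int-¼ i²)))) (int-* (int-* (int-sq int-¼) (int-H₂ k k≤m)) i²)
      where
      k≤m = ℕₚ.≤-trans (ℕₚ.n≤1+n k) k<m
      i² = int-sq (int-inv (ℕₚ.≤-<-trans k<m m<p))

    int-legendre : ∀ k → k ℕ.≤ m → Int (legendre m k)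
    int-legendre k k≤m = int-* (int-* (int-* (int-pow (int-neg int-1) k) (int-fact (k ℕ.+ m))) (int-r k m<p)) (int-sq (int-rf (ℕₚ.≤-<-trans k≤m m<p)))

    -- 2k+1 ≤ p, with equality exactly at k = m, where the factor p cancels the denominator.
    int-π/odd : ∀ k → k ℕ.≤ m → Int (π * inv (k ℕ.* 2))
    int-π/odd k k≤m with ℕₚ.m≤n⇒m<n∨m≡n k≤m
    ... | inj₁ k<m  = int-* int-π (int-inv (s≤s (ℕₚ.*-monoˡ-< 2 k<m)))
    ... | inj₂ refl = int-resp (sym (ι-inv (m ℕ.* 2))) int-1

    int-∑legendre-ρ : Int (∑legendre m (ρ π))
    int-∑legendre-ρ = int-∑ (suc m) λ { k (s≤s k≤m) → int-* (int-legendre k k≤m) (int-ρ k k≤m) }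

    int-π∑legendre/odd-ρ : Int (π * ∑legendre/odd m (ρ π))
    int-π∑legendre/odd-ρ = int-resp (∑-*ˡ (suc m) π _) (int-∑ (suc m) λ { k (s≤s k≤m) →
      int-resp (solve 4 (λ p x y i → x :* y :* (p :* i) := p :* (x :* y :* i)) refl π (legendre m k) (ρ π k) (inv (k ℕ.* 2)))
        (int-* (int-* (int-legendre k k≤m) (int-ρ k k≤m)) (int-π/odd k k≤m)) })

    π*∑legendre/odd : π * ∑legendre/odd m (evenProduct π) ≡ 1ℚ + sq π * ½ * H₂ m + sq (sq π) * (π * ∑legendre/odd m (ρ π))
    π*∑legendre/odd = begin
      π * ∑legendre/odd m (evenProduct π)
        ≡⟨ cong (π *_) (∑legendre/odd-expand m π) ⟩
      π * (∑legendre/odd m one - sq π * e * ∑legendre/odd m H₂ + sq (sq π) * ∑legendre/odd m (ρ π))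
        ≡⟨ solve 5 (λ p e A B C → p :* (A :- p :* p :* e :* B :+ p :* p :* (p :* p) :* C) := p :* A :- p :* p :* e :* (p :* B) :+ p :* p :* (p :* p) :* (p :* C)) refl π e (∑legendre/odd m one) (∑legendre/odd m H₂) (∑legendre/odd m (ρ π)) ⟩
      π * ∑legendre/odd m one - sq π * e * (π * ∑legendre/odd m H₂) + sq (sq π) * (π * ∑legendre/odd m (ρ π))
        ≡⟨ cong₂ (λ z w → z - sq π * e * w + sq (sq π) * (π * ∑legendre/odd m (ρ π)))
            (trans (cong (_* ∑legendre/odd m one) π≡) (odd*∑legendre/odd-one m)) (trans (cong (_* ∑legendre/odd m H₂) π≡) (odd*∑legendre/odd-H₂ m)) ⟩
      1ℚ - sq π * e * - (ι 2 * H₂ m) + sq (sq π) * (π * ∑legendre/odd m (ρ π))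
        ≡⟨ solve 4 (λ p e h x → # 1 :- p :* p :* e :* :- (# 2 :* h) :+ x := # 1 :+ p :* p :* (e :* # 2) :* h :+ x) refl π e (H₂ m) _ ⟩
      1ℚ + sq π * (e * ι 2) * H₂ m + sq (sq π) * (π * ∑legendre/odd m (ρ π))
        ≡⟨ cong (λ z → 1ℚ + sq π * z * H₂ m + sq (sq π) * (π * ∑legendre/odd m (ρ π))) ¼*2 ⟩
      1ℚ + sq π * ½ * H₂ m + sq (sq π) * (π * ∑legendre/odd m (ρ π)) ∎

    sum₁ : ℚ
    sum₁ = ∑ p (λ k → ι (2 ℕ.* k ℕ.+ 1) * ι (T k) * pow (inv 3) k)

    -- The sum equals p + p³ `H₂ m`/2 + p⁵ `R` with `R` p-integral. Since `H₂ m` ≡ (7/3)pB modulo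
    -- p², the middle term is known modulo p⁵, and 7/6 is half of 7/3.
    ord-sum₁ : Ord 5 (sum₁ - (π + ι 7 * (½ * inv 2) * ι (p ℕ.^ 4) * bernoulli s))
    ord-sum₁ = ord-resp eq (ord-+
      (ord-π (ord-π (ord-π (ord-*ˡ (int-* (int-inv 2<p) (int-inv (ℕₚ.<-trans (ℕₚ.n<1+n 3) 4<p))) ord-H₂-bernoulli))))
      (ord-π (ord-π (ord-π (ord-π (ord-π (int⇒ord int-π∑legendre/odd-ρ)))))))
      where
      R = π * ∑legendre/odd m (ρ π)
      t = inv 2
      sum≡ : sum₁ ≡ π * (1ℚ + sq π * ½ * H₂ m + sq (sq π) * R)
      sum≡ = trans sum-T/4ⁿ (trans (cong (λ z → z * (z * ∑legendre/odd m (evenProduct z))) (sym π≡)) (cong (π *_) π*∑legendre/odd))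
      eq : π * (π * (π * (½ * inv 2 * (ι 3 * H₂ m - ι 7 * (π * bernoulli s))))) + π * (π * (π * (π * (π * R)))) ≡ sum₁ - (π + ι 7 * (½ * inv 2) * ι (p ℕ.^ 4) * bernoulli s)
      eq = begin
        π * (π * (π * (½ * t * (ι 3 * H₂ m - ι 7 * (π * bernoulli s))))) + π * (π * (π * (π * (π * R))))
          ≡⟨ solve 6 (λ p h t H B R → p :* (p :* (p :* (h :* t :* (# 3 :* H :- # 7 :* (p :* B))))) :+ p :* (p :* (p :* (p :* (p :* R))))
               := p :* (# 1 :+ p :* p :* h :* (# 3 :* t :* H) :+ p :* p :* (p :* p) :* R) :- (p :+ # 7 :* (h :* t) :* (p :* (p :* (p :* (p :* # 1)))) :* B)) refl π ½ t (H₂ m) (bernoulli s) R ⟩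
        π * (1ℚ + sq π * ½ * (ι 3 * t * H₂ m) + sq (sq π) * R) - (π + ι 7 * (½ * t) * pow π 4 * bernoulli s)
          ≡⟨ cong₂ (λ z w → π * (1ℚ + sq π * ½ * z + sq (sq π) * R) - (π + ι 7 * (½ * t) * w * bernoulli s)) (trans (cong (_* H₂ m) (ι-inv 2)) (*-identityˡ _)) (sym (ι-^ p 4)) ⟩
        π * (1ℚ + sq π * ½ * H₂ m + sq (sq π) * R) - (π + ι 7 * (½ * t) * ι (p ℕ.^ 4) * bernoulli s)
          ≡⟨ cong (_- (π + ι 7 * (½ * t) * ι (p ℕ.^ 4) * bernoulli s)) (sym sum≡) ⟩
        sum₁ - (π + ι 7 * (½ * t) * ι (p ℕ.^ 4) * bernoulli s) ∎

    sum₂ : ℚ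
    sum₂ = ∑ p (λ k → ι (2 ℕ.* k ℕ.+ 1) * ι (T k) * pow (- inv 3) k)

    -- The sum equals σp + p³ σ `A₂ m`/2 + p⁵ `R`, so the congruence of σ `A₂ m` with 2E modulo p
    -- suffices for p⁴.
    ord-sum₂ : Ord 4 (sum₂ - (pow -1ℚ m * π + ι (p ℕ.^ 3) * euler s))
    ord-sum₂ = ord-resp eq (ord-+
      (ord-π (ord-π (ord-π (ord-*ˡ (int-inv 2<p) ord-A₂-euler))))
      (ord-π (ord-π (ord-π (ord-π (int⇒ord (int-* int-π int-∑legendre-ρ)))))))
      where
      R = ∑legendre m (ρ π)
      σ = pow -1ℚ m
      sum≡ : sum₂ ≡ π * (σ + sq π * ½ * (σ * A₂ m) + sq (sq π) * R)
      sum≡ = begin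
        sum₂ ≡⟨ trans sum-T/-4ⁿ (cong (λ z → z * ∑legendre m (evenProduct z)) (sym π≡)) ⟩
        π * ∑legendre m (evenProduct π) ≡⟨ cong (π *_) (∑legendre-expand m π) ⟩
        π * (∑legendre m one - sq π * e * ∑legendre m H₂ + sq (sq π) * R)
          ≡⟨ cong₂ (λ z w → π * (z - sq π * e * w + sq (sq π) * R)) (∑legendre-one m) (∑legendre-H₂ m) ⟩
        π * (σ - sq π * e * - (ι 2 * (σ * A₂ m)) + sq (sq π) * R)
          ≡⟨ solve 5 (λ p e s x y → p :* (s :- p :* p :* e :* :- (# 2 :* x) :+ y) := p :* (s :+ p :* p :* (e :* # 2) :* x :+ y)) refl π e σ (σ * A₂ m) (sq (sq π) * R) ⟩
        π * (σ + sq π * (e * ι 2) * (σ * A₂ m) + sq (sq π) * R)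
          ≡⟨ cong (λ z → π * (σ + sq π * z * (σ * A₂ m) + sq (sq π) * R)) ¼*2 ⟩
        π * (σ + sq π * ½ * (σ * A₂ m) + sq (sq π) * R) ∎
      eq : π * (π * (π * (½ * (σ * A₂ m - ι 2 * euler s)))) + π * (π * (π * (π * (π * R)))) ≡ sum₂ - (σ * π + ι (p ℕ.^ 3) * euler s)
      eq = begin
        π * (π * (π * (½ * (σ * A₂ m - ι 2 * euler s)))) + π * (π * (π * (π * (π * R))))
          ≡⟨ solve 6 (λ p h s x E R → p :* (p :* (p :* (h :* (x :- # 2 :* E)))) :+ p :* (p :* (p :* (p :* (p :* R))))
               := p :* (s :+ p :* p :* h :* x :+ p :* p :* (p :* p) :* R) :- (s :* p :+ p :* (p :* (p :* # 1)) :* (# 2 :* h :* E))) refl π ½ σ (σ * A₂ m) (euler s) R ⟩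
        π * (σ + sq π * ½ * (σ * A₂ m) + sq (sq π) * R) - (σ * π + pow π 3 * (ι 2 * ½ * euler s))
          ≡⟨ cong₂ (λ z w → π * (σ + sq π * ½ * (σ * A₂ m) + sq (sq π) * R) - (σ * π + z * w)) (sym (ι-^ p 3)) (trans (cong (_* euler s) (ι-inv 1)) (*-identityˡ _)) ⟩
        π * (σ + sq π * ½ * (σ * A₂ m) + sq (sq π) * R) - (σ * π + ι (p ℕ.^ 3) * euler s)
          ≡⟨ cong (_- (σ * π + ι (p ℕ.^ 3) * euler s)) (sym sum≡) ⟩
        sum₂ - (σ * π + ι (p ℕ.^ 3) * euler s) ∎

    -- Passage to the definitions of the statement

    ord⇒den : ∀ {j x} (o : Ord j x) → x * ι (Int.den (Ord.int-quot o)) ≡ ι (p ℕ.^ j) * fromℤ (Int.num (Ord.int-quot o))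
    ord⇒den {j} (mkOrd c (mkInt v z p∤v cv≡z) x≡) = trans (cong (_* ι v) x≡) (trans (*-assoc _ c (ι v)) (cong₂ _*_ (sym (ι-^ p j)) cv≡z))

    opaque
      unfolding _+_

      ord⇒CongQ : ∀ {j} x y → Ord j (x - y) → CongQ x y p j
      ord⇒CongQ x y o = Int.num (Ord.int-quot o) , Int.den (Ord.int-quot o) , Int.p∤den (Ord.int-quot o) , ord⇒den o

      powℚ≡pow : ∀ x k → powℚ x k ≡ pow x k
      powℚ≡pow x zero    = refl
      powℚ≡pow x (suc k) = cong (x *_) (powℚ≡pow x k)

      Σ<≡∑ : ∀ x N → Σ< N (λ k → ℕtoℚ (2 ℕ.* k ℕ.+ 1) ℚ.* ℕtoℚ (T k) ℚ.* powℚ x k) ≡ ∑ N (λ k → ι (2 ℕ.* k ℕ.+ 1) * ι (T k) * pow x k)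
      Σ<≡∑ x N = trans (sum-map-upTo _ N) (∑-cong′ N (λ k → cong (ι (2 ℕ.* k ℕ.+ 1) * ι (T k) *_) (powℚ≡pow x k)))

      -- With the operations unfolded, closed rationals are compared by evaluation; in the same way
      -- 1/4 and -1/4 of the statement are identified with `inv 3` and `- inv 3`.
      7/6≡ : + 7 ℚ./ 6 ≡ ι 7 * (½ * inv 2)
      7/6≡ = refl

      congruence₁ : CongQ (Σ< p (λ k → ℕtoℚ (2 ℕ.* k ℕ.+ 1) ℚ.* ℕtoℚ (T k) ℚ.* powℚ (+ 1 ℚ./ 4) k))
                          (ℕtoℚ p ℚ.+ (+ 7 ℚ./ 6) ℚ.* ℕtoℚ (p ℕ.^ 4) ℚ.* bernoulli s) p 5
      congruence₁ = subst₂ (λ x y → CongQ x y p 5) (sym (Σ<≡∑ (inv 3) p))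
        (cong (λ z → π + z * ι (p ℕ.^ 4) * bernoulli s) (sym 7/6≡)) (ord⇒CongQ sum₁ (π + ι 7 * (½ * inv 2) * ι (p ℕ.^ 4) * bernoulli s) ord-sum₁)

      congruence₂ : CongQ (Σ< p (λ k → ℕtoℚ (2 ℕ.* k ℕ.+ 1) ℚ.* ℕtoℚ (T k) ℚ.* powℚ (-[1+ 0 ] ℚ./ 4) k))
                          (powℚ (-[1+ 0 ] ℚ./ 1) ((p ∸ 1) ℕ./ 2) ℚ.* ℕtoℚ p ℚ.+ ℕtoℚ (p ℕ.^ 3) ℚ.* euler s) p 4
      congruence₂ = subst₂ (λ x y → CongQ x y p 4) (sym (Σ<≡∑ (- inv 3) p))
        (cong (λ z → z * π + ι (p ℕ.^ 3) * euler s) (sym (trans (powℚ≡pow -1ℚ ((p ∸ 1) ℕ./ 2)) (cong (pow -1ℚ) (DivMod.m*n/n≡m m 2))))) (ord⇒CongQ sum₂ (pow -1ℚ m * π + ι (p ℕ.^ 3) * euler s) ord-sum₂)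

  parity : ∀ n → ∃ λ k → n ≡ k ℕ.* 2 ⊎ n ≡ suc (k ℕ.* 2)
  parity zero    = 0 , inj₁ refl
  parity (suc n) with parity n
  ... | k , inj₁ refl = k , inj₂ refl
  ... | k , inj₂ refl = suc k , inj₁ refl

  prime>3⇒5+2n : ∀ p → Prime p → 3 < p → ∃ λ n → p ≡ 5 ℕ.+ n ℕ.* 2
  prime>3⇒5+2n (suc (suc (suc (suc p)))) p-prime (s≤s (s≤s (s≤s (s≤s z≤n)))) with parity p
  ... | k , inj₂ refl = k , refl
  -- Here the prime would be 4 + 2k = (2 + k)·2, an even number other than 2.
  ... | k , inj₁ refl with prime⇒irreducible p-prime {2} (divides (2 ℕ.+ k) refl)
  ...   | inj₁ ()
  ...   | inj₂ ()

open import Defs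
open import Data.Nat using (ℕ; _<_; _∸_; _/_)
open import Data.Nat.Primality using (Prime)
open import Data.Integer using (+_; -[1+_])
open import Data.Rational using (_+_; _*_; _/_)
open import Data.Product using (_×_; _,_)
open import Relation.Binary.PropositionalEquality using (refl)

theorem1p2 : (p : ℕ) → Prime p → 3 < p →
    CongQ (Σ< p (λ k → ℕtoℚ (2 Data.Nat.* k Data.Nat.+ 1) * ℕtoℚ (T k) * powℚ ((+ 1) Data.Rational./ 4) k))
    (ℕtoℚ p + ((+ 7) Data.Rational./ 6) * ℕtoℚ (p Data.Nat.^ 4) * bernoulli (p ∸ 3))
    p 5
    ×
    CongQ (Σ< p (λ k → ℕtoℚ (2 Data.Nat.* k Data.Nat.+ 1) * ℕtoℚ (T k) * powℚ (-[1+ 0 ] Data.Rational./ 4) k))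
    (powℚ (-[1+ 0 ] Data.Rational./ 1) ((p ∸ 1) Data.Nat./ 2) * ℕtoℚ p + ℕtoℚ (p Data.Nat.^ 3) * euler (p ∸ 3))
    p 4
theorem1p2 p p-prime 3<p with Proof.prime>3⇒5+2n p p-prime 3<p
... | n , refl = Proof.Final.congruence₁ n p-prime , Proof.Final.congruence₂ n p-prime
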